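{- There is an algorithm which, given a finite set $\Sigma$, a candidate data structure $C$ for an antimatroid $A$ on $\Sigma$, and a comparison oracle for a total order $\pi\in\mathcal{P}(A)$, sorts $\Sigma$ with respect to $\prec_\pi$ (that is, outputs $\pi$) in time $\mathcal{O}(t^{\mathrm{total}}(C)+\log|\mathcal{P}(A)|)$ and with $\mathcal{O}(\log|\mathcal{P}(A)|)$ comparisons.
   Context: Model: word RAM; a comparison oracle for $\pi$ answers queries "$x\prec_\pi y$?" in constant time, and each query is one comparison. Logarithms are base 2 and constants in $\mathcal{O}(\cdot)$ are absolute. A simple word on $\Sigma$ is a finite sequence of pairwise distinct letters of $\Sigma$; $\tilde\alpha$ is the set of letters of $\alpha$; $\Sigma^*_{\mathrm{s}}$ is the set of simple words. An antimatroid on $\Sigma$ is a set $A\subseteq\Sigma^*_{\mathrm{s}}$ such that (i) if $\alpha x\in A$ with $\alpha\in\Sigma^*_{\mathrm{s}}$, $x\in\Sigma\setminus\tilde\alpha$, then $\alpha\in A$; and (ii) for all $\alpha,\beta\in A$ with $\tilde\alpha\not\subseteq\tilde\beta$ there is $x\in\tilde\alpha\setminus\tilde\beta$ with $\beta x\in A$. $\mathcal{P}(A)$ is the set of permutations of $\Sigma$ (simple words containing all letters) belonging to $A$. A permutation $\pi$ is identified with the total order $\prec_\pi$, where $x\prec_\pi y$ iff $x$ precedes $y$ in $\pi$. A monotone precedence system (MPS) on $\Sigma$ is a collection $S=\{p_x\}_{x\in\Sigma}$ of functions $p_x\colon2^{\Sigma\setminus\{x\}}\to\{0,1\}$ with $p_x(X)\le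 p_x(Y)$ whenever $X\subseteq Y$; its language is $\mathcal{L}(S)=\{x_1\dots x_k\in\Sigma^*_{\mathrm{s}}\mid\forall i\in[k]:p_{x_i}(\{x_1,\dots,x_{i-1}\})=1\}$. The nonempty antimatroids on $\Sigma$ are exactly the languages of MPSs. A candidate data structure $C$ for an antimatroid $A=\mathcal{L}(S)$, $S=\{p_x\}_{x\in\Sigma}$, maintains a set $X\subseteq\Sigma$ and supports: $C.\mathtt{init}()$, which sets $X\gets\emptyset$ and reports all $x\in\Sigma$ with $p_x(\emptyset)=1$; and $C.\mathtt{step}(x)$, which, given $x\in\Sigma\setminus X$ with $p_x(X)=1$, reports all $y\in\Sigma$ that were not available before and become available, i.e. with $p_y(X)=0$ and $p_y(X\cup\{x\})=1$, and then adds $x$ to $X$. The total time $t^{\mathrm{total}}(C)$ is the worst-case overall time for one call to $\mathtt{init}$ followed by any valid sequence of $\mathtt{step}$ calls. -}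

module Defs where

open import Data.Nat using (ℕ; zero; suc; _+_; _*_; _∸_; _^_; _≤_; _<_; _<ᵇ_; _≡ᵇ_; _/_; _%_; _⊔_)
open import Data.Nat.Properties using (m^n≢0)
open import Data.Bool as Bool using (Bool; true; false; if_then_else_)
open import Data.Fin using (Fin; toℕ)
import Data.Fin.Properties as Fin
import Data.Fin.Subset as Sub
open Sub using (Subset)
open import Data.List using (List; []; _∷_; _++_; _∷ʳ_; map; concatMap; filter; length; lookup; take; allFin; upTo)
open import Data.List.Extrema.Nat using (max)
open import Data.List.Membership.Propositional using (_∈_; _∉_)
open import Data.List.Relation.Binary.Subset.Propositional using (_⊆_)
open import Data.List.Relation.Unary.Unique.Propositional using (Unique)
import Data.List.Membership.DecPropositional as DecMembership
import Data.List.Relation.Unary.Unique.DecPropositional as DecUnique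
open import Data.Maybe using (Maybe; just; nothing)
open import Data.Product using (∃-syntax; _×_; _,_)
open import Function.Bundles using (_⇔_)
open import Relation.Binary.PropositionalEquality using (_≡_; _≢_)
open import Relation.Nullary using (¬_)
open import Relation.Nullary.Decidable using (_×-dec_)
open import Relation.Unary using (Pred; Decidable)
open import Level using (0ℓ)

------------------------------------------------------------------------
-- Words over Σ = Fin n.  The first letter of a word is the head of the
-- list, so αx is α ∷ʳ x; a word is simple when it is Unique.

Word : ℕ → Set
Word n = List (Fin n)

letters : ∀ {n} → Word n → Subset n
letters α = Sub.⋃ (map Sub.⁅_⁆ α)

wordsOfLength : ∀ n → ℕ → List (Word n)
wordsOfLength n zero    = [] ∷ []
wordsOfLength n (suc k) = concatMap (λ x → map (x ∷_) (wordsOfLength n k)) (allFin n)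

-- Contains every simple word, as simple words have length at most n.
shortWords : ∀ n → List (Word n)
shortWords n = concatMap (wordsOfLength n) (upTo (suc n))

------------------------------------------------------------------------
-- Antimatroids and monotone precedence systems

-- Decidability of Lang is automatic classically; here it makes
-- ∣𝓟 A ∣ computable.
record Antimatroid (n : ℕ) : Set₁ where
  field
    Lang     : Pred (Word n) 0ℓ
    Lang?    : Decidable Lang
    simple   : ∀ {α} → Lang α → Unique α
    prefix   : ∀ α x → Unique α → x ∉ α → Lang (α ∷ʳ x) → Lang α
    exchange : ∀ α β → Lang α → Lang β → ¬ (α ⊆ β) →
               ∃[ x ] (x ∈ α × x ∉ β × Lang (β ∷ʳ x))

open Antimatroid public using (Lang; Lang?)

𝓟 : ∀ {n} → Antimatroid n → Pred (Word n) 0ℓ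
𝓟 A π = Lang A π × (∀ x → x ∈ π)

𝓟? : ∀ {n} (A : Antimatroid n) → Decidable (𝓟 A)
𝓟? A π = Lang? A π ×-dec Fin.all? (λ x → DecMembership._∈?_ Fin._≟_ x π)

∣𝓟_∣ : ∀ {n} → Antimatroid n → ℕ
∣𝓟_∣ {n} A = length (filter (𝓟? A) (shortWords n))

-- The domain of p x is the set of X with x ∉ X.  Here p x is total, but
-- its values at sets containing x are unconstrained and never used.
record MPS (n : ℕ) : Set where
  field
    p    : Fin n → Subset n → Bool
    mono : ∀ x {X Y} → x Sub.∉ Y → X Sub.⊆ Y → p x X Bool.≤ p x Y

open MPS public using (p)

𝓛 : ∀ {n} → MPS n → Pred (Word n) 0ℓ
𝓛 S α = Unique α ×
  (∀ (i : Fin (length α)) → p S (lookup α i) (letters (take (toℕ i) α)) ≡ true)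

𝓛? : ∀ {n} (S : MPS n) → Decidable (𝓛 S)
𝓛? S α = DecUnique.unique? Fin._≟_ α ×-dec Fin.all? (λ i → _ Bool.≟ true)

------------------------------------------------------------------------
-- Candidate data structures

-- A candidate data structure is a black box.  Its internal state is
-- represented by the word of letters passed to step since the last
-- init, so X = letters α in state α; no other property of the
-- implementation is visible to its user.  stepReports α x and
-- stepTime α x describe the call step(x) in state α, and are
-- unspecified unless that call is valid, i.e. unless αx ∈ 𝓛 S.
-- A call takes at least one unit of time, plus one per reported letter.
record Candidate {n : ℕ} (S : MPS n) : Set where
  field
    initReports : List (Fin n)
    initTime    : ℕ
    stepReports : Word n → Fin n → List (Fin n)
    stepTime    : Word n → Fin n → ℕ

    init-unique  : Unique initReports
    init-correct : ∀ y → y ∈ initReports ⇔ p S y Sub.⊥ ≡ true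
    init-cost    : length initReports < initTime

    step-unique  : ∀ α x → 𝓛 S (α ∷ʳ x) → Unique (stepReports α x)
    step-correct : ∀ α x → 𝓛 S (α ∷ʳ x) → ∀ y →
      y ∈ stepReports α x ⇔
        (y ∉ α ∷ʳ x × p S y (letters α) ≡ false × p S y (letters (α ∷ʳ x)) ≡ true)
    step-cost    : ∀ α x → 𝓛 S (α ∷ʳ x) → length (stepReports α x) < stepTime α x

  stepsTime : Word n → Word n → ℕ
  stepsTime α []      = 0
  stepsTime α (x ∷ β) = stepTime α x + stepsTime (α ∷ʳ x) β

  sessionTime : Word n → ℕ
  sessionTime α = initTime + stepsTime [] α

open Candidate public using (initReports; initTime; stepReports; stepTime; sessionTime)

-- The valid step sequences are exactly the words of 𝓛 S.
tᵗᵒᵗᵃˡ : ∀ {n} {S : MPS n} → Candidate S → ℕ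
tᵗᵒᵗᵃˡ {n} {S} C = max 0 (map (sessionTime C) (filter (𝓛? S) (shortWords n)))

------------------------------------------------------------------------
-- Word RAM programs

-- Registers and arrays are named by numerals occurring in the program
-- text, so a program uses a constant number of each; an array has one
-- cell for every address that fits in a machine word.

data Op : Set where
  add sub mul div mod shl shr band bor bxor eq lt : Op

infix 8 _[_]

data Expr : Set where
  lit : ℕ → Expr
  reg : ℕ → Expr
  _[_] : ℕ → Expr → Expr
  op  : Op → Expr → Expr → Expr

infixr 5 _⨾_
infix  6 _:=_ _[_]:=_

data Cmd : Set where
  skip    : Cmd
  _:=_    : ℕ → Expr → Cmd
  _[_]:=_ : ℕ → Expr → Expr → Cmd
  _⨾_     : Cmd → Cmd → Cmd
  ifz     : Expr → Cmd → Cmd → Cmd   -- first branch iff the value is zero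
  while   : Expr → Cmd → Cmd         -- loops as long as the value is nonzero
  -- compare d e f: register d receives 1 if e ≺ f, and 0 otherwise
  compare : ℕ → Expr → Expr → Cmd
  -- init d a, step e d a: array a receives the reported letters (from
  -- index 0 on), register d their number
  init    : ℕ → ℕ → Cmd
  step    : Expr → ℕ → ℕ → Cmd

size : Expr → ℕ
size (lit k)    = 1
size (reg r)    = 1
size (a [ e ])  = suc (size e)
size (op o e f) = suc (size e + size f)

update : {A : Set} → (ℕ → A) → ℕ → A → ℕ → A
update f i v j = if i ≡ᵇ j then v else f j

writeFrom : ∀ {n} → ℕ → List (Fin n) → (ℕ → ℕ) → ℕ → ℕ
writeFrom i []       f = f
writeFrom i (x ∷ xs) f = writeFrom (suc i) xs (update f i (toℕ x))

Precedes : ∀ {n} → Word n → Fin n → Fin n → Set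
Precedes π x y = ∃[ α ] ∃[ β ] ∃[ γ ] π ≡ α ++ x ∷ β ++ y ∷ γ

-- history is the state of the candidate data structure, which is
-- nothing before the first init.
record State (n : ℕ) : Set where
  constructor ⟪_,_,_⟫
  field
    regs    : ℕ → ℕ
    arrays  : ℕ → ℕ → ℕ
    history : Maybe (Word n)

open State public

start : ∀ n → State n
start n = ⟪ update (λ _ → 0) 0 n , (λ _ _ → 0) , nothing ⟫

-- A sorting program returns its result in array 0.
Outputs : ∀ {n} → State n → Word n → Set
Outputs σ π = ∀ (i : Fin (length π)) → arrays σ 0 (toℕ i) ≡ toℕ (lookup π i)

-- Machine words are the naturals below 2 ^ w; a letter x is the word toℕ x.
module WordRAM (w : ℕ) where

  trunc : ℕ → ℕ
  trunc x = _%_ x (2 ^ w) {{m^n≢0 2 w}}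

  bitwise : (ℕ → ℕ → ℕ) → ℕ → ℕ → ℕ → ℕ
  bitwise f zero    x y = 0
  bitwise f (suc k) x y = f (x % 2) (y % 2) + 2 * bitwise f k (x / 2) (y / 2)

  ⟦_⟧ : Op → ℕ → ℕ → ℕ
  ⟦ add ⟧ x y       = trunc (x + y)
  ⟦ sub ⟧ x y       = trunc (x + (2 ^ w ∸ y))
  ⟦ mul ⟧ x y       = trunc (x * y)
  ⟦ div ⟧ x zero    = 0
  ⟦ div ⟧ x (suc y) = x / suc y
  ⟦ mod ⟧ x zero    = 0
  ⟦ mod ⟧ x (suc y) = x % suc y
  ⟦ shl ⟧ x y       = trunc (x * 2 ^ y)
  ⟦ shr ⟧ x y       = _/_ x (2 ^ y) {{m^n≢0 2 y}}
  ⟦ band ⟧ x y      = bitwise _*_ w x y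
  ⟦ bor ⟧ x y       = bitwise _⊔_ w x y
  ⟦ bxor ⟧ x y      = bitwise (λ a b → (a + b) % 2) w x y
  ⟦ eq  ⟧ x y       = trunc (if x ≡ᵇ y then 1 else 0)
  ⟦ lt  ⟧ x y       = trunc (if x <ᵇ y then 1 else 0)

  eval : ∀ {n} → State n → Expr → ℕ
  eval σ (lit k)    = trunc k
  eval σ (reg r)    = regs σ r
  eval σ (a [ e ])  = arrays σ a (eval σ e)
  eval σ (op o e f) = ⟦ o ⟧ (eval σ e) (eval σ f)

  setReg : ∀ {n} → ℕ → ℕ → State n → State n
  setReg d v σ = record σ { regs = update (regs σ) d v }

  setCell : ∀ {n} → ℕ → ℕ → ℕ → State n → State n
  setCell a i v σ = record σ { arrays = update (arrays σ) a (update (arrays σ a) i v) }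

  receive : ∀ {n} → List (Fin n) → Word n → ℕ → ℕ → State n → State n
  receive xs α d a σ =
    ⟪ update (regs σ) d (trunc (length xs))
    , update (arrays σ) a (writeFrom 0 xs (arrays σ a))
    , just α ⟫

  -- Run C π c σ σ′ t q: from σ, with data structure C and comparison
  -- oracle π, c terminates in σ′, in time t (including the time spent by
  -- C) and with q comparisons.  Invalid calls of step, and comparisons of
  -- words that are not letters, get stuck.
  data Run {n} {S : MPS n} (C : Candidate S) (π : Word n) :
           Cmd → State n → State n → ℕ → ℕ → Set where

    skip : ∀ {σ} → Run C π skip σ σ 1 0

    assign : ∀ {σ d e} →
      Run C π (d := e) σ (setReg d (eval σ e) σ) (suc (size e)) 0

    store : ∀ {σ a e f} →
      Run C π (a [ e ]:= f) σ (setCell a (eval σ e) (eval σ f) σ)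
          (suc (size e + size f)) 0

    seq : ∀ {σ σ′ σ″ c c′ t t′ q q′} →
      Run C π c σ σ′ t q → Run C π c′ σ′ σ″ t′ q′ →
      Run C π (c ⨾ c′) σ σ″ (t + t′) (q + q′)

    if-zero : ∀ {σ σ′ e c c′ t q} → eval σ e ≡ 0 →
      Run C π c σ σ′ t q → Run C π (ifz e c c′) σ σ′ (suc (size e + t)) q

    if-nonzero : ∀ {σ σ′ e c c′ t q} → eval σ e ≢ 0 →
      Run C π c′ σ σ′ t q → Run C π (ifz e c c′) σ σ′ (suc (size e + t)) q

    while-done : ∀ {σ e c} → eval σ e ≡ 0 →
      Run C π (while e c) σ σ (suc (size e)) 0

    while-loop : ∀ {σ σ′ σ″ e c t t′ q q′} → eval σ e ≢ 0 →
      Run C π c σ σ′ t q → Run C π (while e c) σ′ σ″ t′ q′ →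
      Run C π (while e c) σ σ″ (suc (size e + t + t′)) (q + q′)

    compare-yes : ∀ {σ d e f} x y → eval σ e ≡ toℕ x → eval σ f ≡ toℕ y →
      Precedes π x y →
      Run C π (compare d e f) σ (setReg d (trunc 1) σ) (suc (size e + size f)) 1

    compare-no : ∀ {σ d e f} x y → eval σ e ≡ toℕ x → eval σ f ≡ toℕ y →
      ¬ Precedes π x y →
      Run C π (compare d e f) σ (setReg d 0 σ) (suc (size e + size f)) 1

    init : ∀ {σ d a} →
      Run C π (init d a) σ (receive (initReports C) [] d a σ) (suc (initTime C)) 0

    step : ∀ {σ e d a} α x → history σ ≡ just α → eval σ e ≡ toℕ x →
      𝓛 S (α ∷ʳ x) →
      Run C π (step e d a) σ (receive (stepReports C α x) (α ∷ʳ x) d a σ)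
          (suc (size e + stepTime C α x)) 0

open WordRAM public using (Run)

------------------------------------------------------------------------
-- Logarithmic bounds

-- t ≤ c · (T + log₂ N), for N ≥ 1, with both sides exponentiated.
_≤_·⟨_+log₂_⟩ : ℕ → ℕ → ℕ → ℕ → Set
t ≤ c ·⟨ T +log₂ N ⟩ = 2 ^ t ≤ (2 ^ T * N) ^ c

{-# OPTIONS --safe #-}
module Submission where

-- Sorting means to extract, again and again, the ≺-least available letter.  Let N = ∣𝓟 A ∣.
-- A first session steps through the letters in FIFO order.  A letter that is alone in the queue
-- precedes all unprocessed letters in every permutation in 𝓟 A, so these forced letters are found
-- in sorted order.  Any other letter can be swapped with the next one, whence their number k
-- satisfies 2 ^ k ≤ N ².
-- The second session follows π.  The available free (that is, not forced) letters are kept in a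
-- heap, and when a letter becomes available, its rank among the forced letters is found by
-- exponential search; so the least letter of the heap need not be compared with the next forced
-- letter.  If y waits for len y letters of π, the search takes O(1 + log (len y)) steps.  So does,
-- amortised, the heap, in which sorted runs of doubling sizes are merged: of s letters in the heap
-- at the same time, half wait for at least s / 2 letters.  Finally, ∏ len y ≤ N · 4 ^ k, since the
-- free letters may be moved independently to earlier slots, so that k + Σ log (len y) = O(log N).

-- The obstacle is that `n` may be far larger than `log N`: a forced letter must not cost a single
-- comparison, and no letter may cost time logarithmic in `n`. So the forced letters are recognised
-- without the oracle, and the choice between them and the heap compares two machine words, the
-- number of forced letters output so far and the rank stored for the top of the heap.
--
-- All other costs are charged to free letters. The level of a letter in the heap depends on its
-- company rather than on its own waiting time. The amortisation therefore replaces the level `i` of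
-- `y` by `i ⊓ cap y`, where `cap y` is the logarithm of its waiting time up to a constant, and this
-- loses only a factor 2. Everything then rests on `2 ^ future π ≤ N ^ 9`, where `future π` sums
-- `cap` over the free letters.
--
-- Budgets are counted in units of at most `K` steps. Units that may contain a comparison are
-- counted apart, so that one number bounds both the comparisons and the logarithmic part of the
-- time. In the constant `(50 + 9 * 45) * K`, 50 pays for the two sessions and 45 for each unit of
-- `cap`.

open import Defs
open import Data.Nat as ℕ hiding (_≡ᵇ_; _<ᵇ_; compare)
open import Data.Nat.Properties
open import Data.Nat.DivMod using (m<n⇒m%n≡m; [m+n]%n≡m%n; m*n/n≡m)
open import Data.Bool as Bool using (Bool; true; false; if_then_else_; _∨_)
open import Data.Bool.Properties using (T-≡)
open import Data.Unit using (⊤; tt)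
open import Data.Fin using (Fin; toℕ; zero; suc)
import Data.Fin.Properties as Fin
import Data.Fin.Subset as Sub
import Data.Fin.Subset.Properties as Sub
open import Data.List hiding ([_]; merge; or; and; any; all)
open import Data.List.Properties
open import Data.List.Extrema.Nat using (v≤max⁺)
open import Data.List.Membership.Propositional using (_∈_; _∉_)
open import Data.List.Membership.Propositional.Properties
import Data.List.Membership.DecPropositional as DecMembership
open import Data.List.Relation.Binary.Pointwise using (Pointwise; []; _∷_)
open import Data.List.Relation.Unary.Any as Any using (Any; here; there)
open import Data.List.Relation.Unary.All as All using (All; []; _∷_)
import Data.List.Relation.Unary.All.Properties as All
open import Data.List.Relation.Unary.AllPairs as AllPairs using (AllPairs; []; _∷_)
import Data.List.Relation.Unary.AllPairs.Properties as AllPairsₚ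
open import Data.List.Relation.Unary.Unique.Propositional using (Unique)
import Data.List.Relation.Unary.Unique.Propositional.Properties as Unique
open import Data.Maybe using (Maybe; just; nothing)
open import Data.Product using (Σ-syntax; ∃₂; ∃-syntax; _×_; _,_; proj₁; proj₂; uncurry)
open import Data.Sum using (_⊎_; inj₁; inj₂)
open import Data.Empty using (⊥; ⊥-elim)
open import Function using (_∘_; id; case_of_)
open import Function.Bundles using (module Equivalence)
open import Relation.Binary.PropositionalEquality hiding ([_])
open import Relation.Nullary
open import Relation.Nullary.Decidable using (True; toWitness)
open import Relation.Unary using (_≐_)
open import Data.Nat.Tactic.RingSolver using (solve-∀)
open import Data.List.Relation.Binary.Permutation.Propositional
  using (_↭_; ↭-refl; ↭-sym; ↭-trans; ↭-reflexive; ↭⇒↭ₛ; prep; swap)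
open import Data.List.Relation.Binary.Permutation.Propositional.Properties
  using (All-resp-↭; ∈-resp-↭; ↭-length; shift; ++⁺ˡ; ++⁺ʳ)
import Data.List.Relation.Binary.Permutation.Setoid.Properties as Permutationₛ

-- Words and permutations

infix 4 _∈?_
_∈?_ : ∀ {n} (x : Fin n) (xs : Word n) → Dec (x ∈ xs)
_∈?_ = DecMembership._∈?_ Fin._≟_

∈-split : ∀ {A : Set} {x : A} {xs} → x ∈ xs → ∃₂ λ u v → xs ≡ u ++ x ∷ v
∈-split {xs = _ ∷ xs} (here refl) = [] , xs , refl
∈-split {xs = y ∷ _} (there p) with ∈-split p
... | u , v , refl = y ∷ u , v , refl

∈-swap : ∀ {A : Set} {x z : A} u {v} → z ∈ u ++ x ∷ v → z ≢ x → z ∈ u ++ v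
∈-swap u p z≢x with ∈-++⁻ u p
... | inj₁ q = ∈-++⁺ˡ q
... | inj₂ (here q) = ⊥-elim (z≢x q)
... | inj₂ (there q) = ∈-++⁺ʳ u q

unique-⊆-length : ∀ {A : Set} {xs ys : List A} → Unique xs →
                  (∀ {x} → x ∈ xs → x ∈ ys) → length xs ≤ length ys
unique-⊆-length {xs = []} _ _ = z≤n
unique-⊆-length {xs = x ∷ xs} {ys} (x∉ ∷ uq) inc with ∈-split (inc (here refl))
... | u , v , refl = subst (suc (length xs) ≤_)
        (sym (trans (length-++ u) (trans (+-suc _ _) (cong suc (sym (length-++ u))))))
        (s≤s (unique-⊆-length uq λ {z} z∈ → ∈-swap u (inc (there z∈)) λ z≡x → All.lookup x∉ z∈ (sym z≡x)))

module _ {A : Set} where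

  unique-++ˡ : ∀ (u : List A) {v} → Unique (u ++ v) → Unique u
  unique-++ˡ [] _ = []
  unique-++ˡ (_ ∷ u) (px ∷ uq) = All.++⁻ˡ u px ∷ unique-++ˡ u uq

  unique-++ʳ : ∀ (u : List A) {v} → Unique (u ++ v) → Unique v
  unique-++ʳ [] uq = uq
  unique-++ʳ (_ ∷ u) (_ ∷ uq) = unique-++ʳ u uq

  unique-++-disjoint : ∀ (u : List A) {v x} → Unique (u ++ v) → x ∈ u → x ∉ v
  unique-++-disjoint (_ ∷ u) (px ∷ uq) (here refl) x∈v = All.lookup (All.++⁻ʳ u px) x∈v refl
  unique-++-disjoint (_ ∷ u) (px ∷ uq) (there x∈u) x∈v = unique-++-disjoint u uq x∈u x∈v

  unique-middle : ∀ (u : List A) {v x} → Unique (u ++ x ∷ v) → x ∉ u × x ∉ v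
  unique-middle u uq = (λ x∈u → unique-++-disjoint u uq x∈u (here refl))
    , Unique.Unique[x∷xs]⇒x∉xs (unique-++ʳ u uq)

  unique-∷ʳ : ∀ {u : List A} {x} → Unique u → x ∉ u → Unique (u ∷ʳ x)
  unique-∷ʳ uq x∉ = Unique.++⁺ uq ([] ∷ []) λ { (p , here refl) → x∉ p }

  ∈-∷ʳ⁻ : ∀ (u : List A) {x z} → z ∈ u ∷ʳ x → z ∈ u ⊎ z ≡ x
  ∈-∷ʳ⁻ u p with ∈-++⁻ u p
  ... | inj₁ q = inj₁ q
  ... | inj₂ (here q) = inj₂ q

  ∷ʳ-split : ∀ (α : List A) {x y} u v → α ∷ʳ x ≡ u ++ y ∷ v →
             (α ≡ u × x ≡ y) ⊎ ∃[ v′ ] α ≡ u ++ y ∷ v′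
  ∷ʳ-split [] [] _ refl = inj₁ (refl , refl)
  ∷ʳ-split [] (_ ∷ []) _ ()
  ∷ʳ-split [] (_ ∷ _ ∷ _) _ ()
  ∷ʳ-split (a ∷ α) [] v refl = inj₂ (α , refl)
  ∷ʳ-split (a ∷ α) (_ ∷ u) v e≡ with ∷-injective e≡
  ... | refl , e≡′ with ∷ʳ-split α u v e≡′
  ... | inj₁ (refl , p) = inj₁ (refl , p)
  ... | inj₂ (v′ , refl) = inj₂ (v′ , refl)

module _ {n : ℕ} where

  ∈-letters⁺ : ∀ {x : Fin n} {α} → x ∈ α → x Sub.∈ letters α
  ∈-letters⁺ (here refl) = Sub.x∈p∪q⁺ (inj₁ (Sub.x∈⁅x⁆ _))
  ∈-letters⁺ (there p) = Sub.x∈p∪q⁺ (inj₂ (∈-letters⁺ p))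

  ∈-letters⁻ : ∀ {x : Fin n} α → x Sub.∈ letters α → x ∈ α
  ∈-letters⁻ [] p = ⊥-elim (Sub.∉⊥ p)
  ∈-letters⁻ (y ∷ α) p with Sub.x∈p∪q⁻ Sub.⁅ y ⁆ (letters α) p
  ... | inj₁ q = here (Sub.x∈⁅y⁆⇒x≡y y q)
  ... | inj₂ q = there (∈-letters⁻ α q)

  Avail : MPS n → Word n → Fin n → Set
  Avail S u y = p S y (letters u) ≡ true

  avail? : ∀ S u y → Dec (Avail S u y)
  avail? S u y = p S y (letters u) Bool.≟ true

  avail-mono : ∀ S {u v y} → (∀ {z} → z ∈ u → z ∈ v) → y ∉ v → Avail S u y → Avail S v y
  avail-mono S {u} {v} {y} inc y∉ av = helper (MPS.mono S y {letters u} {letters v}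
    (y∉ ∘ ∈-letters⁻ v) (λ q → ∈-letters⁺ (inc (∈-letters⁻ u q)))) av
    where
    helper : ∀ {a b} → a Bool.≤ b → a ≡ true → b ≡ true
    helper Bool.b≤b e≡ = e≡
    helper Bool.f≤t ()

  split-at : ∀ {A : Set} (σ : List A) (i : Fin (length σ)) →
             σ ≡ take (toℕ i) σ ++ lookup σ i ∷ drop (suc (toℕ i)) σ
  split-at (x ∷ σ) zero = refl
  split-at (x ∷ σ) (suc i) = cong (x ∷_) (split-at σ i)

  at-split : ∀ {A : Set} (u : List A) {y v} → Σ[ i ∈ Fin (length (u ++ y ∷ v)) ]
             lookup (u ++ y ∷ v) i ≡ y × take (toℕ i) (u ++ y ∷ v) ≡ u
  at-split [] = zero , refl , refl
  at-split (x ∷ u) {y} {v} with at-split u {y} {v}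
  ... | i , p , q = suc i , p , cong (x ∷_) q

  -- Together with `𝓛-intro`, this replaces the indices in the definition of `𝓛` by splittings
  -- `u ++ y ∷ v`, the form in which words are handled from here on.
  𝓛-avail : ∀ S {σ : Word n} → 𝓛 S σ → ∀ u {y v} → σ ≡ u ++ y ∷ v → Avail S u y
  𝓛-avail S (_ , av) u {y} {v} refl with at-split u {y} {v}
  ... | i , p , q = subst₂ (λ a b → Avail S a b) q p (av i)

  𝓛-intro : ∀ S {σ : Word n} → Unique σ →
            (∀ u y v → σ ≡ u ++ y ∷ v → Avail S u y) → 𝓛 S σ
  𝓛-intro S {σ} uq av = uq , λ i → av _ _ _ (split-at σ i)

  𝓛-∷ʳ : ∀ S {α x} → 𝓛 S α → x ∉ α → Avail S α x → 𝓛 S (α ∷ʳ x)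
  𝓛-∷ʳ S {α} {x} Lα x∉ av = 𝓛-intro S (unique-∷ʳ (proj₁ Lα) x∉) λ u y v e≡ →
    case ∷ʳ-split α u v e≡ of λ
      { (inj₁ (refl , refl)) → av
      ; (inj₂ (_ , refl)) → 𝓛-avail S Lα u refl }

  𝓛-prefix : ∀ S u {v} → 𝓛 S (u ++ v) → 𝓛 S u
  𝓛-prefix S u {v} L = 𝓛-intro S (unique-++ˡ u (proj₁ L)) λ u₁ y v₁ e≡ →
    𝓛-avail S L u₁ (trans (cong (_++ v) e≡) (++-assoc u₁ (y ∷ v₁) v))

  unique-length : ∀ {α : Word n} → Unique α → length α ≤ n
  unique-length {α} uq = subst (length α ≤_) (length-tabulate {n = n} id)
    (unique-⊆-length {ys = allFin n} uq λ _ → ∈-allFin _)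

  ∈-wordsOfLength : ∀ (α : Word n) → α ∈ wordsOfLength n (length α)
  ∈-wordsOfLength [] = here refl
  ∈-wordsOfLength (x ∷ α) = ∈-concatMap⁺ _ {xs = allFin n}
    (Any.map (λ { refl → ∈-map⁺ (x ∷_) (∈-wordsOfLength α) }) (∈-allFin x))

  ∈-shortWords : ∀ {α : Word n} → Unique α → α ∈ shortWords n
  ∈-shortWords {α} uq = ∈-concatMap⁺ (wordsOfLength n) {xs = upTo (suc n)}
    (Any.map (λ { refl → ∈-wordsOfLength α }) (∈-upTo⁺ (s≤s (unique-length uq))))

  session≤total : ∀ {S} (C : Candidate S) {α} → 𝓛 S α → sessionTime C α ≤ tᵗᵒᵗᵃˡ C
  session≤total {S} C L = v≤max⁺ 0 _ (inj₂
    (Any.map (≤-reflexive) (∈-map⁺ (sessionTime C) (∈-filter⁺ (𝓛? S) (∈-shortWords (proj₁ L)) L))))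

  -- A letter that does not occur gets the length of the word.
  ord : Word n → Fin n → ℕ
  ord [] x = 0
  ord (y ∷ α) x with x Fin.≟ y
  ... | yes _ = 0
  ... | no _ = suc (ord α x)

  ord-∷-≢ : ∀ {y α x} → x ≢ y → ord (y ∷ α) x ≡ suc (ord α x)
  ord-∷-≢ {y} {α} {x} x≢y with x Fin.≟ y
  ... | yes e = ⊥-elim (x≢y e)
  ... | no _ = refl

  ord-∷-≡ : ∀ x α → ord (x ∷ α) x ≡ 0
  ord-∷-≡ x α with x Fin.≟ x
  ... | yes e = refl
  ... | no c = ⊥-elim (c refl)

  ord-∈ : ∀ u {v x} → x ∈ u → ord (u ++ v) x < length u
  ord-∈ (y ∷ u) {v} {x} p with x Fin.≟ y
  ord-∈ (y ∷ u) p | yes _ = z<s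
  ord-∈ (y ∷ u) (here q) | no c = ⊥-elim (c q)
  ord-∈ (y ∷ u) (there q) | no c = s≤s (ord-∈ u q)

  ord-∉ : ∀ u {v x} → x ∉ u → length u ≤ ord (u ++ v) x
  ord-∉ [] p = z≤n
  ord-∉ (y ∷ u) {v} {x} p with x Fin.≟ y
  ... | yes e = ⊥-elim (p (here e))
  ... | no c = s≤s (ord-∉ u (p ∘ there))

  ord-split : ∀ u {v x} → x ∉ u → ord (u ++ x ∷ v) x ≡ length u
  ord-split [] {v} {x} _ = ord-∷-≡ x v
  ord-split (y ∷ u) p = trans (ord-∷-≢ (p ∘ here)) (cong suc (ord-split u (p ∘ there)))

  ord<⇒∈ : ∀ u {v x} → ord (u ++ v) x < length u → x ∈ u
  ord<⇒∈ u {v} {x} l< with x ∈? u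
  ... | yes p = p
  ... | no ¬p = ⊥-elim (<⇒≱ l< (ord-∉ u ¬p))

  ord-injective : ∀ {α x y} → x ∈ α → ord α x ≡ ord α y → x ≡ y
  ord-injective {a ∷ α} {x} {y} p e≡ with x Fin.≟ a | y Fin.≟ a
  ord-injective p e≡ | yes refl | yes refl = refl
  ord-injective p () | yes e | no c
  ord-injective p () | no c | yes e
  ord-injective (here q) e≡ | no c | no _ = ⊥-elim (c q)
  ord-injective (there q) e≡ | no c | no _ = ord-injective q (suc-injective e≡)

  -- This and its converse let the oracle be treated as a comparison of the natural numbers
  -- `ord π x`, which are the keys of the heap and of the search.
  precedes⇒ord< : ∀ {π x y} → Unique π → Precedes π x y → ord π x < ord π y
  precedes⇒ord< {x = x} {y} uq (α , β , γ , refl) = <-≤-trans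
    (s≤s (≤-reflexive (ord-split α (unique-middle α uq .proj₁))))
    (subst (λ w → suc (length α) ≤ ord w y) (++-assoc α (x ∷ []) (β ++ y ∷ γ))
      (subst (_≤ ord ((α ∷ʳ x) ++ β ++ y ∷ γ) y) (trans (length-++ α) (+-comm _ 1))
        (ord-∉ (α ∷ʳ x) λ y∈ → unique-++-disjoint (α ∷ʳ x)
          (subst Unique (sym (++-assoc α (x ∷ []) (β ++ y ∷ γ))) uq) y∈ (∈-++⁺ʳ β (here refl)))))

  ord<⇒precedes : ∀ {π x y} → Unique π → x ∈ π → y ∈ π → ord π x < ord π y → Precedes π x y
  ord<⇒precedes {π} {x} {y} uq x∈ y∈ l< with ∈-split x∈
  ... | α , δ , refl with ∈-++⁻ α y∈
  ... | inj₁ y∈α = ⊥-elim (<-asym l< (<-≤-trans (ord-∈ α y∈α)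
                     (≤-reflexive (sym (ord-split α (unique-middle α uq .proj₁))))))
  ... | inj₂ (here refl) = ⊥-elim (<-irrefl refl l<)
  ... | inj₂ (there y∈δ) with ∈-split y∈δ
  ... | β , γ , refl = α , β , γ , refl

-- Verified execution of programs

-- Syntactic bounds on what a command can change. On a concrete program they compute, so that a use
-- of `Frame` is discharged by `refl`.
writesReg : Cmd → ℕ → Bool
writesReg skip r = false
writesReg (d := _) r = d ℕ.≡ᵇ r
writesReg (_ [ _ ]:= _) r = false
writesReg (c ⨾ c′) r = writesReg c r ∨ writesReg c′ r
writesReg (ifz _ c c′) r = writesReg c r ∨ writesReg c′ r
writesReg (while _ c) r = writesReg c r
writesReg (compare d _ _) r = d ℕ.≡ᵇ r
writesReg (init d _) r = d ℕ.≡ᵇ r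
writesReg (step _ d _) r = d ℕ.≡ᵇ r

writesArr : Cmd → ℕ → Bool
writesArr skip a = false
writesArr (_ := _) a = false
writesArr (b [ _ ]:= _) a = b ℕ.≡ᵇ a
writesArr (c ⨾ c′) a = writesArr c a ∨ writesArr c′ a
writesArr (ifz _ c c′) a = writesArr c a ∨ writesArr c′ a
writesArr (while _ c) a = writesArr c a
writesArr (compare _ _ _) a = false
writesArr (init _ b) a = b ℕ.≡ᵇ a
writesArr (step _ _ b) a = b ℕ.≡ᵇ a

calls : Cmd → Bool
calls (c ⨾ c′) = calls c ∨ calls c′
calls (ifz _ c c′) = calls c ∨ calls c′
calls (while _ c) = calls c
calls (init _ _) = true
calls (step _ _ _) = true
calls _ = false

∨-falseˡ : ∀ {a b} → a ∨ b ≡ false → a ≡ false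
∨-falseˡ {false} _ = refl

∨-falseʳ : ∀ {a b} → a ∨ b ≡ false → b ≡ false
∨-falseʳ {false} e≡ = e≡

if-false : ∀ {A : Set} {b} {x y : A} → b ≡ false → (if b then x else y) ≡ y
if-false refl = refl

if-true : ∀ {A : Set} {b} {x y : A} → b ≡ true → (if b then x else y) ≡ x
if-true refl = refl

≡ᵇ-refl : ∀ i → (i ℕ.≡ᵇ i) ≡ true
≡ᵇ-refl i = Equivalence.to T-≡ (≡⇒≡ᵇ i i refl)

≢⇒≡ᵇ-false : ∀ {i j} → i ≢ j → (i ℕ.≡ᵇ j) ≡ false
≢⇒≡ᵇ-false {i} {j} i≢j with i ℕ.≡ᵇ j in e≡
... | false = refl
... | true = ⊥-elim (i≢j (≡ᵇ⇒≡ i j (Equivalence.from T-≡ e≡)))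

update-same : ∀ {A : Set} (f : ℕ → A) i v → update f i v i ≡ v
update-same f i v = if-true (≡ᵇ-refl i)

update-other : ∀ {A : Set} (f : ℕ → A) {i j} v → i ≢ j → update f i v j ≡ f j
update-other f v i≢j = if-false (≢⇒≡ᵇ-false i≢j)

-- Exceeds the cost of every straight-line block; abstract so that K * m never unfolds.
abstract
  K : ℕ
  K = 200

  ≤K : ∀ {t} {p : True (t ≤? 200)} → t ≤ K
  ≤K {p = p} = toWitness p

module Machine {n : ℕ} {S : MPS n} (C : Candidate S) (π : Word n)
               (w : ℕ) (room : 16 * suc n ≤ 2 ^ w)
               (π-unique : Unique π) (π-complete : ∀ x → x ∈ π) where

  open WordRAM w hiding (Run)

  record Frame (c : Cmd) (σ σ′ : State n) : Set where
    field
      reg≡ : ∀ r → writesReg c r ≡ false → regs σ′ r ≡ regs σ r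
      arr≡ : ∀ a → writesArr c a ≡ false → arrays σ′ a ≡ arrays σ a
      his≡ : calls c ≡ false → history σ′ ≡ history σ
  open Frame public

  frame-refl : ∀ {c σ} → Frame c σ σ
  frame-refl .reg≡ _ _ = refl
  frame-refl .arr≡ _ _ = refl
  frame-refl .his≡ _ = refl

  frame : ∀ {c σ σ′ t q} → Run w C π c σ σ′ t q → Frame c σ σ′
  frame skip = frame-refl
  frame assign .reg≡ r e≡ = if-false e≡
  frame assign .arr≡ a e≡ = refl
  frame assign .his≡ e≡ = refl
  frame store .reg≡ r e≡ = refl
  frame store .arr≡ a e≡ = if-false e≡
  frame store .his≡ e≡ = refl
  frame (seq {c = c} R R′) .reg≡ r e≡ =
    trans (frame R′ .reg≡ r (∨-falseʳ {writesReg c r} e≡)) (frame R .reg≡ r (∨-falseˡ e≡))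
  frame (seq {c = c} R R′) .arr≡ a e≡ =
    trans (frame R′ .arr≡ a (∨-falseʳ {writesArr c a} e≡)) (frame R .arr≡ a (∨-falseˡ e≡))
  frame (seq {c = c} R R′) .his≡ e≡ =
    trans (frame R′ .his≡ (∨-falseʳ {calls c} e≡)) (frame R .his≡ (∨-falseˡ e≡))
  frame (if-zero _ R) .reg≡ r e≡ = frame R .reg≡ r (∨-falseˡ e≡)
  frame (if-zero _ R) .arr≡ a e≡ = frame R .arr≡ a (∨-falseˡ e≡)
  frame (if-zero _ R) .his≡ e≡ = frame R .his≡ (∨-falseˡ e≡)
  frame (if-nonzero {c = c} _ R) .reg≡ r e≡ = frame R .reg≡ r (∨-falseʳ {writesReg c r} e≡)
  frame (if-nonzero {c = c} _ R) .arr≡ a e≡ = frame R .arr≡ a (∨-falseʳ {writesArr c a} e≡)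
  frame (if-nonzero {c = c} _ R) .his≡ e≡ = frame R .his≡ (∨-falseʳ {calls c} e≡)
  frame (while-done _) = frame-refl
  frame (while-loop _ R R′) .reg≡ r e≡ = trans (frame R′ .reg≡ r e≡) (frame R .reg≡ r e≡)
  frame (while-loop _ R R′) .arr≡ a e≡ = trans (frame R′ .arr≡ a e≡) (frame R .arr≡ a e≡)
  frame (while-loop _ R R′) .his≡ e≡ = trans (frame R′ .his≡ e≡) (frame R .his≡ e≡)
  frame (compare-yes _ _ _ _ _) .reg≡ r e≡ = if-false e≡
  frame (compare-yes _ _ _ _ _) .arr≡ a e≡ = refl
  frame (compare-yes _ _ _ _ _) .his≡ e≡ = refl
  frame (compare-no _ _ _ _ _) .reg≡ r e≡ = if-false e≡
  frame (compare-no _ _ _ _ _) .arr≡ a e≡ = refl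
  frame (compare-no _ _ _ _ _) .his≡ e≡ = refl
  frame init .reg≡ r e≡ = if-false e≡
  frame init .arr≡ a e≡ = if-false e≡
  frame init .his≡ ()
  frame (step _ _ _ _ _) .reg≡ r e≡ = if-false e≡
  frame (step _ _ _ _ _) .arr≡ a e≡ = if-false e≡
  frame (step _ _ _ _ _) .his≡ ()

  record Exec (c : Cmd) (σ : State n) (t q : ℕ) (Post : State n → Set) : Set where
    constructor exec
    field
      {σ′ } : State n
      {t′ q′} : ℕ
      run   : Run w C π c σ σ′ t′ q′
      t′≤   : t′ ≤ t
      q′≤   : q′ ≤ q
      post  : Post σ′
  open Exec public

  -- Execution within b units of work free of comparisons and v units
  -- containing at most one comparison each.
  record Work (c : Cmd) (σ : State n) (b v : ℕ) (Post : State n → Set) : Set where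
    constructor work
    field unwork : Exec c σ (K * (b + v)) v Post
  open Work public

  -- A wrapper keeping the state and the expression visible to unification.
  infix 4 _⊢_⇓_
  record _⊢_⇓_ (σ : State n) (e : Expr) (v : ℕ) : Set where
    constructor ⇓
    field value : eval σ e ≡ v

  private variable
    c c′ : Cmd
    σ : State n
    e f : Expr
    d r i j k t t₁ t₂ q q₁ q₂ u v : ℕ
    P P′ : State n → Set

  e-weaken : t₁ ≤ t₂ → q₁ ≤ q₂ → Exec c σ t₁ q₁ P → Exec c σ t₂ q₂ P
  e-weaken t≤ q≤ (exec R t′≤ q′≤ p) = exec R (≤-trans t′≤ t≤) (≤-trans q′≤ q≤) p

  e-map : (∀ {σ′} → P σ′ → P′ σ′) → Exec c σ t q P → Exec c σ t q P′
  e-map h (exec R t≤ q≤ p) = exec R t≤ q≤ (h p)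

  e-frame : Exec c σ t q P → Exec c σ t q (λ σ′ → Frame c σ σ′ × P σ′)
  e-frame (exec R t≤ q≤ p) = exec R t≤ q≤ (frame R , p)

  e-skip : P σ → Exec skip σ 1 0 P
  e-skip p = exec skip ≤-refl ≤-refl p

  e-assign : σ ⊢ e ⇓ v → P (setReg d v σ) → Exec (d := e) σ (suc (size e)) 0 P
  e-assign (⇓ refl) p = exec assign ≤-refl ≤-refl p

  e-store : ∀ {a} → σ ⊢ e ⇓ i → σ ⊢ f ⇓ v → P (setCell a i v σ) →
            Exec (a [ e ]:= f) σ (suc (size e + size f)) 0 P
  e-store (⇓ refl) (⇓ refl) p = exec store ≤-refl ≤-refl p

  e-seq : Exec c σ t₁ q₁ (λ σ′ → Exec c′ σ′ t₂ q₂ P) →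
          Exec (c ⨾ c′) σ (t₁ + t₂) (q₁ + q₂) P
  e-seq (exec R t≤ q≤ (exec R′ t≤′ q≤′ p)) =
    exec (seq R R′) (+-mono-≤ t≤ t≤′) (+-mono-≤ q≤ q≤′) p

  e-then : Exec c σ t₁ q₁ P′ →
           (∀ {σ′} → Frame c σ σ′ → P′ σ′ → Exec c′ σ′ t₂ q₂ P) →
           Exec (c ⨾ c′) σ (t₁ + t₂) (q₁ + q₂) P
  e-then E h = e-seq (e-map (uncurry h) (e-frame E))

  e-if0 : σ ⊢ e ⇓ 0 → Exec c σ t q P → Exec (ifz e c c′) σ (suc (size e + t)) q P
  e-if0 {e = e} (⇓ z) (exec R t≤ q≤ p) = exec (if-zero z R) (s≤s (+-monoʳ-≤ (size e) t≤)) q≤ p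

  e-if1 : σ ⊢ e ⇓ suc v → Exec c′ σ t q P → Exec (ifz e c c′) σ (suc (size e + t)) q P
  e-if1 {e = e} (⇓ z) (exec R t≤ q≤ p) =
    exec (if-nonzero (λ z′ → 1+n≢0 (trans (sym z) z′)) R) (s≤s (+-monoʳ-≤ (size e) t≤)) q≤ p

  e-while0 : σ ⊢ e ⇓ 0 → P σ → Exec (while e c) σ (suc (size e)) 0 P
  e-while0 (⇓ z) p = exec (while-done z) ≤-refl ≤-refl p

  e-while1 : σ ⊢ e ⇓ suc v →
             Exec c σ t₁ q₁ (λ σ′ → Exec (while e c) σ′ t₂ q₂ P) →
             Exec (while e c) σ (suc (size e + t₁ + t₂)) (q₁ + q₂) P
  e-while1 {e = e} (⇓ z) (exec R t≤ q≤ (exec R′ t≤′ q≤′ p)) =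
    exec (while-loop (λ z′ → 1+n≢0 (trans (sym z) z′)) R R′)
      (s≤s (+-mono-≤ (+-monoʳ-≤ (size e) t≤) t≤′)) (+-mono-≤ q≤ q≤′) p

  infix 4 _≺_
  _≺_ : Fin n → Fin n → Set
  x ≺ y = ord π x < ord π y

  1<2^w : 1 < 2 ^ w
  1<2^w = ≤-trans (≤-trans (s≤s (s≤s z≤n)) (m≤m*n 16 (suc n))) room

  trunc-< : k < 2 ^ w → trunc k ≡ k
  trunc-< {k} k< = m<n⇒m%n≡m {{m^n≢0 2 w}} k<

  -- Heap addresses are at most `4 * suc n`, so `8 * suc n` bounds any sum of two of them; `room`
  -- provides twice as much, and truncation has no effect.
  fits : k ≤ 8 * suc n → k < 2 ^ w
  fits k≤ = ≤-trans (s≤s k≤) (≤-trans (*-monoˡ-< (suc n) {8} {16} (s≤s (s≤s (s≤s (s≤s (s≤s (s≤s (s≤s (s≤s (s≤s z≤n)))))))))) room)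

  e-yes : ∀ {x y} → σ ⊢ e ⇓ toℕ x → σ ⊢ f ⇓ toℕ y → x ≺ y →
          P (setReg d 1 σ) → Exec (compare d e f) σ (suc (size e + size f)) 1 P
  e-yes {σ = σ} {P = P} {d = d} {x = x} {y} (⇓ ex) (⇓ fy) x≺y p = exec
    (compare-yes x y ex fy (ord<⇒precedes π-unique (π-complete x) (π-complete y) x≺y))
    ≤-refl ≤-refl (subst (λ k → P (setReg d k σ)) (sym (trunc-< 1<2^w)) p)

  e-no : ∀ {x y} → σ ⊢ e ⇓ toℕ x → σ ⊢ f ⇓ toℕ y → ¬ x ≺ y →
         P (setReg d 0 σ) → Exec (compare d e f) σ (suc (size e + size f)) 1 P
  e-no {x = x} {y} (⇓ ex) (⇓ fy) x⊀y p = exec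
    (compare-no x y ex fy (x⊀y ∘ precedes⇒ord< π-unique)) ≤-refl ≤-refl p

  -- A pass that may contain a comparison uses up one unit of `v`; `e-iter₀` charges a pass without
  -- comparisons to the other budget.
  e-iter : {t≤ : True (suc (size e + t₁) ≤? 200)} {q≤ : True (q₁ ≤? 1)} → σ ⊢ e ⇓ suc u →
           Exec c σ t₁ q₁ (λ σ′ → Work (while e c) σ′ i v P) → Work (while e c) σ i (suc v) P
  e-iter {e = e} {t₁} {i = i} {v = v} {t≤ = t≤} {q≤} z E = work (e-weaken
    (≤-trans (+-monoˡ-≤ (K * (i + v)) (≤K {p = t≤}))
      (≤-reflexive (trans (sym (*-suc K (i + v))) (cong (K *_) (sym (+-suc i v))))))
    (+-monoˡ-≤ v (toWitness q≤)) (e-while1 z (e-map unwork E)))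

  e-iter₀ : {t≤ : True (suc (size e + t₁) ≤? 200)} → σ ⊢ e ⇓ suc u →
            Exec c σ t₁ 0 (λ σ′ → Work (while e c) σ′ i v P) → Work (while e c) σ (suc i) v P
  e-iter₀ {e = e} {t₁} {i = i} {v = v} {t≤ = t≤} z E = work (e-weaken
    (≤-trans (+-monoˡ-≤ (K * (i + v)) (≤K {p = t≤})) (≤-reflexive (sym (*-suc K (i + v)))))
    ≤-refl (e-while1 z (e-map unwork E)))

  e-block : {t≤ : True (t ≤? 200)} → Exec c σ t 0 P → Work c σ 1 0 P
  e-block {t≤ = t≤} E =
    work (e-weaken (≤-trans (≤K {p = t≤}) (≤-reflexive (sym (*-identityʳ K)))) ≤-refl E)

  -- Time depends only on the sum of the two budgets, so units free of comparisons may be booked as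
  -- units that allow one, though not conversely. This merges constant overheads into the amortised
  -- budget.
  w-convert : i + u ≤ j + v → u ≤ v → Work c σ i u P → Work c σ j v P
  w-convert i≤ u≤ (work E) = work (e-weaken (*-monoʳ-≤ K i≤) u≤ E)

  w-weaken : i ≤ j → u ≤ v → Work c σ i u P → Work c σ j v P
  w-weaken i≤ u≤ = w-convert (+-mono-≤ i≤ u≤) u≤

  w-map : (∀ {σ′} → P σ′ → P′ σ′) → Work c σ i u P → Work c σ i u P′
  w-map h (work E) = work (e-map h E)

  w-map′ : (∀ {σ′} → Frame c σ σ′ → P σ′ → P′ σ′) → Work c σ i u P → Work c σ i u P′
  w-map′ h (work E) = work (e-map (uncurry h) (e-frame E))

  w-then : Work c σ i u P′ → (∀ {σ′} → Frame c σ σ′ → P′ σ′ → Work c′ σ′ j v P) →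
           Work (c ⨾ c′) σ (i + j) (u + v) P
  w-then {i = i} {u} {j = j} {v} (work E) h = work (e-weaken
    (≤-reflexive (trans (sym (*-distribˡ-+ K (i + u) (j + v))) (cong (K *_) (interchange i u j v))))
    ≤-refl (e-then E λ F p → unwork (h F p)))
    where
    interchange : ∀ a b c d → a + b + (c + d) ≡ a + c + (b + d)
    interchange = solve-∀

  w-seq : Work c σ i u (λ σ′ → Work c′ σ′ j v P) → Work (c ⨾ c′) σ (i + j) (u + v) P
  w-seq E = w-then E λ _ E′ → E′

  w-while : {t≤ : True (suc (size e) ≤? 200)} → σ ⊢ e ⇓ suc k →
            Work c σ i u (λ σ′ → Work (while e c) σ′ j v P) →
            Work (while e c) σ (suc (i + j)) (u + v) P
  w-while {e = e} {i = i} {u} {j} {v} {t≤ = t≤} z (work E) = work (e-weaken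
    (≤-trans (≤-reflexive (cong suc (+-assoc (size e) (K * (i + u)) (K * (j + v)))))
      (≤-trans (+-monoˡ-≤ _ (≤K {p = t≤})) (≤-reflexive (identity K i u j v))))
    ≤-refl (e-while1 z (e-map unwork E)))
    where
    identity : ∀ k a b c d → k + (k * (a + b) + k * (c + d)) ≡ k * (suc (a + c) + (b + d))
    identity = solve-∀

  e-init : ∀ {a} → P (receive (initReports C) [] d a σ) → Exec (init d a) σ (suc (initTime C)) 0 P
  e-init p = exec init ≤-refl ≤-refl p

  e-step : ∀ {a α x} → history σ ≡ just α → σ ⊢ e ⇓ toℕ x → 𝓛 S (α ∷ʳ x) →
           P (receive (stepReports C α x) (α ∷ʳ x) d a σ) →
           Exec (step e d a) σ (suc (size e + stepTime C α x)) 0 P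
  e-step h (⇓ ex) L p = exec (step _ _ h ex L) ≤-refl ≤-refl p

  private
    test-cost : ∀ i u → {t≤ : True (suc k ≤? 200)} → suc (k + K * (i + u)) ≤ K * (suc i + u)
    test-cost i u {t≤} = ≤-trans (+-monoˡ-≤ (K * (i + u)) (≤K {p = t≤})) (≤-reflexive (sym (*-suc K (i + u))))

  w-if0 : {t≤ : True (suc (size e) ≤? 200)} → σ ⊢ e ⇓ 0 → Work c σ i u P → Work (ifz e c c′) σ (suc i) u P
  w-if0 {i = i} {u} {t≤ = t≤} z (work E) = work (e-weaken (test-cost i u {t≤}) ≤-refl (e-if0 z E))

  w-if1 : {t≤ : True (suc (size e) ≤? 200)} → σ ⊢ e ⇓ suc v → Work c′ σ i u P →
          Work (ifz e c c′) σ (suc i) u P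
  w-if1 {i = i} {u} {t≤ = t≤} z (work E) = work (e-weaken (test-cost i u {t≤}) ≤-refl (e-if1 z E))

  -- A unit is worth `K ≥ 1` steps, so the time `s` of a call of the black box may be counted as `s`
  -- units, plus one for the command itself.
  w-timed : ∀ s → t ≤ 2 + s → Exec c σ t 0 P → Work c σ (suc s) 0 P
  w-timed {t = t} s t≤ E = work (e-weaken (begin
    t               ≤⟨ t≤ ⟩
    2 + s           ≤⟨ +-mono-≤ ≤K (≤-trans (≤-reflexive (sym (*-identityˡ s))) (*-monoˡ-≤ s (≤K {t = 1}))) ⟩
    K + K * s       ≡⟨ sym (*-suc K s) ⟩
    K * suc s       ≡⟨ cong (K *_) (sym (+-identityʳ (suc s))) ⟩
    K * (suc s + 0) ∎) ≤-refl E)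
    where open ≤-Reasoning

  ev-reg : regs σ r ≡ v → σ ⊢ reg r ⇓ v
  ev-reg e≡ = ⇓ e≡

  ev-lit : {p : True (k ≤? 8)} → σ ⊢ lit k ⇓ k
  ev-lit {k = k} {p = p} = ⇓ (trunc-< (fits (≤-trans (toWitness p) (m≤m*n 8 (suc n)))))

  ev-arr : ∀ {a} → σ ⊢ e ⇓ i → arrays σ a i ≡ v → σ ⊢ a [ e ] ⇓ v
  ev-arr (⇓ refl) e≡ = ⇓ e≡

  ev-add : σ ⊢ e ⇓ i → σ ⊢ f ⇓ j → i + j ≤ 8 * suc n → σ ⊢ op add e f ⇓ i + j
  ev-add (⇓ refl) (⇓ refl) b = ⇓ (trunc-< (fits b))

  ev-pred : σ ⊢ e ⇓ suc i → suc i ≤ 8 * suc n → σ ⊢ op sub e (lit 1) ⇓ i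
  ev-pred {σ = σ} {e = e} {i = i} (⇓ e≡) b = ⇓ (helper e≡ (trunc-< 1<2^w))
    where
    helper : ∀ {x y} → x ≡ suc i → y ≡ 1 → trunc (x + (2 ^ w ∸ y)) ≡ i
    helper refl refl =
      trans (cong trunc (trans (sym (+-suc i (2 ^ w ∸ 1)))
        (cong (i +_) (suc-pred (2 ^ w) {{m^n≢0 2 w}}))))
      (trans ([m+n]%n≡m%n i (2 ^ w) {{m^n≢0 2 w}}) (trunc-< (fits (≤-trans (n≤1+n i) b))))

  ev-half : σ ⊢ e ⇓ i → σ ⊢ op div e (lit 2) ⇓ i / 2
  ev-half {σ = σ} {e = e} (⇓ refl) = ⇓ (cong (⟦ div ⟧ (eval σ e)) (ev-lit {2} {σ} ._⊢_⇓_.value))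

  ev-eq1 : σ ⊢ e ⇓ i → σ ⊢ f ⇓ j → i ≡ j → σ ⊢ op eq e f ⇓ 1
  ev-eq1 {σ = σ} {e = e} (⇓ refl) (⇓ refl) e≡ = ⇓ (trans (cong trunc (if-true
    (subst (λ k → (eval σ e ℕ.≡ᵇ k) ≡ true) e≡ (≡ᵇ-refl (eval σ e))))) (trunc-< 1<2^w))

  ev-eq0 : σ ⊢ e ⇓ i → σ ⊢ f ⇓ j → i ≢ j → σ ⊢ op eq e f ⇓ 0
  ev-eq0 (⇓ refl) (⇓ refl) ne =
    ⇓ (trans (cong trunc (if-false (≢⇒≡ᵇ-false ne))) (trunc-< (<-trans z<s 1<2^w)))

  ev-lt1 : σ ⊢ e ⇓ i → σ ⊢ f ⇓ j → i < j → σ ⊢ op lt e f ⇓ 1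
  ev-lt1 (⇓ refl) (⇓ refl) l< =
    ⇓ (trans (cong trunc (if-true (Equivalence.to T-≡ (<⇒<ᵇ l<)))) (trunc-< 1<2^w))

  ev-lt0 : σ ⊢ e ⇓ i → σ ⊢ f ⇓ j → ¬ i < j → σ ⊢ op lt e f ⇓ 0
  ev-lt0 {σ = σ} {e = e} {f = f} (⇓ refl) (⇓ refl) l≮ =
    ⇓ (trans (cong trunc (if-false (helper (eval σ e ℕ.<ᵇ eval σ f) refl)))
        (trunc-< (<-trans z<s 1<2^w)))
    where
    helper : ∀ b → (eval σ e ℕ.<ᵇ eval σ f) ≡ b → b ≡ false
    helper false _ = refl
    helper true e≡ = ⊥-elim (l≮ (<ᵇ⇒< _ _ (Equivalence.from T-≡ e≡)))

-- A heap of sorted runs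

-- Used with x ≤ y a sum of known inequalities: the equation is then left to the ring solver.
linear : ∀ {x y a b} s → x ≤ y → a + y + s ≡ b + x → a ≤ b
linear {x} {y} {a} {b} s x≤y e≡ = +-cancelʳ-≤ y a b
  (≤-trans (m≤m+n (a + y) s) (≤-trans (≤-reflexive e≡) (+-monoʳ-≤ b x≤y)))

sumBy : ∀ {A : Set} → (A → ℕ) → List A → ℕ
sumBy f [] = 0
sumBy f (x ∷ xs) = f x + sumBy f xs

module _ {A : Set} where

  sumBy-++ : ∀ (f : A → ℕ) xs {ys} → sumBy f (xs ++ ys) ≡ sumBy f xs + sumBy f ys
  sumBy-++ f [] = refl
  sumBy-++ f (x ∷ xs) = trans (cong (f x +_) (sumBy-++ f xs)) (sym (+-assoc (f x) _ _))

  sumBy-↭ : ∀ (f : A → ℕ) {xs ys} → xs ↭ ys → sumBy f xs ≡ sumBy f ys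
  sumBy-↭ f _↭_.refl = refl
  sumBy-↭ f (prep x p) = cong (f x +_) (sumBy-↭ f p)
  sumBy-↭ f (swap x y p) = trans (cong (λ k → f x + (f y + k)) (sumBy-↭ f p)) (exchange (f x) (f y) _)
    where
    exchange : ∀ a b c → a + (b + c) ≡ b + (a + c)
    exchange = solve-∀
  sumBy-↭ f (_↭_.trans p q) = trans (sumBy-↭ f p) (sumBy-↭ f q)

  sumBy-const : ∀ k (xs : List A) → sumBy (λ _ → k) xs ≡ k * length xs
  sumBy-const k [] = sym (*-zeroʳ k)
  sumBy-const k (x ∷ xs) = trans (cong (k +_) (sumBy-const k xs)) (sym (*-suc k (length xs)))

  unique-resp-↭ : ∀ {xs ys : List A} → xs ↭ ys → Unique xs → Unique ys
  unique-resp-↭ p = Permutationₛ.Unique-resp-↭ (setoid A) (↭⇒↭ₛ p)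

  concat-plug-↭ : ∀ (l : List A) {xs ys z} → xs ↭ z ∷ ys → l ++ xs ↭ z ∷ l ++ ys
  concat-plug-↭ l {xs} {ys} {z} p = ↭-trans (++⁺ˡ l p) (shift z l ys)

-- A heap is a list of sorted runs, the run at level i having at most 2 ^ i elements.
module Heaps {A : Set} (key : A → ℕ) where

  Batch Heap : Set
  Batch = List A
  Heap = List Batch

  pick : ∀ {P B : Set} → Dec P → B → B → B
  pick (yes _) x y = x
  pick (no _) x y = y

  pick-elim : ∀ {P B : Set} (Q : B → Set) (d : Dec P) {x y} →
              (P → Q x) → (¬ P → Q y) → Q (pick d x y)
  pick-elim Q (yes p) f g = f p
  pick-elim Q (no ¬p) f g = g ¬p

  pick-yes : ∀ {P B : Set} (d : Dec P) {x y : B} → P → pick d x y ≡ x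
  pick-yes (yes _) _ = refl
  pick-yes (no ¬p) p = ⊥-elim (¬p p)

  pick-no : ∀ {P B : Set} (d : Dec P) {x y : B} → ¬ P → pick d x y ≡ y
  pick-no (yes p) ¬p = ⊥-elim (¬p p)
  pick-no (no _) _ = refl

  -- The recursion goes on until `b` is empty, even if `a` is exhausted, because `mergeLoop` tests
  -- only the length of the second run. What remains of `a` is already in place then.
  merge : Batch → Batch → Batch
  merge a [] = a
  merge [] (y ∷ b) = y ∷ merge [] b
  merge (x ∷ a) (y ∷ b) = pick (key y <? key x) (y ∷ merge (x ∷ a) b) (x ∷ merge a (y ∷ b))

  -- Works like the increment of a binary counter, except that a merged run moves up only if it
  -- exceeds the capacity `2 ^ i`, since pops may have left room. The result is the final level with
  -- its new run and the runs above it; the levels passed on the way become empty.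
  carry : ℕ → Batch → Heap → ℕ × Batch × Heap
  carry i c [] = i , c , []
  carry i c ([] ∷ h) = i , c , h
  carry i c (r@(_ ∷ _) ∷ h) with 2 ^ i <? length c + length r
  ... | yes _ = carry (suc i) (merge c r) h
  ... | no _ = i , merge c r , h

  -- Puts a heap back below the runs of lower levels, which are listed downwards.
  plug : List Batch → Heap → Heap
  plug [] h = h
  plug (l ∷ ls) h = plug ls (l ∷ h)

  empties : ℕ → List Batch
  empties j = replicate j []

  insert : A → Heap → Heap
  insert y h = case carry 0 (y ∷ []) h of λ (j , c , h′) → plug (empties j) (c ∷ h′)

  choose : ℕ → A → Maybe (ℕ × A) → ℕ × A
  choose i x nothing = i , x
  choose i x (just (j , z)) = pick (key x <? key z) (i , x) (j , z)

  best : ℕ → Heap → Maybe (ℕ × A)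
  best i [] = nothing
  best i ([] ∷ h) = best (suc i) h
  best i ((x ∷ r) ∷ h) = just (choose i x (best (suc i) h))

  merge-↭ : ∀ a b → merge a b ↭ a ++ b
  merge-↭ a [] = ↭-reflexive (sym (++-identityʳ a))
  merge-↭ [] (y ∷ b) = prep y (merge-↭ [] b)
  merge-↭ (x ∷ a) (y ∷ b) = pick-elim (_↭ x ∷ a ++ y ∷ b) (key y <? key x)
    (λ _ → ↭-trans (prep y (merge-↭ (x ∷ a) b)) (↭-sym (shift y (x ∷ a) b)))
    (λ _ → prep x (merge-↭ a (y ∷ b)))

  length-merge : ∀ a b → length (merge a b) ≡ length a + length b
  length-merge a b = trans (↭-length (merge-↭ a b)) (length-++ a)

  Sorted : Batch → Set
  Sorted = AllPairs (λ x y → key x ≤ key y)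

  merge-sorted : ∀ {a b} → Sorted a → Sorted b → Sorted (merge a b)
  merge-sorted {a} {[]} sa sb = sa
  merge-sorted {[]} {y ∷ b} sa (py ∷ sb) =
    All-resp-↭ (↭-sym (merge-↭ [] b)) py ∷ merge-sorted [] sb
  merge-sorted {x ∷ a} {y ∷ b} (px ∷ sa) (py ∷ sb) = pick-elim Sorted (key y <? key x)
    (λ y<x → All-resp-↭ (↭-sym (merge-↭ (x ∷ a) b))
                    (All.++⁺ (<⇒≤ y<x ∷ All.map (≤-trans (<⇒≤ y<x)) px) py)
                  ∷ merge-sorted (px ∷ sa) sb)
    (λ y≮x → All-resp-↭ (↭-sym (merge-↭ a (y ∷ b)))
                   (All.++⁺ px (≮⇒≥ y≮x ∷ All.map (≤-trans (≮⇒≥ y≮x)) py))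
                 ∷ merge-sorted sa (py ∷ sb))

  carry-sorted : ∀ i {c h} → Sorted c → All Sorted h →
    let (_ , c′ , h′) = carry i c h in Sorted c′ × All Sorted h′
  carry-sorted i {c} {[]} sc sh = sc , []
  carry-sorted i {c} {[] ∷ h} sc (_ ∷ sh) = sc , sh
  carry-sorted i {c} {r@(_ ∷ _) ∷ h} sc (sr ∷ sh) with 2 ^ i <? length c + length r
  ... | yes _ = carry-sorted (suc i) (merge-sorted sc sr) sh
  ... | no _ = merge-sorted sc sr , sh

  carry-↭ : ∀ i c h → let (_ , c′ , h′) = carry i c h in c′ ++ concat h′ ↭ c ++ concat h
  carry-↭ i c [] = ↭-refl
  carry-↭ i c ([] ∷ h) = ↭-refl
  carry-↭ i c (r@(_ ∷ _) ∷ h) with 2 ^ i <? length c + length r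
  ... | yes _ = ↭-trans (carry-↭ (suc i) (merge c r) h) (↭-trans (++⁺ʳ (concat h) (merge-↭ c r))
                  (↭-reflexive (++-assoc c r (concat h))))
  ... | no _ = ↭-trans (++⁺ʳ (concat h) (merge-↭ c r)) (↭-reflexive (++-assoc c r (concat h)))

  plug-pop-↭ : ∀ ls {z h h′} → concat h ↭ z ∷ concat h′ →
               concat (plug ls h) ↭ z ∷ concat (plug ls h′)
  plug-pop-↭ [] p = p
  plug-pop-↭ (l ∷ ls) p = plug-pop-↭ ls (concat-plug-↭ l p)

  plug-empties-concat : ∀ j h → concat (plug (empties j) h) ≡ concat h
  plug-empties-concat zero h = refl
  plug-empties-concat (suc j) h = plug-empties-concat j ([] ∷ h)

  insert-↭ : ∀ y h → concat (insert y h) ↭ y ∷ concat h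
  insert-↭ y h with carry 0 (y ∷ []) h | carry-↭ 0 (y ∷ []) h
  ... | j , c , h′ | p = ↭-trans (↭-reflexive (plug-empties-concat j (c ∷ h′))) p

  plug-all⁺ : ∀ {P : Batch → Set} {ls h} → All P ls → All P h → All P (plug ls h)
  plug-all⁺ [] ph = ph
  plug-all⁺ (pl ∷ pls) ph = plug-all⁺ pls (pl ∷ ph)

  plug-all⁻ : ∀ {P : Batch → Set} ls {h} → All P (plug ls h) → All P ls × All P h
  plug-all⁻ [] ph = [] , ph
  plug-all⁻ (l ∷ ls) p with plug-all⁻ ls p
  ... | pls , pl ∷ ph = pl ∷ pls , ph

  insert-sorted : ∀ y {h} → All Sorted h → All Sorted (insert y h)
  insert-sorted y {h} sh with carry 0 (y ∷ []) h | carry-sorted 0 {y ∷ []} ([] ∷ []) sh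
  ... | j , c , h′ | sc , sh′ = plug-all⁺ (All.replicate⁺ j []) (sc ∷ sh′)

  length-plug : ∀ ls h → length (plug ls h) ≡ length ls + length h
  length-plug [] h = refl
  length-plug (l ∷ ls) h = trans (length-plug ls (l ∷ h)) (+-suc (length ls) (length h))

  Caps : ℕ → Heap → Set
  Caps i [] = ⊤
  Caps i (r ∷ h) = length r ≤ 2 ^ i × Caps (suc i) h

  carry-caps : ∀ i {c h} → length c ≤ 2 ^ i → Caps i h →
    let (j , c′ , h′) = carry i c h in length c′ ≤ 2 ^ j × Caps (suc j) h′
  carry-caps i {c} {[]} pc ph = pc , tt
  carry-caps i {c} {[] ∷ h} pc (_ , ph) = pc , ph
  carry-caps i {c} {r@(_ ∷ _) ∷ h} pc (pr , ph) with 2 ^ i <? length c + length r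
  ... | yes _ = carry-caps (suc i) (≤-trans (≤-reflexive (length-merge c r))
                  (≤-trans (+-mono-≤ pc pr) (≤-reflexive (sym (cong (2 ^ i +_) (+-identityʳ (2 ^ i))))))) ph
  ... | no l≮ = ≤-trans (≤-reflexive (length-merge c r)) (≮⇒≥ l≮) , ph

  -- A run is carried to level i + 1 only when it has more than 2 ^ i elements.
  carry-height : ∀ N i c h → 2 ^ i ≤ 2 * length c → length c + length (concat h) ≤ N →
    2 ^ (i + length h) ≤ 4 * N →
    let (j , c′ , h′) = carry i c h in 2 ^ (j + suc (length h′)) ≤ 4 * N
  carry-height N i c [] pc size ph = subst (λ k → 2 ^ k ≤ 4 * N) (+-comm 1 i)
    (≤-trans (*-monoʳ-≤ 2 pc) (≤-trans (≤-reflexive (sym (*-assoc 2 2 (length c))))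
      (*-monoʳ-≤ 4 (≤-trans (m≤m+n (length c) 0) size))))
  carry-height N i c ([] ∷ h) pc size ph = ph
  carry-height N i c (r@(_ ∷ _) ∷ h) pc size ph with 2 ^ i <? length c + length r
  ... | yes l< = carry-height N (suc i) (merge c r) h
                   (*-monoʳ-≤ 2 (≤-trans (<⇒≤ l<) (≤-reflexive (sym (length-merge c r)))))
                   (≤-trans (≤-reflexive (trans (cong (_+ length (concat h)) (length-merge c r))
                      (trans (+-assoc (length c) (length r) _)
                        (cong (length c +_) (sym (length-++ r)))))) size)
                   (subst (λ k → 2 ^ k ≤ 4 * N) (+-suc i (length h)) ph)
  ... | no _ = ph

  -- Turns the level returned by `best` into a place in the heap: the runs below are the list `ls`,
  -- whose length is that level, and `z` is on top of the run found there.
  best-plug : ∀ {i} h {j z} → best i h ≡ just (j , z) → ∀ ls₀ → length ls₀ ≡ i →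
    ∃[ ls ] ∃[ r ] ∃[ up ] plug ls₀ h ≡ plug ls ((z ∷ r) ∷ up) × length ls ≡ j
  best-plug ([] ∷ h) b ls₀ e≡ = best-plug h b ([] ∷ ls₀) (cong suc e≡)
  best-plug {i} ((x ∷ r) ∷ h) b ls₀ e≡ with best (suc i) h in b′
  best-plug {i} ((x ∷ r) ∷ h) refl ls₀ e≡ | nothing = ls₀ , r , h , refl , e≡
  best-plug {i} ((x ∷ r) ∷ h) b ls₀ e≡ | just (k , y) with key x <? key y
  best-plug {i} ((x ∷ r) ∷ h) refl ls₀ e≡ | just (k , y) | yes _ = ls₀ , r , h , refl , e≡
  best-plug {i} ((x ∷ r) ∷ h) refl ls₀ e≡ | just (k , y) | no _ =
    best-plug h b′ ((x ∷ r) ∷ ls₀) (cong suc e≡)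

  best-nothing : ∀ i h → best i h ≡ nothing → concat h ≡ []
  best-nothing i [] b = refl
  best-nothing i ([] ∷ h) b = best-nothing (suc i) h b

  best-minimum : ∀ i {h j z} → All Sorted h → best i h ≡ just (j , z) →
                 All (λ y → key z ≤ key y) (concat h)
  best-minimum i {[] ∷ h} (_ ∷ sh) b = best-minimum (suc i) sh b
  best-minimum i {(x ∷ r) ∷ h} ((px ∷ _) ∷ sh) b with best (suc i) h in b′
  best-minimum i {(x ∷ r) ∷ h} ((px ∷ _) ∷ sh) refl | nothing
    rewrite best-nothing (suc i) h b′ = ≤-refl ∷ All.++⁺ px []
  best-minimum i {(x ∷ r) ∷ h} ((px ∷ _) ∷ sh) b | just (k , y) with key x <? key y
  best-minimum i {(x ∷ r) ∷ h} ((px ∷ _) ∷ sh) refl | just (k , y) | yes x<y =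
    ≤-refl ∷ All.++⁺ px (All.map (≤-trans (<⇒≤ x<y)) (best-minimum (suc i) sh b′))
  best-minimum i {(x ∷ r) ∷ h} ((px ∷ _) ∷ sh) refl | just (k , y) | no x≮y =
    ≮⇒≥ x≮y ∷ All.++⁺ (All.map (≤-trans (≮⇒≥ x≮y)) px) (best-minimum (suc i) sh b′)

  -- Amortised cost of insertions

  weight : (ℕ → A → ℕ) → ℕ → Heap → ℕ
  weight g i [] = 0
  weight g i (r ∷ h) = sumBy (g i) r + weight g (suc i) h

  weight-plug-empties : ∀ g j {h} → weight g 0 (plug (empties j) h) ≡ weight g j h
  weight-plug-empties g zero = refl
  weight-plug-empties g (suc j) = weight-plug-empties g j

  weight-pop : ∀ g ls {z r up} → weight g 0 (plug ls ((z ∷ r) ∷ up)) ≡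
               g (length ls) z + weight g 0 (plug ls (r ∷ up))
  weight-pop g ls {z} {r} {up} = go ls (+-assoc (g (length ls) z) (sumBy (g (length ls)) r) _)
    where
    exchange : ∀ a b c → a + (b + c) ≡ b + (a + c)
    exchange = solve-∀
    go : ∀ ls {k h h′} → weight g (length ls) h ≡ k + weight g (length ls) h′ →
         weight g 0 (plug ls h) ≡ k + weight g 0 (plug ls h′)
    go [] e≡ = e≡
    go (l ∷ ls) {k} {h} {h′} e≡ = go ls (trans (cong (sumBy (g (length ls)) l +_) e≡)
      (exchange (sumBy (g (length ls)) l) k (weight g (length (l ∷ ls)) h′)))

  levels : ℕ → Heap → ℕ
  levels = weight (λ i _ → i)

  -- Units used by `carryLoop`: one for each letter of the two runs that are merged, and 6 for the
  -- overhead of a pass.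
  carryWork : ℕ → Batch → Heap → ℕ
  carryWork i c [] = 0
  carryWork i c ([] ∷ h) = 0
  carryWork i c (r@(_ ∷ _) ∷ h) with 2 ^ i <? length c + length r
  ... | yes _ = length c + length r + 6 + carryWork (suc i) (merge c r) h
  ... | no _ = length c + length r + 6

  levels-∷ : ∀ i c h → levels i (c ∷ h) ≡ i * length c + levels (suc i) h
  levels-∷ i c h = cong (_+ levels (suc i) h) (sumBy-const i c)

  -- Merging is paid for by the elements that rise, or, in the last merge, by those that
  -- have just risen.
  carry-work : ∀ i c h → 2 ^ i ≤ 2 * length c →
    let (j , c′ , h′) = carry i c h in
    carryWork i c h + length c′ + j + 18 * (i * length c + levels i h) ≤
      i + 10 * length c + 18 * levels j (c′ ∷ h′)
  carry-work i c [] pc rewrite levels-∷ i c [] = ≤-trans (m≤m+n _ (9 * length c))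
    (≤-reflexive (rearrange (length c) i (i * length c + 0)))
    where
    rearrange : ∀ c i p → 0 + c + i + 18 * p + 9 * c ≡ i + 10 * c + 18 * p
    rearrange = solve-∀
  carry-work i c ([] ∷ h) pc rewrite levels-∷ i c h = ≤-trans (m≤m+n _ (9 * length c))
    (≤-reflexive (rearrange (length c) i (i * length c + levels (suc i) h)))
    where
    rearrange : ∀ c i p → 0 + c + i + 18 * p + 9 * c ≡ i + 10 * c + 18 * p
    rearrange = solve-∀
  carry-work i c (r@(_ ∷ _) ∷ h) pc with 2 ^ i <? length c + length r
  -- All `c + r` letters rise by one level, which is worth 18 each: 1 for the merge, 10 for the
  -- credit needed at the next level, and 7 for the overhead 6 and the growth of `i`.
  ... | yes l< rewrite levels-∷ i r h =
    let (j , c′ , h′) = carry (suc i) (merge c r) h in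
    rise {i = i} {carryWork (suc i) (merge c r) h} {length c} {length r} {d = length c′} {j}
      {levels (suc i) h} {levels j (c′ ∷ h′)} (length-merge c r) (≤-trans (s≤s z≤n) l<)
    (carry-work (suc i) (merge c r) h
      (*-monoʳ-≤ 2 (≤-trans (<⇒≤ l<) (≤-reflexive (sym (length-merge c r))))))
    where
    identity : ∀ i w c r d j l t →
      c + r + 6 + w + d + j + 18 * (i * c + (i * r + l)) +
        (suc i + 10 * (c + r) + 18 * t + 7 * (c + r)) + 10 * c ≡
      i + 10 * c + 18 * t + (w + d + j + 18 * (suc i * (c + r) + l) + 7 * 1)
    identity = solve-∀
    rise : ∀ {i w c r m d j l t} → m ≡ c + r → 1 ≤ c + r →
      w + d + j + 18 * (suc i * m + l) ≤ suc i + 10 * m + 18 * t →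
      c + r + 6 + w + d + j + 18 * (i * c + (i * r + l)) ≤ i + 10 * c + 18 * t
    rise {i} {w} {c} {r} {m} {d} {j} {l} {t} refl p q =
      linear (10 * c) (+-mono-≤ q (*-monoʳ-≤ 7 p)) (identity i w c r d j l t)
  -- The last merge raises nothing. As `c + r ≤ 2 ^ i ≤ 2 * c`, the credit `10 * c` covers merging
  -- and copying, at most `2 * (2 * c)`, and the overhead 6.
  ... | no l≮ rewrite levels-∷ i (merge c r) h | levels-∷ i r h =
    stay {i = i} {length c} {length r} {l = levels (suc i) h} (length-merge c r)
      (≤-trans (≮⇒≥ l≮) pc)
      (nonempty (length c) (≤-trans (m^n>0 2 i) pc))
    where
    nonempty : ∀ k → 1 ≤ 2 * k → 1 ≤ k
    nonempty (suc k) _ = s≤s z≤n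
    identity : ∀ i c r l →
      c + r + 6 + (c + r) + i + 18 * (i * c + (i * r + l)) + (2 * (2 * c) + 6 * c) + 0 ≡
      i + 10 * c + 18 * (i * (c + r) + l) + (2 * (c + r) + 6 * 1)
    identity = solve-∀
    stay : ∀ {i c r m l} → m ≡ c + r → c + r ≤ 2 * c → 1 ≤ c →
      c + r + 6 + m + i + 18 * (i * c + (i * r + l)) ≤ i + 10 * c + 18 * (i * m + l)
    stay {i} {c} {r} {m} {l} refl p q =
      linear 0 (+-mono-≤ (*-monoʳ-≤ 2 p) (*-monoʳ-≤ 6 q)) (identity i c r l)

  insert-work : ∀ y h → let (j , c′ , h′) = carry 0 (y ∷ []) h in
    carryWork 0 (y ∷ []) h + length c′ + j + 18 * levels 0 h ≤ 10 + 18 * levels 0 (insert y h)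
  insert-work y h with carry 0 (y ∷ []) h | carry-work 0 (y ∷ []) h (s≤s z≤n)
  ... | j , c′ , h′ | p rewrite weight-plug-empties (λ i _ → i) j {c′ ∷ h′} = p

  module _ (cap : A → ℕ) where

    cappedLevels : ℕ → Heap → ℕ
    cappedLevels = weight (λ i x → i ⊓ cap x)

    -- At least half of the elements x of a batch that is too big for level i have i < cap x.
    Rises : List A → Set
    Rises xs = ∀ i → 2 ^ i < length xs →
      length xs + 2 * sumBy (λ x → i ⊓ cap x) xs ≤ 2 * sumBy (λ x → suc i ⊓ cap x) xs

    -- When a batch rises, `levels` grows by 1 for each of its letters, while by `Rises` the capped
    -- sum grows for at least half of them. So the growth of `levels` is at most twice that of
    -- `cappedLevels`. The property `Good` is whatever ensures `Rises` for the batches that occur.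
    carry-capped : (Good : List A → Set) → (∀ {xs ys} → xs ↭ ys → Good xs → Good ys) →
      (∀ {xs} ys → Good (xs ++ ys) → Rises xs) →
      ∀ i c h → Good (c ++ concat h) →
      let (j , c′ , h′) = carry i c h in
      levels j (c′ ∷ h′) + 2 * (sumBy (λ x → i ⊓ cap x) c + cappedLevels i h) ≤
        i * length c + levels i h + 2 * cappedLevels j (c′ ∷ h′)
    carry-capped Good resp rises i c [] g rewrite levels-∷ i c [] = ≤-refl
    carry-capped Good resp rises i c ([] ∷ h) g rewrite levels-∷ i c h = ≤-refl
    carry-capped Good resp rises i c (r@(_ ∷ _) ∷ h) g with 2 ^ i <? length c + length r
    ... | yes l< rewrite levels-∷ i r h =
      let (j , c′ , h′) = carry (suc i) (merge c r) h
          μ = sumBy (λ x → i ⊓ cap x)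
      in
      rise {i = i} {length c} {length r} {levels (suc i) h} {lj = levels j (c′ ∷ h′)} {μ c} {μ r} {cappedLevels (suc i) h}
        {cappedLevels j (c′ ∷ h′)}
        {m = sumBy (λ x → suc i ⊓ cap x) (merge c r)}
        (length-merge c r) (sumBy-↭ (λ x → suc i ⊓ cap x) (merge-↭ c r))
        (sumBy-++ (λ x → i ⊓ cap x) c) (length-++ c)
        (rises {c ++ r} (concat h) (resp (↭-reflexive (sym (++-assoc c r (concat h)))) g) i
          (subst (2 ^ i <_) (sym (length-++ c)) l<))
        (carry-capped Good resp rises (suc i) (merge c r) h
          (resp (↭-trans (↭-reflexive (sym (++-assoc c r (concat h))))
            (++⁺ʳ (concat h) (↭-sym (merge-↭ c r)))) g))
      where
      identity : ∀ i c r l lj μc μr μ μj m k →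
        lj + 2 * (μc + (μr + μ)) + ((suc i * (c + r) + l + 2 * μj) + 2 * m) + 0 ≡
        i * c + (i * r + l) + 2 * μj + ((lj + 2 * (m + μ)) + (c + r + 2 * (μc + μr)))
      identity = solve-∀
      rise : ∀ {i c r l lj μc μr μ μj m n s t cr} → n ≡ c + r → m ≡ s → t ≡ μc + μr → cr ≡ c + r →
        cr + 2 * t ≤ 2 * s →
        lj + 2 * (m + μ) ≤ suc i * n + l + 2 * μj →
        lj + 2 * (μc + (μr + μ)) ≤ i * c + (i * r + l) + 2 * μj
      rise {i} {c} {r} {l} {lj} {μc} {μr} {μ} {μj} {m} refl refl refl refl p q =
        linear 0 (+-mono-≤ q p) (identity i c r l lj μc μr μ μj m 0)
    ... | no l≮ rewrite levels-∷ i (merge c r) h | levels-∷ i r h =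
      let μ = sumBy (λ x → i ⊓ cap x) in
      ≤-reflexive (stay {i = i} {length c} {length r} {levels (suc i) h} {μ c} {μ r} {cappedLevels (suc i) h} (length-merge c r)
        (trans (sumBy-↭ (λ x → i ⊓ cap x) (merge-↭ c r)) (sumBy-++ (λ x → i ⊓ cap x) c)))
      where
      identity : ∀ i c r l μc μr μ →
        i * (c + r) + l + 2 * (μc + (μr + μ)) ≡ i * c + (i * r + l) + 2 * (μc + μr + μ)
      identity = solve-∀
      stay : ∀ {i c r l μc μr μ n m} → n ≡ c + r → m ≡ μc + μr →
        i * n + l + 2 * (μc + (μr + μ)) ≡ i * c + (i * r + l) + 2 * (m + μ)
      stay {i} {c} {r} {l} {μc} {μr} {μ} refl refl = identity i c r l μc μr μ

    insert-capped : (Good : List A → Set) → (∀ {xs ys} → xs ↭ ys → Good xs → Good ys) →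
      (∀ {xs} ys → Good (xs ++ ys) → Rises xs) → ∀ y h → Good (y ∷ concat h) →
      levels 0 (insert y h) + 2 * cappedLevels 0 h ≤ levels 0 h + 2 * cappedLevels 0 (insert y h)
    insert-capped Good resp rises y h g
      with carry 0 (y ∷ []) h | carry-capped Good resp rises 0 (y ∷ []) h g
    ... | j , c′ , h′ | p
      rewrite weight-plug-empties (λ i _ → i) j {c′ ∷ h′}
            | weight-plug-empties (λ i x → i ⊓ cap x) j {c′ ∷ h′} = p

-- The program

rN rHead rTail rCount rX rI rM rCur rOut rY rP rA rL rG rS rU rPos : ℕ
rN = 0
rHead = 1
rTail = 2
rCount = 3
rX = 4
rI = 5
rM = 6
rCur = 7
rOut = 8
rY = 9
rP = 10
rA = 11
rL = 12
rG = 13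
rS = 14
rU = 15
rPos = 16

aOut aQueue aReport aForced aIsForced aHeap aLen aMin aCarry aPos : ℕ
aOut = 0
aQueue = 1
aReport = 2
aForced = 3
aIsForced = 4
aHeap = 5
aLen = 6
aMin = 7
aCarry = 8
aPos = 9

infixl 7 _⊕_
_⊕_ : Expr → Expr → Expr
_⊕_ = op add

decrement half : Expr → Expr
decrement e = op sub e (lit 1)
half e = op div e (lit 2)

-- Level i of the heap is addressed by P = 2 ^ i: its run is a stack in the cells
-- P + 1, …, P + aLen [ P ] of aHeap, with the minimum on top, and aMin [ P ] is the address
-- of the level containing the least element of level i and above, or 0 if they are empty.
len[P] top[P] : Expr
len[P] = aLen [ reg rP ]
top[P] = aHeap [ reg rP ⊕ len[P] ]

-- Since the merged run is written from its top downwards, starting right above the two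
-- stacks, it may share the array of the first of them.
mergeStep mergeLoop : Cmd
mergeStep =
    ifz (reg rA) (rG := lit 1) (compare rG top[P] (aCarry [ reg rA ]))
  ⨾ ifz (reg rG)
      (aCarry [ reg rA ⊕ len[P] ]:= aCarry [ reg rA ] ⨾ rA := decrement (reg rA))
      (aCarry [ reg rA ⊕ len[P] ]:= top[P] ⨾ aLen [ reg rP ]:= decrement len[P])
mergeLoop = while len[P] mergeStep

carryStep carryLoop : Cmd
carryStep =
    rA := reg rL
  ⨾ rL := reg rL ⊕ len[P]
  ⨾ mergeLoop
  -- `mergeLoop` has reduced the length of level `P` to 0, so `carryLoop` stops here unless the
  -- address is doubled.
  ⨾ ifz (op lt (reg rP) (reg rL)) skip (rP := reg rP ⊕ reg rP)
carryLoop = while len[P] carryStep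

placeLoop : Cmd
placeLoop = while (reg rL)
  (aHeap [ reg rP ⊕ reg rL ]:= aCarry [ reg rL ] ⨾ rL := decrement (reg rL))

above : Expr
above = aMin [ reg rP ⊕ reg rP ]

-- From level `P` downwards, the entry of a level is the better of its own top and the entry of the
-- level above, at the cost of one comparison. Halving takes the address 1 of level 0 to 0, which
-- ends the loop.
fixStep fixLoop : Cmd
fixStep =
  ifz len[P]
    (aMin [ reg rP ]:= above)
    (ifz above
      (aMin [ reg rP ]:= reg rP)
      (compare rG top[P] (aHeap [ above ⊕ aLen [ above ] ])
       ⨾ ifz (reg rG) (aMin [ reg rP ]:= above) (aMin [ reg rP ]:= reg rP)))
fixLoop = while (reg rP) (fixStep ⨾ rP := half (reg rP))

insertHeap : Cmd
insertHeap =
    aCarry [ lit 1 ]:= reg rY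
  ⨾ rL := lit 1
  ⨾ rP := lit 1
  ⨾ carryLoop
  ⨾ aLen [ reg rP ]:= reg rL
  ⨾ placeLoop
  ⨾ fixLoop

popHeap : Cmd
popHeap = aLen [ reg rP ]:= decrement len[P] ⨾ fixLoop

-- Counts the forced letters before rY by exponential search from the rCur-th on, where rS is
-- the stride and rU is 1 while it is still growing.
searchStep search : Cmd
searchStep =
    -- A probe beyond the last forced letter fails without a comparison.
    ifz (op lt (reg rM) (reg rPos ⊕ reg rS))
      (compare rG (aForced [ reg rPos ⊕ reg rS ]) (reg rY))
      (rG := lit 0)
  ⨾ ifz (reg rG) (rU := lit 0) (rPos := reg rPos ⊕ reg rS)
  ⨾ ifz (reg rU) (rS := half (reg rS)) (rS := reg rS ⊕ reg rS)
search =
    rPos := reg rCur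
  ⨾ rS := lit 1
  ⨾ rU := lit 1
  ⨾ while (reg rS) searchStep
  ⨾ aPos [ reg rY ]:= reg rPos

enqueueReports : Cmd
enqueueReports =
    rI := lit 0
  ⨾ while (op lt (reg rI) (reg rCount))
      (aQueue [ reg rTail ]:= aReport [ reg rI ]
       ⨾ rI := reg rI ⊕ lit 1
       ⨾ rTail := reg rTail ⊕ lit 1)

insertReports : Cmd
insertReports =
    rI := lit 0
  ⨾ while (op lt (reg rI) (reg rCount))
      (rY := aReport [ reg rI ]
       ⨾ rI := reg rI ⊕ lit 1
       ⨾ ifz (aIsForced [ reg rY ]) (search ⨾ insertHeap) skip)

findForced : Cmd
findForced =
    init rCount aReport
  ⨾ enqueueReports
  ⨾ while (op lt (reg rHead) (reg rTail))
      (rX := aQueue [ reg rHead ]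
       ⨾ rHead := reg rHead ⊕ lit 1
       -- Note the order of the branches: the registers agree after the increment, and the value of
       -- the test is 1, iff the letter was alone in the queue.
       ⨾ ifz (op eq (reg rHead) (reg rTail)) skip
           (rM := reg rM ⊕ lit 1 ⨾ aForced [ reg rM ]:= reg rX ⨾ aIsForced [ reg rX ]:= lit 1)
       ⨾ step (reg rX) rCount aReport
       ⨾ enqueueReports)

takeForced nextLetter : Cmd
takeForced = rCur := reg rCur ⊕ lit 1 ⨾ rX := aForced [ reg rCur ]
nextLetter =
    rP := aMin [ lit 1 ]
  ⨾ ifz (reg rP)
      takeForced
      (rX := top[P]
       -- `aPos [ x ]` forced letters precede `x` and `rCur` have been output, so `x` is next unless
       -- the former number is larger. The oracle is not asked.
       ⨾ ifz (op lt (reg rCur) (aPos [ reg rX ])) popHeap takeForced)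

outputAll : Cmd
outputAll =
    init rCount aReport
  ⨾ insertReports
  ⨾ while (op lt (reg rOut) (reg rN))
      (nextLetter
       ⨾ aOut [ reg rOut ]:= reg rX
       ⨾ rOut := reg rOut ⊕ lit 1
       ⨾ step (reg rX) rCount aReport
       ⨾ insertReports)

program : Cmd
program = findForced ⨾ outputAll

-- Correctness and cost of the heap operations

Stack : ∀ {n} → (ℕ → ℕ) → ℕ → Word n → Set
Stack f base [] = ⊤
Stack f base (x ∷ xs) = f (base + suc (length xs)) ≡ toℕ x × Stack f base xs

stack-cong : ∀ {n} {f g : ℕ → ℕ} base (xs : Word n) →
  (∀ i → base < i → i ≤ base + length xs → g i ≡ f i) → Stack f base xs → Stack g base xs
stack-cong base [] h s = tt
stack-cong base (x ∷ xs) h (e≡ , s) =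
  trans (h _ (m<m+n base z<s) ≤-refl) e≡ ,
  stack-cong base xs (λ i b< i≤ → h i b< (≤-trans i≤ (+-monoʳ-≤ base (n≤1+n _)))) s

stack-update : ∀ {n} {f : ℕ → ℕ} base (xs : Word n) {i v} → base + length xs < i →
               Stack f base xs → Stack (update f i v) base xs
stack-update {f = f} base xs {i} {v} b< =
  stack-cong base xs λ j _ j≤ → update-other f {i} v λ { refl → <⇒≱ b< j≤ }

module HeapCode {n : ℕ} {S : MPS n} (C : Candidate S) (π : Word n)
               (w : ℕ) (room : 16 * suc n ≤ 2 ^ w)
               (π-unique : Unique π) (π-complete : ∀ x → x ∈ π) where

  open WordRAM w hiding (Run)
  open Machine C π w room π-unique π-complete
  open Heaps (ord π)

  -- The bound `4 * N` of `carry-height`, with `N = suc n` as a bound on the number of letters.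
  Lim : ℕ
  Lim = 4 * suc n

  ≤Lim : ∀ {i} → i ≤ Lim → i ≤ 8 * suc n
  ≤Lim i≤ = ≤-trans i≤ (*-monoˡ-≤ (suc n) {4} {8} (s≤s (s≤s (s≤s (s≤s z≤n)))))

  ≤Lim₂ : ∀ {i} → i ≤ Lim → i + i ≤ 8 * suc n
  ≤Lim₂ i≤ = ≤-trans (+-mono-≤ i≤ i≤) (≤-reflexive (sym (*-distribʳ-+ (suc n) 4 4)))

  record Merged (σ σ′ : State n) (p m : ℕ) (c : Word n) : Set where
    constructor merged
    field
      result    : Stack (arrays σ′ aCarry) 0 c
      rest      : ∀ i → m < i → arrays σ′ aCarry i ≡ arrays σ aCarry i
      emptied   : arrays σ′ aLen p ≡ 0
      unchanged : ∀ i → p ≢ i → arrays σ′ aLen i ≡ arrays σ aLen i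

  -- The induction writes the top cell `m` of the merged run and leaves the cells below to the
  -- smaller problem, whose field `rest` preserves what has been written. While `b` is nonempty, `m`
  -- lies above the cells of `a`, so that no letter is overwritten before it is read.
  merge-code : ∀ {σ} m p a b → length a + length b ≡ m →
    regs σ rP ≡ p → regs σ rA ≡ length a → arrays σ aLen p ≡ length b →
    Stack (arrays σ aCarry) 0 a → Stack (arrays σ aHeap) p b →
    m ≤ Lim → p + length b ≤ Lim →
    Work mergeLoop σ 1 m (λ σ′ → Merged σ σ′ p m (merge a b))
  merge-code m p a [] refl rp ra ln sa sb ml pl = w-weaken ≤-refl z≤n (e-block
    (e-while0 (ev-arr (ev-reg rp) ln) (merged sa (λ _ _ → refl) ln (λ _ _ → refl))))
  merge-code {σ} (suc m) p [] (y ∷ b) e≡ rp ra ln sa (ey , sb) ml pl =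
    e-iter (ev-arr (ev-reg rp) ln)
      (e-seq (e-if0 (ev-reg ra) (e-assign ev-lit (e-if1 (ev-reg refl) (e-seq
        (e-store (ev-add (ev-reg ra) (ev-arr (ev-reg rp) ln) ml′)
                 (ev-arr (ev-add (ev-reg rp) (ev-arr (ev-reg rp) ln) (≤Lim pl)) ey)
          (e-store (ev-reg rp) (ev-pred (ev-arr (ev-reg rp) ln) ml′)
            (w-map finish (merge-code m p [] b (suc-injective e≡) rp ra
              (update-same (arrays σ aLen) p _) tt sb
              (≤-trans (n≤1+n _) ml) (≤-trans (+-monoʳ-≤ p (n≤1+n _)) pl))))))))))
    where
    ml′ : length (y ∷ b) ≤ 8 * suc n
    ml′ = ≤Lim (≤-trans (≤-reflexive e≡) ml)
    finish : ∀ {σ′} → Merged _ σ′ p m (merge [] b) → Merged σ σ′ p (suc m) (y ∷ merge [] b)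
    finish (merged st fr l0 lo) = merged
      (trans (fr _ (s≤s (≤-reflexive (sym (trans (length-merge [] b) (suc-injective e≡))))))
        (trans (cong (λ k → update (arrays σ aCarry) (suc (length b)) (toℕ y) (suc k)) (length-merge [] b))
          (update-same (arrays σ aCarry) (suc (length b)) _)) , st)
      (λ i i> → trans (fr i (<-trans (n<1+n m) i>))
                  (update-other (arrays σ aCarry) _ (<⇒≢ (subst (_< i) (sym e≡) i>))))
      l0
      (λ i i≢ → trans (lo i i≢) (update-other (arrays σ aLen) _ i≢))
  merge-code {σ} (suc m) p (x ∷ a) (y ∷ b) e≡ rp ra ln (ex , sa) (ey , sb) ml pl
    with ord π y <? ord π x
  ... | yes y≺x = e-iter (ev-arr (ev-reg rp) ln)
      (e-seq (e-if1 (ev-reg ra) (e-yes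
        (ev-arr (ev-add (ev-reg rp) (ev-arr (ev-reg rp) ln) (≤Lim pl)) ey)
        (ev-arr (ev-reg ra) ex) y≺x
        (e-if1 (ev-reg refl) (e-seq
        (e-store (ev-add (ev-reg ra) (ev-arr (ev-reg rp) ln) ml′)
                 (ev-arr (ev-add (ev-reg rp) (ev-arr (ev-reg rp) ln) (≤Lim pl)) ey)
          (e-store (ev-reg rp) (ev-pred (ev-arr (ev-reg rp) ln)
              (≤-trans (m≤n+m _ (suc (length a))) ml′))
            (w-map finish (merge-code m p (x ∷ a) b |xa|+|b| rp ra
              (update-same (arrays σ aLen) p _)
              (stack-update 0 (x ∷ a) (m<m+n (suc (length a)) z<s) (ex , sa)) sb
              (≤-trans (n≤1+n _) ml) (≤-trans (+-monoʳ-≤ p (n≤1+n _)) pl))))))))))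
    where
    top : ℕ
    top = suc (length a) + suc (length b)
    ml′ : top ≤ 8 * suc n
    ml′ = ≤Lim (≤-trans (≤-reflexive e≡) ml)
    |xa|+|b| : suc (length a) + length b ≡ m
    |xa|+|b| = trans (sym (+-suc (length a) (length b))) (suc-injective e≡)
    |merge| : length (merge (x ∷ a) b) ≡ m
    |merge| = trans (length-merge (x ∷ a) b) |xa|+|b|
    finish : ∀ {σ′} → Merged _ σ′ p m (merge (x ∷ a) b) → Merged σ σ′ p (suc m) (y ∷ merge (x ∷ a) b)
    finish (merged st fr l0 lo) = merged
      (trans (fr _ (s≤s (≤-reflexive (sym |merge|))))
        (trans (cong (update (arrays σ aCarry) top (toℕ y)) (trans (cong suc |merge|) (sym e≡)))
          (update-same (arrays σ aCarry) top _)) , st)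
      (λ i i> → trans (fr i (<-trans (n<1+n m) i>))
                  (update-other (arrays σ aCarry) _ (<⇒≢ (subst (_< i) (sym e≡) i>))))
      l0
      (λ i i≢ → trans (lo i i≢) (update-other (arrays σ aLen) _ i≢))
  ... | no y⊀x = e-iter (ev-arr (ev-reg rp) ln)
      (e-seq (e-if1 (ev-reg ra) (e-no
        (ev-arr (ev-add (ev-reg rp) (ev-arr (ev-reg rp) ln) (≤Lim pl)) ey)
        (ev-arr (ev-reg ra) ex) y⊀x
        (e-if0 (ev-reg refl) (e-seq
        (e-store (ev-add (ev-reg ra) (ev-arr (ev-reg rp) ln) ml′)
                 (ev-arr (ev-reg ra) ex)
          (e-assign (ev-pred (ev-reg ra) (≤-trans (m≤m+n (suc (length a)) _) ml′))
            (w-map finish (merge-code m p a (y ∷ b) (suc-injective e≡) rp refl ln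
              (stack-update 0 a (<-trans (n<1+n (length a)) (m<m+n (suc (length a)) z<s)) sa) (ey , sb)
              (≤-trans (n≤1+n _) ml) pl)))))))))
    where
    top : ℕ
    top = suc (length a) + suc (length b)
    ml′ : top ≤ 8 * suc n
    ml′ = ≤Lim (≤-trans (≤-reflexive e≡) ml)
    |merge| : length (merge a (y ∷ b)) ≡ m
    |merge| = trans (length-merge a (y ∷ b)) (suc-injective e≡)
    finish : ∀ {σ′} → Merged _ σ′ p m (merge a (y ∷ b)) → Merged σ σ′ p (suc m) (x ∷ merge a (y ∷ b))
    finish (merged st fr l0 lo) = merged
      (trans (fr _ (s≤s (≤-reflexive (sym |merge|))))
        (trans (cong (update (arrays σ aCarry) top (toℕ x)) (trans (cong suc |merge|) (sym e≡)))
          (update-same (arrays σ aCarry) top _)) , st)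
      (λ i i> → trans (fr i (<-trans (n<1+n m) i>))
                  (update-other (arrays σ aCarry) _ (<⇒≢ (subst (_< i) (sym e≡) i>))))
      l0 lo

-- Representation of the heap in memory

module HeapOps {n : ℕ} {S : MPS n} (C : Candidate S) (π : Word n)
               (w : ℕ) (room : 16 * suc n ≤ 2 ^ w)
               (π-unique : Unique π) (π-complete : ∀ x → x ∈ π) where

  open WordRAM w hiding (Run)
  open Machine C π w room π-unique π-complete
  open Heaps (ord π)
  open HeapCode C π w room π-unique π-complete

  code : Maybe (ℕ × Fin n) → ℕ
  code nothing = 0
  code (just (j , _)) = 2 ^ j

  -- Beyond the last run all lengths are 0, which stops `carryLoop`, and `Mins` likewise demands
  -- zeros there. The number of levels is thus never stored.
  Runs : (ℕ → ℕ) → (ℕ → ℕ) → ℕ → Heap → Set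
  Runs ln arr i [] = ∀ j → i ≤ j → ln (2 ^ j) ≡ 0
  Runs ln arr i (r ∷ h) = ln (2 ^ i) ≡ length r × Stack arr (2 ^ i) r × Runs ln arr (suc i) h

  Mins : (ℕ → ℕ) → ℕ → Heap → Set
  Mins m i [] = ∀ j → i ≤ j → m (2 ^ j) ≡ 0
  Mins m i (r ∷ h) = m (2 ^ i) ≡ code (best i (r ∷ h)) × Mins m (suc i) h

  2^-double : ∀ i → 2 ^ i + 2 ^ i ≡ 2 ^ suc i
  2^-double i = cong (2 ^ i +_) (sym (+-identityʳ (2 ^ i)))

  2^-< : ∀ {i j} → i < j → 2 ^ i < 2 ^ j
  2^-< = ^-monoʳ-< 2 (s≤s (s≤s z≤n))

  2^-≤ : ∀ {i j} → i ≤ j → 2 ^ i ≤ 2 ^ j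
  2^-≤ = ^-monoʳ-≤ 2

  2^-≢ : ∀ {i j} → i < j → 2 ^ i ≢ 2 ^ j
  2^-≢ i<j = <⇒≢ (2^-< i<j)

  runs-cong : ∀ {ln ln′ arr} i h → (∀ j → i ≤ j → ln′ (2 ^ j) ≡ ln (2 ^ j)) →
              Runs ln arr i h → Runs ln′ arr i h
  runs-cong i [] p R j i≤ = trans (p j i≤) (R j i≤)
  runs-cong i (r ∷ h) p (l≡ , s , R) =
    trans (p i ≤-refl) l≡ , s , runs-cong (suc i) h (λ j i< → p j (<⇒≤ i<)) R

  runs-cells : ∀ {ln arr arr′} i h → (∀ k → 2 ^ i < k → arr′ k ≡ arr k) →
               Runs ln arr i h → Runs ln arr′ i h
  runs-cells i [] p R = R
  runs-cells i (r ∷ h) p (l≡ , s , R) =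
    l≡ , stack-cong (2 ^ i) r (λ k i< _ → p k i<) s ,
    runs-cells (suc i) h (λ k i< → p k (<-trans (2^-< (n<1+n i)) i<)) R

  runs-drop : ∀ {ln arr} ls {h} → Runs ln arr 0 (plug ls h) → Runs ln arr (length ls) h
  runs-drop [] R = R
  runs-drop (l ∷ ls) R = runs-drop ls R .proj₂ .proj₂

  runs-plug : ∀ {ln ln′ arr} ls {h h′} → (∀ k → k < length ls → ln′ (2 ^ k) ≡ ln (2 ^ k)) →
    Runs ln arr 0 (plug ls h) → Runs ln′ arr (length ls) h′ → Runs ln′ arr 0 (plug ls h′)
  runs-plug [] p R R′ = R′
  runs-plug (l ∷ ls) p R R′ with runs-drop ls R
  ... | l≡ , s , _ = runs-plug ls (λ k k< → p k (m<n⇒m<1+n k<)) R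
                       (trans (p (length ls) (n<1+n _)) l≡ , s , R′)

  runs-empties : ∀ {ln arr} j {h} → (∀ k → k < j → ln (2 ^ k) ≡ 0) →
                 Runs ln arr j h → Runs ln arr 0 (plug (empties j) h)
  runs-empties zero p R = R
  runs-empties (suc j) p R = runs-empties j (λ k k< → p k (m<n⇒m<1+n k<)) (p j (n<1+n j) , tt , R)

  mins-head : ∀ {m} i h → Mins m i h → m (2 ^ i) ≡ code (best i h)
  mins-head i [] M = M i ≤-refl
  mins-head i (r ∷ h) M = proj₁ M

  mins-drop : ∀ {m} ls {h} → Mins m 0 (plug ls h) → Mins m (length ls) h
  mins-drop [] M = M
  mins-drop (l ∷ ls) M = mins-drop ls M .proj₂

  mins-update : ∀ {m} k {i v} h → k < i → Mins m i h → Mins (update m (2 ^ k) v) i h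
  mins-update {m} k [] k<i M j i≤ = trans (update-other m _ (2^-≢ (<-≤-trans k<i i≤))) (M j i≤)
  mins-update {m} k (r ∷ h) k<i (e≡ , M) =
    trans (update-other m _ (2^-≢ k<i)) e≡ , mins-update k h (m<n⇒m<1+n k<i) M

  caps-drop : ∀ ls {h} → Caps 0 (plug ls h) → Caps (length ls) h
  caps-drop [] c = c
  caps-drop (l ∷ ls) c = caps-drop ls c .proj₂

  caps-plug : ∀ ls {h h′} → Caps 0 (plug ls h) → Caps (length ls) h′ → Caps 0 (plug ls h′)
  caps-plug [] c c′ = c′
  caps-plug (l ∷ ls) c c′ = caps-plug ls c (caps-drop ls c .proj₁ , c′)

  caps-empties : ∀ j {h} → Caps j h → Caps 0 (plug (empties j) h)
  caps-empties zero c = c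
  caps-empties (suc j) c = caps-empties j (z≤n , c)

  -- By `caps`, the run of level `i` occupies cells from `2 ^ i + 1` to at most `2 ^ suc i`, so that
  -- levels do not overlap; `height` keeps all these addresses within `Lim`.
  record Heaped (σ : State n) (h : Heap) : Set where
    constructor heaped
    field
      runs   : Runs (arrays σ aLen) (arrays σ aHeap) 0 h
      mins   : Mins (arrays σ aMin) 0 h
      caps   : Caps 0 h
      height : 2 ^ length h ≤ Lim
  open Heaped public

  record Top (ln arr : ℕ → ℕ) (j : ℕ) (z : Fin n) : Set where
    constructor isTop
    field
      {size′} : ℕ
      length≡ : ln (2 ^ j) ≡ suc size′
      cell≡   : arr (2 ^ j + suc size′) ≡ toℕ z
      fits≤   : 2 ^ j + suc size′ ≤ Lim

  2^-height : ∀ i (h : Heap) {k} → k ≤ 2 ^ i → 2 ^ (i + suc (length h)) ≤ Lim → 2 ^ i + k ≤ Lim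
  2^-height i h {k} k≤ ht = ≤-trans (+-monoʳ-≤ (2 ^ i) k≤) (≤-trans (≤-reflexive (2^-double i))
    (≤-trans (2^-≤ (≤-trans (≤-reflexive (+-comm 1 i)) (+-monoʳ-≤ i (s≤s (z≤n {length h}))))) ht))

  best-top : ∀ {ln arr i} h {j z} → Runs ln arr i h → Caps i h → 2 ^ (i + length h) ≤ Lim →
             best i h ≡ just (j , z) → Top ln arr j z
  best-top {i = i} ([] ∷ h) R (_ , c) ht b = best-top h (R .proj₂ .proj₂) c
    (subst (λ k → 2 ^ k ≤ Lim) (+-suc i (length h)) ht) b
  best-top {i = i} ((x ∷ r) ∷ h) R@(l≡ , s≡ , R′) (k≤ , c) ht b with best (suc i) h in b′
  best-top {i = i} ((x ∷ r) ∷ h) (l≡ , s≡ , R′) (k≤ , c) ht refl | nothing =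
    isTop l≡ (proj₁ s≡) (2^-height i h k≤ ht)
  best-top {i = i} ((x ∷ r) ∷ h) (l≡ , s≡ , R′) (k≤ , c) ht b | just (j , z) with ord π x <? ord π z
  best-top {i = i} ((x ∷ r) ∷ h) (l≡ , s≡ , R′) (k≤ , c) ht refl | just (j , z) | yes _ =
    isTop l≡ (proj₁ s≡) (2^-height i h k≤ ht)
  best-top {i = i} ((x ∷ r) ∷ h) (l≡ , s≡ , R′) (k≤ , c) ht refl | just (j , z) | no _ =
    best-top h R′ c (subst (λ k → 2 ^ k ≤ Lim) (+-suc i (length h)) ht) b′

  record Carried (ln arr : ℕ → ℕ) (σ′ : State n) (i : ℕ) (out : ℕ × Word n × Heap) : Set where
    constructor carried
    j : ℕ
    j = proj₁ out
    c′ : Word n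
    c′ = proj₁ (proj₂ out)
    h′ : Heap
    h′ = proj₂ (proj₂ out)
    field
      address : regs σ′ rP ≡ 2 ^ j
      count   : regs σ′ rL ≡ length c′
      stack   : Stack (arrays σ′ aCarry) 0 c′
      upper   : Runs (arrays σ′ aLen) arr (suc j) h′
      cleared : ∀ k → i ≤ k → k < j → arrays σ′ aLen (2 ^ k) ≡ 0
      lower   : ∀ k → k < i → arrays σ′ aLen (2 ^ k) ≡ ln (2 ^ k)

  carry-code : ∀ {σ} i c h → regs σ rP ≡ 2 ^ i → regs σ rL ≡ length c →
    Stack (arrays σ aCarry) 0 c → Runs (arrays σ aLen) (arrays σ aHeap) i h → Caps i h →
    2 ^ (i + length h) ≤ Lim → length c + length (concat h) ≤ suc n →
    Work carryLoop σ 1 (carryWork i c h)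
      (λ σ′ → Carried (arrays σ aLen) (arrays σ aHeap) σ′ i (carry i c h))
  carry-code i c [] rp rl sc R cp ht size = e-block (e-while0 (ev-arr (ev-reg rp) (R i ≤-refl))
    (carried rp rl sc (λ j i< → R j (<⇒≤ i<)) (λ k i≤ k< → ⊥-elim (<⇒≱ k< i≤)) λ _ _ → refl))
  carry-code i c ([] ∷ h) rp rl sc R cp ht size = e-block (e-while0 (ev-arr (ev-reg rp) (R .proj₁))
    (carried rp rl sc (R .proj₂ .proj₂) (λ k i≤ k< → ⊥-elim (<⇒≱ k< i≤)) λ _ _ → refl))
  carry-code {σ} i c (r@(y ∷ r′) ∷ h) rp rl sc (l≡ , sr , R) (r≤ , cp) ht size
    with 2 ^ i <? length c + length r
  ... | yes s> = w-convert
      (≤-trans (≤-reflexive (cost (length c + length r) _)) (n≤1+n _)) (+-monoˡ-≤ (carryWork (suc i) (merge c r) h)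
        (≤-trans (≤-reflexive (+-identityʳ (length c + length r))) (m≤m+n (length c + length r) 6)))
      (w-while (ev-arr (ev-reg rp) l≡)
        (w-seq (e-block (e-assign (ev-reg rl)
        (w-seq (e-block (e-assign (ev-add (ev-reg rl) (ev-arr (ev-reg rp) l≡) s≤)
        (w-then (merge-code (length c + length r) (2 ^ i) c r refl rp refl l≡ sc sr s≤Lim p≤)
          λ {σ′} F (merged st _ l0 lo) → e-block (e-if1 (ev-lt1
              (ev-reg (trans (F .reg≡ rP refl) rp)) (ev-reg (F .reg≡ rL refl)) s>)
            (e-assign (ev-add (ev-reg (trans (F .reg≡ rP refl) rp))
                (ev-reg (trans (F .reg≡ rP refl) rp)) (≤Lim P≤))
            (w-map (finish F l0 lo) (carry-code (suc i) (merge c r) h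
              (2^-double i) (trans (F .reg≡ rL refl) (sym (length-merge c r))) st
              (subst (λ f → Runs _ f (suc i) h) (sym (F .arr≡ aHeap refl))
                (runs-cong (suc i) h (λ j i< → lo (2 ^ j) (2^-≢ i<)) R)) cp
              (subst (λ k → 2 ^ k ≤ Lim) (+-suc i (length h)) ht)
              size′))))))))))))
    where
    s≤n : length c + length r ≤ suc n
    s≤n = ≤-trans (+-monoʳ-≤ (length c) (≤-trans (m≤m+n _ _) (≤-reflexive (sym (length-++ r))))) size
    s≤Lim : length c + length r ≤ Lim
    s≤Lim = ≤-trans s≤n (m≤n*m (suc n) 4)
    s≤ : length c + length r ≤ 8 * suc n
    s≤ = ≤Lim s≤Lim
    p≤ : 2 ^ i + length r ≤ Lim
    p≤ = 2^-height i h r≤ ht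
    P≤ : 2 ^ i + 2 ^ i ≤ Lim
    P≤ = 2^-height i h ≤-refl ht
    size′ : length (merge c r) + length (concat h) ≤ suc n
    size′ = ≤-trans (≤-reflexive (trans (cong (_+ length (concat h)) (length-merge c r))
      (trans (+-assoc (length c) (length r) _) (cong (length c +_) (sym (length-++ r)))))) size
    cost : ∀ s v → suc (1 + (1 + (1 + 1)) + 1) + (0 + (0 + (s + 0)) + v) ≡ s + 6 + v
    cost = solve-∀
    finish : ∀ {σ₁ σ₂ σ₃} → Frame mergeLoop σ₁ σ₂ → arrays σ₂ aLen (2 ^ i) ≡ 0 →
      (∀ k → 2 ^ i ≢ k → arrays σ₂ aLen k ≡ arrays σ₁ aLen k) →
      Carried (arrays σ₂ aLen) (arrays σ₂ aHeap) σ₃ (suc i) (carry (suc i) (merge c r) h) →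
      Carried (arrays σ₁ aLen) (arrays σ₁ aHeap) σ₃ i (carry (suc i) (merge c r) h)
    finish {σ₁} F l0 lo (carried a b d e f g) = carried a b d
      (subst (λ f → Runs _ f _ _) (F .arr≡ aHeap refl) e)
      (λ k i≤ k< → case m≤n⇒m<n∨m≡n i≤ of λ
        { (inj₁ i<k) → f k i<k k<
        ; (inj₂ refl) → trans (g i (n<1+n i)) l0 })
      (λ k k<i → trans (g k (m<n⇒m<1+n k<i)) (lo (2 ^ k) (2^-≢ k<i ∘ sym)))
  ... | no s≤2^i = w-convert
      (≤-trans (≤-reflexive (cost (length c + length r))) (n≤1+n _))
      (≤-trans (≤-reflexive (cost₀ (length c + length r))) (m≤m+n (length c + length r) 6))
      (w-while (ev-arr (ev-reg rp) l≡)
        (w-seq (e-block (e-assign (ev-reg rl)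
        (w-seq (e-block (e-assign (ev-add (ev-reg rl) (ev-arr (ev-reg rp) l≡) s≤)
        (w-then (merge-code (length c + length r) (2 ^ i) c r refl rp refl l≡ sc sr s≤Lim p≤)
          λ {σ′} F (merged st _ l0 lo) → e-block (e-if0 (ev-lt0
              (ev-reg (trans (F .reg≡ rP refl) rp)) (ev-reg (F .reg≡ rL refl)) s≤2^i)
            (e-skip (e-block (e-while0 (ev-arr (ev-reg (trans (F .reg≡ rP refl) rp)) l0)
              (carried (trans (F .reg≡ rP refl) rp)
                (trans (F .reg≡ rL refl) (sym (length-merge c r))) st
                (runs-cong (suc i) h (λ j i< → lo (2 ^ j) (2^-≢ i<)) R)
                (λ k i≤ k< → ⊥-elim (<⇒≱ k< i≤))
                (λ k k<i → lo (2 ^ k) (2^-≢ k<i ∘ sym)))))))))))))))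
    where
    s≤n : length c + length r ≤ suc n
    s≤n = ≤-trans (+-monoʳ-≤ (length c) (≤-trans (m≤m+n _ _) (≤-reflexive (sym (length-++ r))))) size
    s≤Lim : length c + length r ≤ Lim
    s≤Lim = ≤-trans s≤n (m≤n*m (suc n) 4)
    s≤ : length c + length r ≤ 8 * suc n
    s≤ = ≤Lim s≤Lim
    p≤ : 2 ^ i + length r ≤ Lim
    p≤ = 2^-height i h r≤ ht
    cost : ∀ s → suc (1 + (1 + (1 + 1)) + 1) + (0 + (0 + (s + 0)) + 0) ≡ s + 6
    cost = solve-∀
    cost₀ : ∀ s → 0 + (0 + (s + 0)) + 0 ≡ s
    cost₀ = solve-∀

  place-code : ∀ {σ} i (c : Word n) → regs σ rP ≡ 2 ^ i → regs σ rL ≡ length c →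
    Stack (arrays σ aCarry) 0 c → 2 ^ i + length c ≤ Lim →
    Work placeLoop σ 1 (length c) (λ σ′ → Stack (arrays σ′ aHeap) (2 ^ i) c ×
      (∀ k → 2 ^ i + length c < k → arrays σ′ aHeap k ≡ arrays σ aHeap k))
  place-code i [] rp rl sc p≤ = e-block (e-while0 (ev-reg rl) (tt , λ _ _ → refl))
  place-code {σ} i (x ∷ c) rp rl (s≡ , sc) p≤ = e-iter (ev-reg rl)
    (e-seq (e-store (ev-add (ev-reg rp) (ev-reg rl) (≤Lim p≤)) (ev-arr (ev-reg rl) s≡)
      (e-assign (ev-pred (ev-reg rl) (≤Lim (≤-trans (m≤n+m _ (2 ^ i)) p≤)))
        (w-map (λ {σ′} → finish {σ′}) (place-code i c rp refl sc (≤-trans (+-monoʳ-≤ (2 ^ i) (n≤1+n _)) p≤))))))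
    where
    finish : ∀ {σ′ : State n} → Stack (arrays σ′ aHeap) (2 ^ i) c ×
      (∀ k → 2 ^ i + length c < k → arrays σ′ aHeap k ≡
        update (arrays σ aHeap) (2 ^ i + suc (length c)) (toℕ x) k) →
      Stack (arrays σ′ aHeap) (2 ^ i) (x ∷ c) ×
      (∀ k → 2 ^ i + suc (length c) < k → arrays σ′ aHeap k ≡ arrays σ aHeap k)
    finish (s , fr) =
      ( trans (fr _ (+-monoʳ-< (2 ^ i) (n<1+n _))) (update-same (arrays σ aHeap) (2 ^ i + suc (length c)) _)
      , s) ,
      λ k k> → trans (fr k (<-trans (+-monoʳ-< (2 ^ i) (n<1+n _)) k>))
                 (update-other (arrays σ aHeap) _ (<⇒≢ k>))

  code-just : ∀ j {z : Fin n} → ∃[ u ] code (just (j , z)) ≡ suc u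
  code-just j = pred (2 ^ j) , sym (suc-pred (2 ^ j) {{m^n≢0 2 j}})

  2^suc/2 : ∀ i → 2 ^ suc i / 2 ≡ 2 ^ i
  2^suc/2 i = trans (cong (_/ 2) (*-comm 2 (2 ^ i))) (m*n/n≡m (2 ^ i) 2)

  -- Only the minima stored for the changed level and for those below it can be out of date. As `ls`
  -- lists the latter downwards, recursion on `ls` follows the halving of the address.
  fix-code : ∀ {σ} ls r h → regs σ rP ≡ 2 ^ length ls →
    Runs (arrays σ aLen) (arrays σ aHeap) 0 (plug ls (r ∷ h)) →
    Mins (arrays σ aMin) (suc (length ls)) h →
    Caps 0 (plug ls (r ∷ h)) → 2 ^ length (plug ls (r ∷ h)) ≤ Lim →
    Work fixLoop σ 1 (suc (length ls)) (λ σ′ → Mins (arrays σ′ aMin) 0 (plug ls (r ∷ h)))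

  fix-rest : ∀ {σ} ls r h → regs σ rP ≡ 2 ^ length ls / 2 →
    Runs (arrays σ aLen) (arrays σ aHeap) 0 (plug ls (r ∷ h)) →
    Mins (arrays σ aMin) (length ls) (r ∷ h) →
    Caps 0 (plug ls (r ∷ h)) → 2 ^ length (plug ls (r ∷ h)) ≤ Lim →
    Work fixLoop σ 1 (length ls) (λ σ′ → Mins (arrays σ′ aMin) 0 (plug ls (r ∷ h)))
  fix-rest [] r h rp R M cp ht = e-block (e-while0 (ev-reg rp) M)
  fix-rest (l ∷ ls) r h rp R M cp ht =
    fix-code ls l (r ∷ h) (trans rp (2^suc/2 (length ls))) R M cp ht

  module Fix (σ : State n) (ls : List Batch) (r : Batch) (h : Heap) (rp : regs σ rP ≡ 2 ^ length ls)
             (R : Runs (arrays σ aLen) (arrays σ aHeap) 0 (plug ls (r ∷ h)))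
             (M : Mins (arrays σ aMin) (suc (length ls)) h)
             (cp : Caps 0 (plug ls (r ∷ h))) (ht : 2 ^ length (plug ls (r ∷ h)) ≤ Lim) where

    i : ℕ
    i = length ls

    ht′ : 2 ^ (i + suc (length h)) ≤ Lim
    ht′ = subst (λ k → 2 ^ k ≤ Lim) (length-plug ls (r ∷ h)) ht

    P≢0 : σ ⊢ reg rP ⇓ suc (pred (2 ^ i))
    P≢0 = ev-reg (trans rp (sym (suc-pred (2 ^ i) {{m^n≢0 2 i}})))

    P+P : 2 ^ i + 2 ^ i ≤ 8 * suc n
    P+P = ≤Lim (2^-height i h ≤-refl ht′)

    ev-above : ∀ {τ} → arrays τ aMin ≡ arrays σ aMin → regs τ rP ≡ regs σ rP →
               τ ⊢ above ⇓ code (best (suc i) h)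
    ev-above m≡ r≡ = ev-arr (ev-add (ev-reg (trans r≡ rp)) (ev-reg (trans r≡ rp)) P+P)
      (trans (cong₂ (λ f k → f k) m≡ (2^-double i)) (mins-head (suc i) h M))

    updated : ∀ {v} → v ≡ code (best i (r ∷ h)) → Mins (update (arrays σ aMin) (2 ^ i) v) i (r ∷ h)
    updated v≡ = trans (update-same (arrays σ aMin) (2 ^ i) _) v≡ , mins-update i h (n<1+n i) M

  fix-code {σ} ls [] h rp R M cp ht =
    e-iter P≢0 (e-seq (e-if0 (ev-arr (ev-reg rp) (runs-drop ls R .proj₁))
      (e-store (ev-reg rp) (ev-above refl refl) (e-assign (ev-half (ev-reg rp))
        (fix-rest ls [] h refl R (updated refl) cp ht)))))
    where open Fix σ ls [] h rp R M cp ht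
  fix-code {σ} ls r@(x ∷ r′) h rp R M cp ht = cases (best (suc i) h) refl
    where
    open Fix σ ls r h rp R M cp ht
    Rᵢ : Runs (arrays σ aLen) (arrays σ aHeap) i (r ∷ h)
    Rᵢ = runs-drop ls R
    topᵢ : Top (arrays σ aLen) (arrays σ aHeap) i x
    topᵢ = isTop (Rᵢ .proj₁) (Rᵢ .proj₂ .proj₁ .proj₁) (2^-height i h (caps-drop ls cp .proj₁) ht′)
    ev-top : ∀ {τ j z} e → Top (arrays τ aLen) (arrays τ aHeap) j z → τ ⊢ e ⇓ 2 ^ j →
             τ ⊢ aHeap [ e ⊕ aLen [ e ] ] ⇓ toℕ z
    ev-top e (isTop l≡ c≡ f≤) p = ev-arr (ev-add p (ev-arr p l≡) (≤Lim f≤)) c≡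
    cases : ∀ b → best (suc i) h ≡ b →
      Work fixLoop σ 1 (suc i) (λ σ′ → Mins (arrays σ′ aMin) 0 (plug ls (r ∷ h)))
    cases nothing b≡ =
      e-iter P≢0 (e-seq (e-if1 (ev-arr (ev-reg rp) (Rᵢ .proj₁))
        (e-if0 (subst (λ b → σ ⊢ above ⇓ code b) b≡ (ev-above refl refl))
        (e-store (ev-reg rp) (ev-reg rp) (e-assign (ev-half (ev-reg rp))
          (fix-rest ls r h refl R
            (updated (cong (λ b → code (just (choose i x b))) (sym b≡))) cp ht))))))
    cases (just (j , z)) b≡ with ord π x <? ord π z
    ... | yes x≺z =
      e-iter P≢0 (e-seq (e-if1 (ev-arr (ev-reg rp) (Rᵢ .proj₁))
        (e-if1 (subst (λ b → σ ⊢ above ⇓ b) (trans (cong code b≡) (code-just j {z} .proj₂)) (ev-above refl refl))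
        (e-seq (e-yes (ev-top (reg rP) topᵢ (ev-reg rp)) (ev-top above topⱼ above≡) x≺z
        (e-if1 (ev-reg refl) (e-store (ev-reg rp) (ev-reg rp) (e-assign (ev-half (ev-reg rp))
          (fix-rest ls r h refl R (updated (trans
            (sym (cong (code ∘ just) (pick-yes (ord π x <? ord π z) x≺z)))
            (cong (λ b → code (just (choose i x b))) (sym b≡)))) cp ht)))))))))
      where
      above≡ : σ ⊢ above ⇓ 2 ^ j
      above≡ = subst (λ b → σ ⊢ above ⇓ code b) b≡ (ev-above refl refl)
      topⱼ : Top (arrays σ aLen) (arrays σ aHeap) j z
      topⱼ = best-top h (Rᵢ .proj₂ .proj₂) (caps-drop ls cp .proj₂)
               (subst (λ k → 2 ^ k ≤ Lim) (+-suc i (length h)) ht′) b≡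
    ... | no x⊀z =
      e-iter P≢0 (e-seq (e-if1 (ev-arr (ev-reg rp) (Rᵢ .proj₁))
        (e-if1 (subst (λ b → σ ⊢ above ⇓ b) (trans (cong code b≡) (code-just j {z} .proj₂)) (ev-above refl refl))
        (e-seq (e-no (ev-top (reg rP) topᵢ (ev-reg rp)) (ev-top above topⱼ above≡) x⊀z
        (e-if0 (ev-reg refl) (e-store (ev-reg rp) (ev-above refl refl) (e-assign (ev-half (ev-reg rp))
          (fix-rest ls r h refl R (updated (trans (cong code b≡) (trans
            (sym (cong (code ∘ just) (pick-no (ord π x <? ord π z) x⊀z)))
            (cong (λ b → code (just (choose i x b))) (sym b≡))))) cp ht)))))))))
      where
      above≡ : σ ⊢ above ⇓ 2 ^ j
      above≡ = subst (λ b → σ ⊢ above ⇓ code b) b≡ (ev-above refl refl)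
      topⱼ : Top (arrays σ aLen) (arrays σ aHeap) j z
      topⱼ = best-top h (Rᵢ .proj₂ .proj₂) (caps-drop ls cp .proj₂)
               (subst (λ k → 2 ^ k ≤ Lim) (+-suc i (length h)) ht′) b≡

  carry-mins : ∀ {m} i c h → Mins m i h →
    let (j , _ , h′) = carry i c h in Mins m (suc j) h′
  carry-mins i c [] M j i< = M j (<⇒≤ i<)
  carry-mins i c ([] ∷ h) M = M .proj₂
  carry-mins i c (r@(_ ∷ _) ∷ h) M with 2 ^ i <? length c + length r
  ... | yes _ = carry-mins (suc i) (merge c r) h (M .proj₂)
  ... | no _ = M .proj₂

  -- The amortised part of the cost consists of the carries, the copying of the final run back into
  -- the heap, and the repair of the minima of the levels from `j` down to 0.
  insert-code : ∀ {σ y} h → regs σ rY ≡ toℕ y → Heaped σ h → suc (length (concat h)) ≤ suc n →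
    let (j , c′ , _) = carry 0 (y ∷ []) h in
    Work insertHeap σ 7 (carryWork 0 (y ∷ []) h + (length c′ + suc j))
      (λ σ′ → Heaped σ′ (insert y h))
  insert-code {σ} {y} h ry (heaped R M cp ht) size =
    w-seq (e-block (e-store ev-lit (ev-reg ry)
    (w-seq (e-block (e-assign ev-lit
    (w-seq (e-block (e-assign ev-lit
    (w-then (carry-code 0 (y ∷ []) h refl refl (refl , tt) R cp ht size) after-carry)))))))))
    where
    out : ℕ × Batch × Heap
    out = carry 0 (y ∷ []) h
    j : ℕ
    j = proj₁ out
    c′ : Batch
    c′ = proj₁ (proj₂ out)
    h′ : Heap
    h′ = proj₂ (proj₂ out)
    caps′ : length c′ ≤ 2 ^ j × Caps (suc j) h′
    caps′ = carry-caps 0 {y ∷ []} {h} ≤-refl cp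
    ht′ : 2 ^ (j + suc (length h′)) ≤ Lim
    ht′ = carry-height (suc n) 0 (y ∷ []) h (s≤s z≤n) size ht
    |empties| : length (empties j) ≡ j
    |empties| = length-replicate j
    ht″ : 2 ^ length (plug (empties j) (c′ ∷ h′)) ≤ Lim
    ht″ = subst (λ k → 2 ^ k ≤ Lim) (sym (trans (length-plug (empties j) (c′ ∷ h′))
            (cong (_+ suc (length h′)) |empties|))) ht′
    after-place : ∀ {σ₁ σ₂} → Carried (arrays σ aLen) (arrays σ aHeap) σ₁ 0 out →
      regs σ₂ rP ≡ regs σ₁ rP → arrays σ₂ aMin ≡ arrays σ aMin →
      arrays σ₂ aLen ≡ update (arrays σ₁ aLen) (2 ^ j) (length c′) →
      Stack (arrays σ₂ aHeap) (2 ^ j) c′ →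
      (∀ k → 2 ^ j + length c′ < k → arrays σ₂ aHeap k ≡ arrays σ aHeap k) →
      Work fixLoop σ₂ 1 (suc j) (λ σ′ → Heaped σ′ (insert y h))
    after-place {σ₁} {σ₂} (carried rp rl sc up cl lo) rp₂ m≡ l≡ st fr =
      subst (λ k → Work fixLoop σ₂ 1 (suc k) (λ σ′ → Heaped σ′ (insert y h))) |empties|
      (w-map′ (λ F M′ → heaped
          (subst₂ (λ f g → Runs f g 0 (plug (empties j) (c′ ∷ h′)))
            (sym (F .arr≡ aLen refl)) (sym (F .arr≡ aHeap refl)) R′) M′ cp′ ht″)
        (fix-code (empties j) c′ h′ (trans rp₂ (trans rp (cong (2 ^_) (sym |empties|)))) R′
          (subst (λ k → Mins _ (suc k) h′) (sym |empties|)
            (subst (λ f → Mins f (suc j) h′) (sym m≡) (carry-mins 0 (y ∷ []) h M)))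
          cp′ ht″))
      where
      cp′ : Caps 0 (plug (empties j) (c′ ∷ h′))
      cp′ = caps-empties j caps′
      len₂ : ∀ {k} → 2 ^ j ≢ k → arrays σ₂ aLen k ≡ arrays σ₁ aLen k
      len₂ {k} ne = trans (cong (λ f → f k) l≡) (update-other (arrays σ₁ aLen) _ ne)
      R′ : Runs (arrays σ₂ aLen) (arrays σ₂ aHeap) 0 (plug (empties j) (c′ ∷ h′))
      R′ = runs-empties j (λ k k< → trans (len₂ (2^-≢ k< ∘ sym)) (cl k z≤n k<))
        ( trans (cong (λ f → f (2 ^ j)) l≡) (update-same (arrays σ₁ aLen) (2 ^ j) _)
        , st
        , runs-cells (suc j) h′ (λ k k> → fr k (≤-<-trans
            (≤-trans (+-monoʳ-≤ (2 ^ j) (proj₁ caps′)) (≤-reflexive (2^-double j))) k>))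
          (runs-cong (suc j) h′ (λ k k> → len₂ (2^-≢ k>)) up))
    after-carry : ∀ {σ₁} →
      Frame carryLoop (setReg rP 1 (setReg rL 1 (setCell aCarry 1 (toℕ y) σ))) σ₁ →
      Carried (arrays σ aLen) (arrays σ aHeap) σ₁ 0 out →
      Work (aLen [ reg rP ]:= reg rL ⨾ placeLoop ⨾ fixLoop) σ₁ 3 (length c′ + suc j)
        (λ σ′ → Heaped σ′ (insert y h))
    after-carry F c@(carried rp rl sc up cl lo) =
      w-seq (e-block (e-store (ev-reg rp) (ev-reg rl)
      (w-then (place-code j c′ rp rl sc (2^-height j h′ (proj₁ caps′) ht′))
        λ F₂ (st , fr) → after-place c (F₂ .reg≡ rP refl)
          (trans (F₂ .arr≡ aMin refl) (F .arr≡ aMin refl)) (F₂ .arr≡ aLen refl) st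
          λ k k> → trans (fr k k>) (cong (λ f → f k) (F .arr≡ aHeap refl)))))

  pop-code : ∀ {σ} ls z r h → regs σ rP ≡ 2 ^ length ls → Heaped σ (plug ls ((z ∷ r) ∷ h)) →
    Work popHeap σ 2 (suc (length ls)) (λ σ′ → Heaped σ′ (plug ls (r ∷ h)))
  pop-code {σ} ls z r h rp (heaped R M cp ht) =
    w-seq (e-block (e-store (ev-reg rp) (ev-pred (ev-arr (ev-reg rp) (Rᵢ .proj₁))
        (≤Lim (≤-trans (m≤n+m _ (2 ^ i)) (2^-height i h (capsᵢ .proj₁) ht′))))
      (w-map′ (λ F M′ → heaped
          (subst₂ (λ f g → Runs f g 0 (plug ls (r ∷ h)))
            (sym (F .arr≡ aLen refl)) (sym (F .arr≡ aHeap refl)) R′) M′ cp′ ht″)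
        (fix-code ls r h rp R′ (mins-drop ls M .proj₂) cp′ ht″))))
    where
    i : ℕ
    i = length ls
    Rᵢ : Runs (arrays σ aLen) (arrays σ aHeap) i ((z ∷ r) ∷ h)
    Rᵢ = runs-drop ls R
    capsᵢ : Caps i ((z ∷ r) ∷ h)
    capsᵢ = caps-drop ls cp
    ht′ : 2 ^ (i + suc (length h)) ≤ Lim
    ht′ = subst (λ k → 2 ^ k ≤ Lim) (length-plug ls ((z ∷ r) ∷ h)) ht
    ht″ : 2 ^ length (plug ls (r ∷ h)) ≤ Lim
    ht″ = subst (λ k → 2 ^ k ≤ Lim) (sym (length-plug ls (r ∷ h))) ht′
    cp′ : Caps 0 (plug ls (r ∷ h))
    cp′ = caps-plug ls cp (≤-trans (n≤1+n _) (capsᵢ .proj₁) , capsᵢ .proj₂)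
    R′ : Runs (update (arrays σ aLen) (2 ^ i) (length r)) (arrays σ aHeap) 0 (plug ls (r ∷ h))
    R′ = runs-plug ls (λ k k< → update-other (arrays σ aLen) _ (2^-≢ k< ∘ sym)) R
      ( update-same (arrays σ aLen) (2 ^ i) _ , Rᵢ .proj₂ .proj₁ .proj₂
      , runs-cong (suc i) h (λ j i< → update-other (arrays σ aLen) _ (2^-≢ i<)) (Rᵢ .proj₂ .proj₂))

-- Counting permutations

module Counting {n : ℕ} (A : Antimatroid n) (S : MPS n) (A≐S : Lang A ≐ 𝓛 S) where

  words : List (Word n)
  words = filter (𝓟? A) (shortWords n)

  ∈-words : ∀ {σ} → 𝓛 S σ → (∀ x → x ∈ σ) → σ ∈ words
  ∈-words {σ} L full = ∈-filter⁺ (𝓟? A) (∈-shortWords (proj₁ L)) (proj₂ A≐S L , full)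

  Spells : Word n → Word n → Set
  Spells d v = 𝓛 S v × (∀ {z} → z ∈ v → z ∈ d) × (∀ {z} → z ∈ d → z ∈ v)

  -- Here `k` counts free letters. A swap doubles the number of spellings and may account for two
  -- free letters; squaring that number avoids halving `k`.
  record Variants (k : ℕ) (d : Word n) : Set where
    constructor variants
    field
      spellings : List (Word n)
      distinct  : Unique spellings
      spell     : All (Spells d) spellings
      enough    : 2 ^ k ≤ length spellings * length spellings

  spells-∷ʳ : ∀ {d v x} → Spells d v → x ∉ d → Avail S d x → Spells (d ∷ʳ x) (v ∷ʳ x)
  spells-∷ʳ {d} {v} {x} (L , v⊆ , ⊆v) x∉ av =
    𝓛-∷ʳ S L (x∉ ∘ v⊆) (avail-mono S ⊆v (x∉ ∘ v⊆) av) , extend v⊆ , extend ⊆v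
    where
    extend : ∀ {u w : Word n} → (∀ {z} → z ∈ u → z ∈ w) → ∀ {z} → z ∈ u ∷ʳ x → z ∈ w ∷ʳ x
    extend {u} {w} inc p with ∈-++⁻ u p
    ... | inj₁ q = ∈-++⁺ˡ (inc q)
    ... | inj₂ q = ∈-++⁺ʳ w q

  variants-[] : Variants 0 []
  variants-[] = variants ([] ∷ []) ([] ∷ []) ((([] , λ ()) , id , id) ∷ []) (s≤s z≤n)

  variants-∷ʳ : ∀ {k d x} → Variants k d → x ∉ d → Avail S d x → Variants k (d ∷ʳ x)
  variants-∷ʳ {x = x} (variants vs uq sp count) x∉ av = variants
    (map (_∷ʳ x) vs) (Unique.map⁺ (∷ʳ-injectiveˡ _ _) uq)
    (All.map⁺ (All.map (λ s → spells-∷ʳ s x∉ av) sp))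
    (subst (λ l → _ ≤ l * l) (sym (length-map (_∷ʳ x) vs)) count)

  variants-swap : ∀ {k d x y} → Variants k d → x ∉ d → y ∉ d → x ≢ y → Avail S d x → Avail S d y →
                  Variants (2 + k) (d ∷ʳ x ∷ʳ y)
  variants-swap {k} {d} {x} {y} (variants vs uq sp count) x∉ y∉ x≢y avx avy = variants
    (xy ++ yx)
    (Unique.++⁺ (Unique.map⁺ inj uq) (Unique.map⁺ inj uq) disjoint)
    (All.++⁺ (All.map⁺ (All.map (λ s → spells-∷ʳ (spells-∷ʳ s x∉ avx) y∉x av-yx) sp))
            (All.map⁺ (All.map (λ s → exchange (spells-∷ʳ (spells-∷ʳ s y∉ avy) x∉y av-xy)) sp)))
    (subst (λ l → _ ≤ l * l) (sym (trans (length-++ xy) (cong₂ _+_ (length-map _ vs) (length-map _ vs))))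
      (≤-trans (*-monoʳ-≤ 2 (*-monoʳ-≤ 2 count)) (≤-reflexive (identity (length vs)))))
    where
    xy yx : List (Word n)
    xy = map (λ v → v ∷ʳ x ∷ʳ y) vs
    yx = map (λ v → v ∷ʳ y ∷ʳ x) vs
    inj : ∀ {a b : Fin n} {u v : Word n} → u ∷ʳ a ∷ʳ b ≡ v ∷ʳ a ∷ʳ b → u ≡ v
    inj e≡ = ∷ʳ-injectiveˡ _ _ (∷ʳ-injectiveˡ _ _ e≡)
    disjoint : ∀ {v} → ¬ (v ∈ xy × v ∈ yx)
    disjoint (p , q) with ∈-map⁻ _ p | ∈-map⁻ _ q
    ... | u , _ , refl | u′ , _ , e≡ = x≢y (sym (∷ʳ-injectiveʳ (u ∷ʳ x) (u′ ∷ʳ y) e≡))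
    y∉x : y ∉ d ∷ʳ x
    y∉x p = case ∈-∷ʳ⁻ d p of λ { (inj₁ q) → y∉ q ; (inj₂ q) → x≢y (sym q) }
    x∉y : x ∉ d ∷ʳ y
    x∉y p = case ∈-∷ʳ⁻ d p of λ { (inj₁ q) → x∉ q ; (inj₂ q) → x≢y q }
    av-yx : Avail S (d ∷ʳ x) y
    av-yx = avail-mono S {d} ∈-++⁺ˡ y∉x avy
    av-xy : Avail S (d ∷ʳ y) x
    av-xy = avail-mono S {d} ∈-++⁺ˡ x∉y avx
    flip : ∀ {a b z} → z ∈ d ∷ʳ a ∷ʳ b → z ∈ d ∷ʳ b ∷ʳ a
    flip {a} {b} p with ∈-∷ʳ⁻ (d ∷ʳ a) p
    ... | inj₂ refl = ∈-++⁺ˡ (∈-++⁺ʳ d (here refl))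
    ... | inj₁ q with ∈-∷ʳ⁻ d q
    ... | inj₁ r = ∈-++⁺ˡ (∈-++⁺ˡ r)
    ... | inj₂ refl = ∈-++⁺ʳ (d ∷ʳ b) (here refl)
    exchange : ∀ {v} → Spells (d ∷ʳ y ∷ʳ x) v → Spells (d ∷ʳ x ∷ʳ y) v
    exchange (L , v⊆ , ⊆v) = L , flip ∘ v⊆ , ⊆v ∘ flip
    identity : ∀ l → 2 * (2 * (l * l)) ≡ (l + l) * (l + l)
    identity = solve-∀

  variants-count : ∀ {k d} → Variants k d → (∀ x → x ∈ d) → 2 ^ k ≤ ∣𝓟 A ∣ * ∣𝓟 A ∣
  variants-count (variants vs uq sp count) full = ≤-trans count (*-mono-≤ bound bound)
    where
    bound : length vs ≤ ∣𝓟 A ∣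
    bound = unique-⊆-length uq λ v∈ → case All.lookup sp v∈ of λ
      (L , _ , ⊆v) → ∈-words L λ x → ⊆v (full x)

-- Counting permutations by the slots of the free letters

injective-length : ∀ {X Y : Set} (g : X → Y) {xs ys} → Unique xs → (∀ {x} → x ∈ xs → g x ∈ ys) →
  (∀ {x y} → x ∈ xs → y ∈ xs → g x ≡ g y → x ≡ y) → length xs ≤ length ys
injective-length g {xs} uq into inj = subst (_≤ _) (length-map g xs)
  (unique-⊆-length (unique-map uq inj) λ p → case ∈-map⁻ g p of λ { (x , x∈ , refl) → into x∈ })
  where
  unique-map : ∀ {xs} → Unique xs → (∀ {x y} → x ∈ xs → y ∈ xs → g x ≡ g y → x ≡ y) → Unique (map g xs)
  unique-map [] inj = []
  unique-map (px ∷ uq) inj =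
    All.map⁺ (All.tabulate λ y∈ e≡ → All.lookup px y∈ (inj (here refl) (there y∈) e≡))
    ∷ unique-map uq λ x∈ y∈ → inj (there x∈) (there y∈)

bools : ℕ → List (List Bool)
bools zero = [] ∷ []
bools (suc k) = map (true ∷_) (bools k) ++ map (false ∷_) (bools k)

length-bools : ∀ k → length (bools k) ≡ 2 ^ k
length-bools zero = refl
length-bools (suc k) = trans (length-++ (map (true ∷_) (bools k)))
  (cong₂ _+_ (trans (length-map _ (bools k)) (length-bools k))
    (trans (trans (length-map _ (bools k)) (length-bools k)) (sym (+-identityʳ _))))

∈-bools : ∀ bs → bs ∈ bools (length bs)
∈-bools [] = here refl
∈-bools (true ∷ bs) = ∈-++⁺ˡ (∈-map⁺ (true ∷_) (∈-bools bs))
∈-bools (false ∷ bs) = ∈-++⁺ʳ (map (true ∷_) (bools (length bs))) (∈-map⁺ (false ∷_) (∈-bools bs))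

length-cartesianProductWith : ∀ {X Y Z : Set} (f : X → Y → Z) xs ys →
  length (cartesianProductWith f xs ys) ≡ length xs * length ys
length-cartesianProductWith f [] ys = refl
length-cartesianProductWith f (x ∷ xs) ys = trans (length-++ (map (f x) ys))
  (cong₂ _+_ (length-map (f x) ys) (length-cartesianProductWith f xs ys))

productBy : ∀ {A : Set} → (A → ℕ) → List A → ℕ
productBy f [] = 1
productBy f (x ∷ xs) = f x * productBy f xs

choices : ∀ {A : Set} → (A → ℕ) → (A → ℕ) → List A → List (List ℕ)
choices lo width [] = [] ∷ []
choices lo width (y ∷ ys) =
  cartesianProductWith _∷_ (map (lo y +_) (upTo (width y))) (choices lo width ys)

module _ {A : Set} (lo width : A → ℕ) where

  length-choices : ∀ ys → length (choices lo width ys) ≡ productBy width ys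
  length-choices [] = refl
  length-choices (y ∷ ys) = trans (length-cartesianProductWith _∷_ (map (lo y +_) (upTo (width y))) (choices lo width ys))
    (cong₂ _*_ (trans (length-map (lo y +_) (upTo (width y))) (length-upTo (width y)))
      (length-choices ys))

  choices-unique : ∀ ys → Unique (choices lo width ys)
  choices-unique [] = [] ∷ []
  choices-unique (y ∷ ys) = Unique.cartesianProductWith⁺ _∷_ ∷-injective
    (Unique.map⁺ (+-cancelˡ-≡ (lo y) _ _) (Unique.upTo⁺ (width y))) (choices-unique ys)

  InRange : A → ℕ → Set
  InRange y t = lo y ≤ t × t < lo y + width y

  choices-range : ∀ ys {ts} → ts ∈ choices lo width ys → Pointwise InRange ys ts
  choices-range [] (here refl) = []
  choices-range (y ∷ ys) p
    with ∈-cartesianProductWith⁻ _∷_ (map (lo y +_) (upTo (width y))) (choices lo width ys) p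
  ... | t , ts , t∈ , ts∈ , refl with ∈-map⁻ (lo y +_) t∈
  ... | i , i∈ , refl = (m≤m+n (lo y) i , +-monoʳ-< (lo y) (∈-upTo⁻ i∈)) ∷ choices-range ys ts∈

++-cancel-length : ∀ {A : Set} (u u′ : List A) {v v′} → u ++ v ≡ u′ ++ v′ →
                   length u ≡ length u′ → u ≡ u′ × v ≡ v′
++-cancel-length [] [] e≡ _ = refl , e≡
++-cancel-length (x ∷ u) (x′ ∷ u′) e≡ l≡ with ∷-injective e≡
... | refl , e≡′ with ++-cancel-length u u′ e≡′ (suc-injective l≡)
... | refl , v≡ = refl , v≡

stars-injective : ∀ i j {u v} → replicate i true ++ false ∷ u ≡ replicate j true ++ false ∷ v →
                  i ≡ j × u ≡ v
stars-injective zero zero e≡ = refl , ∷-injectiveʳ e≡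
stars-injective (suc i) (suc j) e≡ with stars-injective i j (∷-injectiveʳ e≡)
... | refl , v≡ = refl , v≡

marker-injective : ∀ {A : Set} {x : A} u u′ {v v′} → x ∉ u → x ∉ u′ →
                   u ++ x ∷ v ≡ u′ ++ x ∷ v′ → u ≡ u′ × v ≡ v′
marker-injective [] [] _ _ e≡ = refl , ∷-injectiveʳ e≡
marker-injective [] (y ∷ u′) _ x∉ e≡ = ⊥-elim (x∉ (here (∷-injectiveˡ e≡)))
marker-injective (y ∷ u) [] x∉ _ e≡ = ⊥-elim (x∉ (here (sym (∷-injectiveˡ e≡))))
marker-injective (y ∷ u) (y′ ∷ u′) x∉ x∉′ e≡ with ∷-injective e≡
... | refl , e≡′ with marker-injective u u′ (x∉ ∘ there) (x∉′ ∘ there) e≡′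
... | refl , v≡ = refl , v≡

-- Every letter y of ns is moved to a slot between a y and its own position in π, while the
-- other letters stay where they are, each at the end of its slot.  In the resulting word the
-- ends of the slots of the letters of ns are invisible; they are recorded in the code.
module Slots {n : ℕ} (π : Word n) (ns : Word n) where

  at : ℕ → Word n → List ℕ → Word n
  at t (y ∷ ys) (s ∷ ss) with s ≟ t
  ... | yes _ = y ∷ at t ys ss
  ... | no _ = at t ys ss
  at t _ _ = []

  respell : List ℕ → ℕ → Word n → Word n
  respell ts t [] = []
  respell ts t (x ∷ r) with x ∈? ns
  ... | yes _ = at t ns ts ++ respell ts (suc t) r
  ... | no _ = at t ns ts ++ x ∷ respell ts (suc t) r

  -- Stars and bars: `true` for each letter moved into the slot, and `false` for the end of a slot
  -- whose own letter belongs to `ns`. The other ends are visible in the word, whence two bits per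
  -- letter of `ns` suffice.
  encode : List ℕ → ℕ → Word n → List Bool
  encode ts t [] = []
  encode ts t (x ∷ r) with x ∈? ns
  ... | yes _ = replicate (length (at t ns ts)) true ++ false ∷ encode ts (suc t) r
  ... | no _ = replicate (length (at t ns ts)) true ++ encode ts (suc t) r

  at-⊆ : ∀ t ys ts {x} → x ∈ at t ys ts → x ∈ ys
  at-⊆ t (y ∷ ys) (s ∷ ts) p with s ≟ t
  at-⊆ t (y ∷ ys) (s ∷ ts) (here e≡) | yes _ = here e≡
  at-⊆ t (y ∷ ys) (s ∷ ts) (there p) | yes _ = there (at-⊆ t ys ts p)
  at-⊆ t (y ∷ ys) (s ∷ ts) p | no _ = there (at-⊆ t ys ts p)

  at-unique : ∀ t {ys} ts → Unique ys → Unique (at t ys ts)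
  at-unique t [] [] = []
  at-unique t [] (_ ∷ _) = []
  at-unique t (s ∷ ts) [] = []
  at-unique t {y ∷ ys} (s ∷ ts) (py ∷ uq) with s ≟ t
  ... | yes _ = All.tabulate (λ p → All.lookup py (at-⊆ t ys ts p)) ∷ at-unique t ts uq
  ... | no _ = at-unique t ts uq

  -- Each letter of `ns` appears in exactly one slot, so the contents of the slots below `N`
  -- determine the chosen slots.
  at-injective : ∀ {N : ℕ} {Q : Fin n → ℕ → Set} ys ts ss → Unique ys →
    (∀ {y s} → Q y s → s < N) → Pointwise Q ys ts → Pointwise Q ys ss →
    (∀ t → t < N → at t ys ts ≡ at t ys ss) → ts ≡ ss
  at-injective [] [] [] _ _ _ _ _ = refl
  at-injective {N} (y ∷ ys) (t ∷ ts) (s ∷ ss) (py ∷ uq) bd (q ∷ pt) (q′ ∷ ps) same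
    with head≡ (t ≟ s)
    where
    head≡ : Dec (t ≡ s) → t ≡ s
    head≡ (yes e≡) = e≡
    head≡ (no t≢s) with same t (bd q)
    ... | e≡ with t ≟ t | s ≟ t
    ... | no c | _ = ⊥-elim (c refl)
    ... | yes _ | yes s≡t = sym s≡t
    ... | yes _ | no _ = ⊥-elim (All.lookup py (at-⊆ t ys ss (subst (y ∈_) e≡ (here refl))) refl)
  ... | refl = cong (t ∷_) (at-injective ys ts ss uq bd pt ps rests)
    where
    rests : ∀ u → u < N → at u ys ts ≡ at u ys ss
    rests u u< with same u u<
    ... | e≡ with t ≟ u
    ... | yes _ = ∷-injectiveʳ e≡
    ... | no _ = e≡

  -- The slots are read off one by one. If the letter `x` of a slot is in `ns`, the stars give the
  -- length of its content; otherwise `x` itself marks the end, since moved letters belong to `ns`.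
  decode : ∀ ts ss t r → respell ts t r ≡ respell ss t r → encode ts t r ≡ encode ss t r →
           ∀ u → t ≤ u → u < t + length r → at u ns ts ≡ at u ns ss
  decode ts ss t [] w≡ c≡ u t≤ u< = ⊥-elim (<⇒≱ u< (≤-trans (≤-reflexive (+-identityʳ t)) t≤))
  decode ts ss t (x ∷ r) w≡ c≡ u t≤ u< with x ∈? ns
  ... | yes _ with stars-injective (length (at t ns ts)) (length (at t ns ss)) c≡
  ... | l≡ , c≡′ with ++-cancel-length (at t ns ts) (at t ns ss) w≡ l≡
  ... | a≡ , w≡′ with m≤n⇒m<n∨m≡n t≤
  ... | inj₁ t< = decode ts ss (suc t) r w≡′ c≡′ u t< (subst (u <_) (+-suc t (length r)) u<)
  ... | inj₂ refl = a≡
  decode ts ss t (x ∷ r) w≡ c≡ u t≤ u< | no x∉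
    with marker-injective (at t ns ts) (at t ns ss) (x∉ ∘ at-⊆ t ns ts) (x∉ ∘ at-⊆ t ns ss) w≡
  ... | a≡ , w≡′ with m≤n⇒m<n∨m≡n t≤
  ... | inj₂ refl = a≡
  ... | inj₁ t< = decode ts ss (suc t) r w≡′
    (++-cancel-length (replicate (length (at t ns ts)) true) (replicate (length (at t ns ss)) true) c≡
      (cong (λ a → length (replicate (length a) true)) a≡) .proj₂)
    u t< (subst (u <_) (+-suc t (length r)) u<)

  -- Within a suffix, the letters moved in need not balance those moved out, so the length of the
  -- respelling has to stay in the equation. For the whole word it cancels against `length r`.
  length-encode : ∀ ts t r → length (encode ts t r) + length r ≡
                  length (respell ts t r) + (length (filter (_∈? ns) r) + length (filter (_∈? ns) r))
  length-encode ts t [] = refl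
  length-encode ts t (x ∷ r) with x ∈? ns
  ... | yes _ = trans
    (cong (_+ suc (length r)) (trans (length-++ (replicate (length (at t ns ts)) true))
      (cong (_+ suc (length (encode ts (suc t) r))) (length-replicate (length (at t ns ts))))))
    (trans (step′ (length (at t ns ts)) _ _ _ (length (filter (_∈? ns) r)) (length-encode ts (suc t) r))
      (cong (_+ _) (sym (length-++ (at t ns ts)))))
    where
    identity₁ : ∀ a e r → a + suc e + suc r ≡ a + 2 + (e + r)
    identity₁ = solve-∀
    identity₂ : ∀ a w k → a + 2 + (w + (k + k)) ≡ a + w + (suc k + suc k)
    identity₂ = solve-∀
    step′ : ∀ a e r w k → e + r ≡ w + (k + k) → a + suc e + suc r ≡ a + w + (suc k + suc k)
    step′ a e r w k p = trans (identity₁ a e r) (trans (cong (a + 2 +_) p) (identity₂ a w k))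
  ... | no _ = trans
    (cong (_+ suc (length r)) (trans (length-++ (replicate (length (at t ns ts)) true))
      (cong (_+ length (encode ts (suc t) r)) (length-replicate (length (at t ns ts))))))
    (trans (step′ (length (at t ns ts)) _ _ _ (length (filter (_∈? ns) r)) (length-encode ts (suc t) r))
      (cong (_+ _) (sym (length-++ (at t ns ts)))))
    where
    identity₁ : ∀ a e r → a + e + suc r ≡ a + 1 + (e + r)
    identity₁ = solve-∀
    identity₂ : ∀ a w k → a + 1 + (w + (k + k)) ≡ a + suc w + (k + k)
    identity₂ = solve-∀
    step′ : ∀ a e r w k → e + r ≡ w + (k + k) → a + e + suc r ≡ a + suc w + (k + k)
    step′ a e r w k p = trans (identity₁ a e r) (trans (cong (a + 1 +_) p) (identity₂ a w k))

  -- The default is the position in `π`, because a letter outside `ns` ends the slot of that number.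
  -- Hence `slot` is the key by which the respelled word is sorted.
  slot : Word n → List ℕ → Fin n → ℕ
  slot (y ∷ ys) (t ∷ ts) x with x Fin.≟ y
  ... | yes _ = t
  ... | no _ = slot ys ts x
  slot _ _ x = ord π x

  slot-at : ∀ t {ys} ts {x} → Unique ys → x ∈ at t ys ts → slot ys ts x ≡ t
  slot-at t {y ∷ ys} (s ∷ ts) {x} (py ∷ uq) p with x Fin.≟ y | s ≟ t
  ... | yes _ | yes s≡t = s≡t
  slot-at t {y ∷ ys} (s ∷ ts) (py ∷ uq) p | yes refl | no _ =
    ⊥-elim (All.lookup py (at-⊆ t ys ts p) refl)
  slot-at t {y ∷ ys} (s ∷ ts) (py ∷ uq) (here e≡) | no x≢y | yes _ = ⊥-elim (x≢y e≡)
  slot-at t {y ∷ ys} (s ∷ ts) (py ∷ uq) (there p) | no _ | yes _ = slot-at t ts uq p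
  slot-at t {y ∷ ys} (s ∷ ts) (py ∷ uq) p | no _ | no _ = slot-at t ts uq p

  at-slot : ∀ {Q : Fin n → ℕ → Set} {ys ts x} → Pointwise Q ys ts → x ∈ ys → x ∈ at (slot ys ts x) ys ts
  at-slot {ys = y ∷ ys} {t ∷ ts} {x} (q ∷ pt) p with x Fin.≟ y
  at-slot {ys = y ∷ ys} {t ∷ ts} (q ∷ pt) p | yes refl with t ≟ t
  ... | yes _ = here refl
  ... | no c = ⊥-elim (c refl)
  at-slot (q ∷ pt) (here e≡) | no x≢y = ⊥-elim (x≢y e≡)
  at-slot {ys = y ∷ ys} {t ∷ ts} {x} (q ∷ pt) (there p) | no _ with t ≟ slot ys ts x
  ... | yes _ = there (at-slot pt p)
  ... | no _ = at-slot pt p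

  slot-∉ : ∀ ys ts {x} → x ∉ ys → slot ys ts x ≡ ord π x
  slot-∉ [] _ _ = refl
  slot-∉ (_ ∷ _) [] _ = refl
  slot-∉ (y ∷ ys) (t ∷ ts) {x} x∉ with x Fin.≟ y
  ... | yes e≡ = ⊥-elim (x∉ (here e≡))
  ... | no _ = slot-∉ ys ts (x∉ ∘ there)

  slot-range : ∀ {Q : Fin n → ℕ → Set} {ys ts} → Pointwise Q ys ts → ∀ {x} → x ∈ ys → Q x (slot ys ts x)
  slot-range {ys = y ∷ ys} (q ∷ pt) {x} p with x Fin.≟ y
  ... | yes refl = q
  slot-range (q ∷ pt) (here e≡) | no x≢y = ⊥-elim (x≢y e≡)
  slot-range (q ∷ pt) (there p) | no _ = slot-range pt p

  module Respelled (ns-unique : Unique ns) (π-unique : Unique π) (π-complete : ∀ x → x ∈ π)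
                   (ts : List ℕ) where

    F : Fin n → ℕ
    F = slot ns ts

    Ordered : Fin n → Fin n → Set
    Ordered x y = F x ≤ F y × x ≢ y

    chunk : ℕ → Fin n → Word n
    chunk t x with x ∈? ns
    ... | yes _ = at t ns ts
    ... | no _ = at t ns ts ∷ʳ x

    respell-chunk : ∀ t x r → respell ts t (x ∷ r) ≡ chunk t x ++ respell ts (suc t) r
    respell-chunk t x r with x ∈? ns
    ... | yes _ = refl
    ... | no _ = sym (++-assoc (at t ns ts) (x ∷ []) (respell ts (suc t) r))

    chunk-unique : ∀ t x → Unique (chunk t x)
    chunk-unique t x with x ∈? ns
    ... | yes _ = at-unique t ts ns-unique
    ... | no x∉ = unique-∷ʳ (at-unique t ts ns-unique) (x∉ ∘ at-⊆ t ns ts)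

    chunk-slot : ∀ P x r → π ≡ P ++ x ∷ r → All (λ y → F y ≡ length P) (chunk (length P) x)
    chunk-slot P x r refl with x ∈? ns
    ... | yes _ = All.tabulate (slot-at (length P) ts ns-unique)
    ... | no x∉ = All.++⁺ (All.tabulate (slot-at (length P) ts ns-unique))
      (trans (slot-∉ ns ts x∉) (ord-split P (unique-middle P π-unique .proj₁)) ∷ [])

    unique-ordered : ∀ {t xs} → Unique xs → All (λ x → F x ≡ t) xs → AllPairs Ordered xs
    unique-ordered [] [] = []
    unique-ordered (px ∷ uq) (refl ∷ ps) =
      All.zipWith (λ (x≢y , e≡) → ≤-reflexive (sym e≡) , x≢y) (px , ps) ∷ unique-ordered uq ps

    -- All letters of a chunk have the number of its slot as their value of `F`, and later chunks
    -- have larger values. This order yields both that the respelled word is simple and that it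
    -- belongs to the language.
    respell-ordered : ∀ P r → π ≡ P ++ r →
      All (λ x → length P ≤ F x) (respell ts (length P) r) ×
      AllPairs Ordered (respell ts (length P) r)
    respell-ordered P [] e≡ = [] , []
    respell-ordered P (x ∷ r) e≡
      with respell-ordered (P ∷ʳ x) r (trans e≡ (sym (++-assoc P (x ∷ []) r)))
    ... | ih rewrite respell-chunk (length P) x r | length-++ P {x ∷ []} | +-comm (length P) 1 =
      All.++⁺ (All.map (≤-reflexive ∘ sym) here′) (All.map (≤-trans (n≤1+n _)) (proj₁ ih)) ,
      AllPairsₚ.++⁺ (unique-ordered (chunk-unique (length P) x) here′) (proj₂ ih)
        (All.map (λ e≡ → All.map (λ P< → <⇒≤ (earlier e≡ P<) ,
          λ { refl → <-irrefl refl (earlier e≡ P<) }) (proj₁ ih)) here′)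
      where
      here′ : All (λ y → F y ≡ length P) (chunk (length P) x)
      here′ = chunk-slot P x r e≡
      earlier : ∀ {a b} → F a ≡ length P → length P < F b → F a < F b
      earlier e≡ P< = subst (_< _) (sym e≡) P<

    respell-∈ : ∀ {Q : Fin n → ℕ → Set} → Pointwise Q ns ts → ∀ P r → π ≡ P ++ r → ∀ z →
      length P ≤ F z → F z < length P + length r → z ∈ respell ts (length P) r
    respell-∈ pt P [] e≡ z P≤ F< = ⊥-elim (<⇒≱ F< (≤-trans (≤-reflexive (+-identityʳ _)) P≤))
    respell-∈ pt P (x ∷ r) e≡ z P≤ F< with m≤n⇒m<n∨m≡n P≤
    ... | inj₂ P≡ rewrite respell-chunk (length P) x r = ∈-++⁺ˡ (∈-chunk (z ∈? ns))
      where
      ∈-chunk : Dec (z ∈ ns) → z ∈ chunk (length P) x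
      ∈-chunk (yes z∈) with x ∈? ns
      ... | yes _ = subst (λ t → z ∈ at t ns ts) (sym P≡) (at-slot pt z∈)
      ... | no _ = ∈-++⁺ˡ (subst (λ t → z ∈ at t ns ts) (sym P≡) (at-slot pt z∈))
      ∈-chunk (no z∉) with ord-injective (π-complete z)
        (trans (sym (slot-∉ ns ts z∉)) (trans (sym P≡)
          (sym (trans (cong (λ w → ord w x) e≡)
            (ord-split P (unique-middle P (subst Unique e≡ π-unique) .proj₁))))))
      ... | refl with x ∈? ns
      ... | yes x∈ = ⊥-elim (z∉ x∈)
      ... | no _ = ∈-++⁺ʳ (at (length P) ns ts) (here refl)
    ... | inj₁ P< with respell-∈ pt (P ∷ʳ x) r (trans e≡ (sym (++-assoc P (x ∷ []) r))) z
    ... | ih rewrite respell-chunk (length P) x r | length-++ P {x ∷ []} | +-comm (length P) 1 =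
      ∈-++⁺ʳ (chunk (length P) x) (ih P< (subst (F z <_) (+-suc (length P) (length r)) F<))

module _ {n : ℕ} (A : Antimatroid n) (S : MPS n) (A≐S : Lang A ≐ 𝓛 S)
         (π : Word n) (π-complete : ∀ x → x ∈ π) (π-unique : Unique π)
         (a : Fin n → ℕ) (a≤ : ∀ y → a y ≤ ord π y)
         (available : ∀ y → Avail S (take (a y) π) y)
         (ns : Word n) (ns-unique : Unique ns) where

  open Counting A S A≐S
  open Slots

  width : Fin n → ℕ
  width y = suc (ord π y ∸ a y)

  |π| : length π ≡ n
  |π| = ≤-antisym (unique-length π-unique) (subst (_≤ length π) (length-tabulate {n = n} id)
    (unique-⊆-length (Unique.allFin⁺ n) λ _ → π-complete _))

  ord<n : ∀ y → ord π y < n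
  ord<n y = subst₂ _<_ (cong (λ w → ord w y) (++-identityʳ π)) |π| (ord-∈ π {[]} (π-complete y))

  module _ {ts : List ℕ} (pt : Pointwise (InRange a width) ns ts) where

    open Respelled π ns ns-unique π-unique π-complete ts

    slot≤ : ∀ y → F y ≤ ord π y
    slot≤ y with y ∈? ns
    ... | yes y∈ = s≤s⁻¹ (≤-trans (slot-range π ns pt y∈ .proj₂)
                     (≤-reflexive (trans (+-suc (a y) _) (cong suc (m+[n∸m]≡n (a≤ y))))))
    ... | no y∉ = ≤-reflexive (slot-∉ π ns ns ts y∉)

    ≤slot : ∀ y → a y ≤ F y
    ≤slot y with y ∈? ns
    ... | yes y∈ = slot-range π ns pt y∈ .proj₁
    ... | no y∉ = ≤-trans (a≤ y) (≤-reflexive (sym (slot-∉ π ns ns ts y∉)))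

    respelled : Word n
    respelled = respell π ns ts 0 π

    respelled-complete : ∀ x → x ∈ respelled
    respelled-complete x = respell-∈ pt [] π refl x z≤n
      (≤-<-trans (slot≤ x) (<-≤-trans (ord<n x) (≤-reflexive (sym |π|))))

    respelled-ordered : AllPairs Ordered respelled
    respelled-ordered = respell-ordered [] π refl .proj₂

    respelled-unique : Unique respelled
    respelled-unique = AllPairs.map proj₂ respelled-ordered

    -- A letter z before y in the first a y letters of π has slot z ≤ ord z < a y ≤ slot y.
    respelled-𝓛 : 𝓛 S respelled
    respelled-𝓛 = 𝓛-intro S respelled-unique λ u y v e≡ →
      avail-mono S {take (a y) π}
        (λ z∈ → before u y v e≡ _ (subst (λ w → ord w _ < a y) (take++drop≡id (a y) π)
          (<-≤-trans (ord-∈ (take (a y) π) z∈) (≤-trans (≤-reflexive (length-take (a y) π)) (m⊓n≤m (a y) _)))))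
        (unique-middle u (subst Unique e≡ respelled-unique) .proj₁) (available y)
      where
      after : ∀ u {y v z} → AllPairs Ordered (u ++ y ∷ v) → z ∈ v → F y ≤ F z
      after [] (py ∷ _) z∈ = All.lookup py z∈ .proj₁
      after (_ ∷ u) (_ ∷ o) z∈ = after u o z∈
      before : ∀ u y v → respelled ≡ u ++ y ∷ v → ∀ z → ord π z < a y → z ∈ u
      before u y v e≡ z z< with ∈-++⁻ u (subst (z ∈_) e≡ (respelled-complete z))
      ... | inj₁ z∈ = z∈
      ... | inj₂ (here refl) = ⊥-elim (<⇒≱ z< (a≤ y))
      ... | inj₂ (there z∈) = ⊥-elim (<⇒≱ z< (≤-trans (≤slot y) (≤-trans
              (after u (subst (AllPairs Ordered) e≡ respelled-ordered) z∈) (slot≤ z))))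

    length-code : length (encode π ns ts 0 π) ≡ length ns + length ns
    length-code = trans (+-cancelʳ-≡ (length π) _ _ (trans (length-encode π ns ts 0 π)
        (trans (+-comm (length respelled) _) (cong (_ +_) |respelled|)))) (cong₂ _+_ |ns| |ns|)
      where
      |respelled| : length respelled ≡ length π
      |respelled| = ≤-antisym (unique-⊆-length respelled-unique λ _ → π-complete _)
                              (unique-⊆-length π-unique λ _ → respelled-complete _)
      |ns| : length (filter (_∈? ns) π) ≡ length ns
      |ns| = ≤-antisym
        (unique-⊆-length (Unique.filter⁺ (_∈? ns) π-unique) (λ z∈ → ∈-filter⁻ (_∈? ns) {xs = π} z∈ .proj₂))
        (unique-⊆-length ns-unique λ z∈ → ∈-filter⁺ (_∈? ns) (π-complete _) z∈)

  -- The respelled word is one of at most `∣𝓟 A ∣` permutations, and together with its code of two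
  -- bits per letter it determines the choice of slots.
  width-product : productBy width ns ≤ ∣𝓟 A ∣ * 2 ^ (length ns + length ns)
  width-product = begin
    productBy width ns ≡⟨ length-choices a width ns ⟨
    length (choices a width ns) ≤⟨ injective-length g (choices-unique a width ns) into inj ⟩
    length targets ≡⟨ length-cartesianProductWith _,_ words (bools (length ns + length ns)) ⟩
    ∣𝓟 A ∣ * length (bools (length ns + length ns)) ≡⟨ cong (∣𝓟 A ∣ *_) (length-bools (length ns + length ns)) ⟩
    ∣𝓟 A ∣ * 2 ^ (length ns + length ns) ∎
    where
    open ≤-Reasoning
    targets : List (Word n × List Bool)
    targets = cartesianProductWith _,_ words (bools (length ns + length ns))
    g : List ℕ → Word n × List Bool
    g ts = respell π ns ts 0 π , encode π ns ts 0 π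
    into : ∀ {ts} → ts ∈ choices a width ns → g ts ∈ targets
    into {ts} ts∈ = ∈-cartesianProductWith⁺ _,_
      (∈-words (respelled-𝓛 pt) (respelled-complete pt))
      (subst (λ k → encode π ns ts 0 π ∈ bools k) (length-code pt) (∈-bools _))
      where
      pt : Pointwise (InRange a width) ns ts
      pt = choices-range a width ns ts∈
    inj : ∀ {ts ss} → ts ∈ choices a width ns → ss ∈ choices a width ns → g ts ≡ g ss → ts ≡ ss
    inj {ts} {ss} ts∈ ss∈ e≡ = at-injective π ns ns ts ss ns-unique
      (λ {y} r → <-≤-trans (r .proj₂) (≤-trans
        (≤-reflexive (trans (+-suc (a y) _) (cong suc (m+[n∸m]≡n (a≤ y))))) (ord<n y)))
      (choices-range a width ns ts∈) (choices-range a width ns ss∈)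
      (λ t t< → decode π ns ts ss 0 π (cong proj₁ e≡) (cong proj₂ e≡) t z≤n
        (subst (t <_) (sym |π|) t<))

-- Waiting times

lg-spec : ∀ m → ∃[ l ] 2 ^ l ≤ suc m × suc m < 2 ^ suc l
lg-spec zero = 0 , s≤s z≤n , s≤s (s≤s z≤n)
lg-spec (suc m) with lg-spec m
... | l , lo , hi with suc (suc m) <? 2 ^ suc l
... | yes hi′ = l , ≤-trans lo (n≤1+n _) , hi′
... | no ¬hi′ = suc l , ≮⇒≥ ¬hi′ , ≤-<-trans hi (2^l<2^1+l (suc l))
  where
  2^l<2^1+l : ∀ l → 2 ^ l < 2 ^ suc l
  2^l<2^1+l l = ^-monoʳ-< 2 (s≤s (s≤s z≤n)) (n<1+n l)

lg : ℕ → ℕ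
lg m = lg-spec m .proj₁

-- The letter y is available from the time a y on, where the prefix of π of length τ is output at time τ.
module Capacity {n : ℕ} (π : Word n) (π-complete : ∀ x → x ∈ π)
                (a : Fin n → ℕ) (a≤ : ∀ y → a y ≤ ord π y) where

  -- The summand 2 is what makes `lows-count` gain the factor 2, so that at most half of an overfull
  -- batch is capped; it also supplies a constant budget for every free letter.
  cap : Fin n → ℕ
  cap y = 2 + lg (ord π y ∸ a y)

  Alive : ℕ → Fin n → Set
  Alive τ y = a y ≤ τ × τ ≤ ord π y

  Good : ℕ → Word n → Set
  Good τ xs = Unique xs × All (Alive τ) xs

  good-resp-↭ : ∀ {τ xs ys} → xs ↭ ys → Good τ xs → Good τ ys
  good-resp-↭ p (uq , al) = unique-resp-↭ p uq , All-resp-↭ p al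

  lows : ℕ → Word n → Word n
  lows i = filter (λ y → cap y ≤? i)

  -- A letter with `cap y ≤ i` that is alive at `τ` has been available since `a y ≤ τ`, so its
  -- position is less than `2 ^ (i - 1)` beyond `τ`. Distinct letters have distinct positions.
  lows-count : ∀ {τ xs} i → Good τ xs → 2 * length (lows i xs) ≤ 2 ^ i
  lows-count {τ} {xs} i (uq , al) = count i
    where
    empty : ∀ {i} → i < 2 → length (lows i xs) ≡ 0
    empty {i} i<2 = cong length (filter-none (λ y → cap y ≤? i) {xs} (All.tabulate λ _ c≤ →
      <⇒≱ (<-≤-trans i<2 (s≤s (s≤s z≤n))) c≤))
    offset< : ∀ {i y} → y ∈ lows (2 + i) xs → ord π y ∸ τ < 2 ^ suc i
    offset< {i} {y} y∈ with ∈-filter⁻ (λ y → cap y ≤? 2 + i) {xs = xs} y∈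
    ... | y∈xs , s≤s (s≤s l≤i) = ≤-<-trans (∸-monoʳ-≤ (ord π y) (All.lookup al y∈xs .proj₁))
      (<-≤-trans (m<n⇒m<1+n (n<1+n _))
        (≤-trans (lg-spec (ord π y ∸ a y) .proj₂ .proj₂) (^-monoʳ-≤ 2 (s≤s l≤i))))
    count : ∀ i → 2 * length (lows i xs) ≤ 2 ^ i
    count zero = ≤-trans (≤-reflexive (cong (2 *_) (empty {0} z<s))) z≤n
    count (suc zero) = ≤-trans (≤-reflexive (cong (2 *_) (empty {1} (s≤s z<s)))) z≤n
    count (suc (suc i)) = *-monoʳ-≤ 2 (≤-trans
      (injective-length (λ y → ord π y ∸ τ) {ys = upTo (2 ^ suc i)}
        (Unique.filter⁺ (λ y → cap y ≤? 2 + i) uq) (∈-upTo⁺ ∘ offset< {i})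
        λ {x} {y} x∈ y∈ e≡ → ord-injective (π-complete x)
          (∸-cancelʳ-≡ (alive x∈ .proj₂) (alive y∈ .proj₂) e≡))
      (≤-reflexive (length-upTo (2 ^ suc i))))
      where
      alive : ∀ {x} → x ∈ lows (2 + i) xs → Alive τ x
      alive x∈ = All.lookup al (∈-filter⁻ (λ y → cap y ≤? 2 + i) {xs = xs} x∈ .proj₁)

  open Heaps (ord π)

  rise-count : ∀ i xs → sumBy (λ x → i ⊓ cap x) xs + length xs ≡
               sumBy (λ x → suc i ⊓ cap x) xs + length (lows i xs)
  rise-count i [] = refl
  rise-count i (x ∷ xs) with cap x ≤? i
  ... | yes c≤i = trans (step′ (trans (m≥n⇒m⊓n≡n c≤i) (sym (m≥n⇒m⊓n≡n (m≤n⇒m≤1+n c≤i))))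
                    (sumBy (λ x → i ⊓ cap x) xs) _ _ _ (rise-count i xs))
    (cong (λ ys → suc i ⊓ cap x + sumBy (λ x → suc i ⊓ cap x) xs + length ys)
      (sym (filter-accept (λ y → cap y ≤? i) {x} {xs} c≤i)))
    where
    step′ : ∀ {u u′} → u ≡ u′ → ∀ s l t m → s + l ≡ t + m → u + s + suc l ≡ u′ + t + suc m
    step′ {u} refl s l t m p = trans (identity u s l) (trans (cong (suc u +_) p) (sym (identity u t m)))
      where
      identity : ∀ u s l → u + s + suc l ≡ suc u + (s + l)
      identity = solve-∀
  ... | no c≰i = trans (step′ (trans (m≤n⇒m⊓n≡m (≰⇒> c≰i)) (cong suc (sym (m≤n⇒m⊓n≡m (<⇒≤ (≰⇒> c≰i))))))
                   (sumBy (λ x → i ⊓ cap x) xs) _ _ _ (rise-count i xs))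
    (cong (λ ys → suc i ⊓ cap x + sumBy (λ x → suc i ⊓ cap x) xs + length ys)
      (sym (filter-reject (λ y → cap y ≤? i) {x} {xs} c≰i)))
    where
    step′ : ∀ {u u′} → u′ ≡ suc u → ∀ s l t m → s + l ≡ t + m → u + s + suc l ≡ u′ + t + m
    step′ {u} refl s l t m p = trans (identity u s l) (trans (cong (suc u +_) p) (sym (+-assoc (suc u) t m)))
      where
      identity : ∀ u s l → u + s + suc l ≡ suc u + (s + l)
      identity = solve-∀

  rises : ∀ {τ xs} ys → Good τ (xs ++ ys) → Rises cap xs
  rises {τ} {xs} ys (uq , al) i 2^i< = linear 0
    (+-mono-≤ (≤-trans (lows-count i (unique-++ˡ xs uq , All.++⁻ˡ xs al)) (<⇒≤ 2^i<))
      (≤-reflexive (cong (2 *_) (rise-count i xs))))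
    (identity (length xs) (sumBy (λ x → i ⊓ cap x) xs)
      (sumBy (λ x → suc i ⊓ cap x) xs) (length (lows i xs)))
    where
    identity : ∀ l s t m → l + 2 * s + (l + 2 * (t + m)) + 0 ≡ 2 * t + (2 * m + 2 * (s + l))
    identity = solve-∀

  -- The 2 in `cap` contributes `4 ^ k`, and the count of slots contributes `N * 4 ^ k`. Since
  -- `2 ^ k ≤ N * N`, each `4 ^ k` is at most `N ^ 4`, which explains the exponent 9.
  width≤cap : ∀ {N k} xs → productBy (λ y → suc (ord π y ∸ a y)) xs ≤ N * 2 ^ (k + k) →
              2 ^ k ≤ N * N → length xs ≤ k → 2 ^ sumBy cap xs ≤ N ^ 9
  width≤cap {N} {k} xs prod≤ k≤ l≤ = begin
    2 ^ sumBy cap xs                              ≤⟨ caps xs ⟩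
    2 ^ (length xs + length xs) * productBy width′ xs ≤⟨ *-mono-≤ (^-monoʳ-≤ 2 (+-mono-≤ l≤ l≤)) prod≤ ⟩
    2 ^ (k + k) * (N * 2 ^ (k + k))               ≡⟨ cong (λ p → p * (N * p)) (^-distribˡ-+-* 2 k k) ⟩
    2 ^ k * 2 ^ k * (N * (2 ^ k * 2 ^ k))         ≤⟨ *-mono-≤ (*-mono-≤ k≤ k≤) (*-monoʳ-≤ N (*-mono-≤ k≤ k≤)) ⟩
    N * N * (N * N) * (N * (N * N * (N * N)))     ≡⟨ identity N ⟩
    N ^ 9                                         ∎
    where
    open ≤-Reasoning
    width′ : Fin n → ℕ
    width′ y = suc (ord π y ∸ a y)
    identity : ∀ N → N * N * (N * N) * (N * (N * N * (N * N))) ≡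
                     N * (N * (N * (N * (N * (N * (N * (N * (N * 1))))))))
    identity = solve-∀
    swap′ : ∀ p q r → 4 * p * (q * r) ≡ 4 * q * (p * r)
    swap′ = solve-∀
    caps : ∀ xs → 2 ^ sumBy cap xs ≤ 2 ^ (length xs + length xs) * productBy width′ xs
    caps [] = s≤s z≤n
    caps (x ∷ xs) = begin
      2 ^ (cap x + sumBy cap xs) ≡⟨ ^-distribˡ-+-* 2 (cap x) _ ⟩
      2 ^ cap x * 2 ^ sumBy cap xs
        ≤⟨ *-mono-≤ {2 ^ cap x} {4 * width′ x}
             (≤-trans (≤-reflexive (sym (*-assoc 2 2 (2 ^ lg (ord π x ∸ a x)))))
                (*-monoʳ-≤ 4 (lg-spec (ord π x ∸ a x) .proj₂ .proj₁)))
             (caps xs) ⟩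
      4 * width′ x * (2 ^ (length xs + length xs) * productBy width′ xs)
        ≡⟨ swap′ (width′ x) (2 ^ (length xs + length xs)) (productBy width′ xs) ⟩
      4 * 2 ^ (length xs + length xs) * (width′ x * productBy width′ xs)
        ≡⟨ cong (_* (width′ x * productBy width′ xs)) (trans (*-assoc 2 2 (2 ^ (length xs + length xs)))
             (cong (λ e → 2 ^ suc e) (sym (+-suc (length xs) (length xs))))) ⟩
      2 ^ (length (x ∷ xs) + length (x ∷ xs)) * productBy width′ (x ∷ xs) ∎

-- Exponential search among the forced letters

Holds : ∀ {n} → (ℕ → ℕ) → ℕ → Word n → Set
Holds f i [] = ⊤
Holds f i (x ∷ xs) = f i ≡ toℕ x × Holds f (suc i) xs

holds-cong : ∀ {n} {f g : ℕ → ℕ} i (xs : Word n) → (∀ j → i ≤ j → j < i + length xs → g j ≡ f j) →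
             Holds f i xs → Holds g i xs
holds-cong i [] p h = tt
holds-cong i (x ∷ xs) p (e≡ , h) = trans (p i ≤-refl (m<m+n i z<s)) e≡ ,
  holds-cong (suc i) xs (λ j i< j< → p j (<⇒≤ i<) (subst (j <_) (sym (+-suc i (length xs))) j<)) h

holds-∷ʳ : ∀ {n} {f : ℕ → ℕ} i (xs : Word n) {x} → Holds f i xs → f (i + length xs) ≡ toℕ x →
           Holds f i (xs ∷ʳ x)
holds-∷ʳ {f = f} i [] h e≡ = trans (cong f (sym (+-identityʳ i))) e≡ , tt
holds-∷ʳ {f = f} i (y ∷ xs) (e≡′ , h) e≡ =
  e≡′ , holds-∷ʳ (suc i) xs h (trans (cong f (sym (+-suc i (length xs)))) e≡)

module Ranks {n : ℕ} (π : Word n) (π-unique : Unique π) (π-complete : ∀ x → x ∈ π) where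

  open Heaps (ord π) using (pick; pick-yes; pick-no)

  Increasing : Word n → Set
  Increasing = AllPairs (λ x y → ord π x < ord π y)

  -- The argument is a position instead of a letter, so that the rank stored for a letter and the
  -- number of forced letters among the first `u` outputs are values of the same function.
  rank : ℕ → Word n → ℕ
  rank u [] = 0
  rank u (b ∷ bs) = pick (ord π b <? u) (suc (rank u bs)) (rank u bs)

  rank-none : ∀ {u bs} → All (λ b → u ≤ ord π b) bs → rank u bs ≡ 0
  rank-none [] = refl
  rank-none {u} {b ∷ bs} (u≤ ∷ us) = trans (pick-no (ord π b <? u) (≤⇒≯ u≤)) (rank-none us)

  rank-zero : ∀ bs → rank 0 bs ≡ 0
  rank-zero bs = rank-none {0} {bs} (All.tabulate λ _ → z≤n)

  rank-≤ : ∀ u bs → rank u bs ≤ length bs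
  rank-≤ u [] = z≤n
  rank-≤ u (b ∷ bs) with ord π b <? u
  ... | yes _ = s≤s (rank-≤ u bs)
  ... | no _ = m≤n⇒m≤1+n (rank-≤ u bs)

  rank-mono : ∀ {u v} bs → u ≤ v → rank u bs ≤ rank v bs
  rank-mono [] u≤v = z≤n
  rank-mono {u} {v} (b ∷ bs) u≤v with ord π b <? u | ord π b <? v
  ... | yes _ | yes _ = s≤s (rank-mono bs u≤v)
  ... | yes b<u | no b≮v = ⊥-elim (b≮v (<-≤-trans b<u u≤v))
  ... | no _ | yes _ = m≤n⇒m≤1+n (rank-mono bs u≤v)
  ... | no _ | no _ = rank-mono bs u≤v

  rank-suc-∉ : ∀ {x bs} → x ∉ bs → rank (suc (ord π x)) bs ≡ rank (ord π x) bs
  rank-suc-∉ {x} {[]} x∉ = refl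
  rank-suc-∉ {x} {b ∷ bs} x∉ with ord π b <? suc (ord π x) | ord π b <? ord π x
  ... | yes _ | yes _ = cong suc (rank-suc-∉ (x∉ ∘ there))
  ... | no b≮ | yes b< = ⊥-elim (b≮ (m<n⇒m<1+n b<))
  ... | no _ | no _ = rank-suc-∉ (x∉ ∘ there)
  ... | yes b≤ | no b≮ = ⊥-elim (x∉ (here (ord-injective (π-complete x)
                           (≤-antisym (≮⇒≥ b≮) (s≤s⁻¹ b≤)))))

  rank-suc-∈ : ∀ {x bs} → Increasing bs → x ∈ bs → rank (suc (ord π x)) bs ≡ suc (rank (ord π x) bs)
  rank-suc-∈ {x} {b ∷ bs} (pb ∷ inc) (here refl) = trans
    (pick-yes (ord π b <? suc (ord π b)) (n<1+n _))
    (cong suc (trans (rank-none pb) (sym (trans (pick-no (ord π b <? ord π b) (<-irrefl refl))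
      (rank-none (All.map <⇒≤ pb))))))
  rank-suc-∈ {x} {b ∷ bs} (pb ∷ inc) (there x∈) = trans
    (pick-yes (ord π b <? suc (ord π x)) (m<n⇒m<1+n b<x))
    (cong suc (trans (rank-suc-∈ inc x∈) (sym (pick-yes (ord π b <? ord π x) b<x))))
    where
    b<x : ord π b < ord π x
    b<x = All.lookup pb x∈

  rank-suc : ∀ u {bs} → Increasing bs → rank (suc u) bs ≤ suc (rank u bs)
  rank-suc u {[]} inc = z≤n
  rank-suc u {b ∷ bs} (pb ∷ inc) with ord π b <? suc u | ord π b <? u
  ... | yes _ | yes _ = s≤s (rank-suc u inc)
  ... | no _ | no _ = rank-suc u inc
  ... | no b≮ | yes b< = ⊥-elim (b≮ (m<n⇒m<1+n b<))
  ... | yes b≤ | no b≮ = s≤s (≤-trans (≤-reflexive (rank-none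
          (All.map (≤-trans (s≤s (≮⇒≥ b≮))) pb))) z≤n)

  -- At most one forced letter stands at each position. So the distance that the search has to cover
  -- is bounded by the waiting time.
  rank-+ : ∀ u d {bs} → Increasing bs → rank (d + u) bs ≤ rank u bs + d
  rank-+ u zero inc = ≤-reflexive (sym (+-identityʳ _))
  rank-+ u (suc d) {bs} inc = ≤-trans (rank-suc (d + u) inc)
    (≤-trans (s≤s (rank-+ u d inc)) (≤-reflexive (sym (+-suc (rank u bs) d))))

  -- As `bs` increases, its letters before position `u` form an initial segment of length
  -- `rank u bs`. A probe of the table thus amounts to a comparison of the index `j` with the rank.
  holds-rank : ∀ {arr} s bs → Increasing bs → Holds arr (suc s) bs → ∀ {j} → s < j → j ≤ s + length bs →
    ∃[ b ] arr j ≡ toℕ b × (∀ u → (ord π b < u → j ≤ s + rank u bs) × (j ≤ s + rank u bs → ord π b < u))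
  holds-rank s [] inc h {j} s<j j≤ = ⊥-elim (<⇒≱ s<j (≤-trans j≤ (≤-reflexive (+-identityʳ s))))
  holds-rank s (b ∷ bs) (pb ∷ inc) (e≡ , h) {j} s<j j≤ with m≤n⇒m<n∨m≡n s<j
  ... | inj₂ refl = b , e≡ , λ u → at u (ord π b <? u)
    where
    at : ∀ u → Dec (ord π b < u) → (ord π b < u → suc s ≤ s + rank u (b ∷ bs)) ×
                                   (suc s ≤ s + rank u (b ∷ bs) → ord π b < u)
    at u (yes b<u) = (λ _ → ≤-trans (≤-trans (s≤s (m≤m+n s (rank u bs))) (≤-reflexive (sym (+-suc s _))))
                       (≤-reflexive (cong (s +_) (sym (pick-yes (ord π b <? u) b<u))))) , λ _ → b<u
    at u (no b≮u) = ⊥-elim ∘ b≮u , λ s< → ⊥-elim (<⇒≱ s< (≤-reflexive (trans (cong (s +_)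
      (rank-none {u} {b ∷ bs} (≮⇒≥ b≮u ∷ All.map (λ b< → ≤-trans (≮⇒≥ b≮u) (<⇒≤ b<)) pb)))
      (+-identityʳ s))))
  ... | inj₁ s+1<j with holds-rank (suc s) bs inc h s+1<j (≤-trans j≤ (≤-reflexive (+-suc s (length bs))))
  ... | b′ , e≡′ , iff = b′ , e≡′ , λ u → at u (ord π b <? u)
    where
    at : ∀ u → Dec (ord π b < u) → (ord π b′ < u → j ≤ s + rank u (b ∷ bs)) ×
                                   (j ≤ s + rank u (b ∷ bs) → ord π b′ < u)
    at u (yes b<u) rewrite pick-yes (ord π b <? u) {suc (rank u bs)} {rank u bs} b<u
      | +-suc s (rank u bs) = iff u
    at u (no b≮u) = (λ b′< → ⊥-elim (<⇒≱ s+1<j (≤-trans (iff u .proj₁ b′<)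
        (≤-reflexive (trans (cong (suc s +_) (rank-none later)) (+-identityʳ _))))))
      , λ j≤′ → ⊥-elim (<⇒≱ s<j (≤-trans j≤′ (≤-reflexive
          (trans (cong (s +_) (rank-none {u} {b ∷ bs} (≮⇒≥ b≮u ∷ later))) (+-identityʳ s)))))
      where
      later : All (λ b → u ≤ ord π b) bs
      later = All.map (λ b< → ≤-trans (≮⇒≥ b≮u) (<⇒≤ b<)) pb

  holds-next : ∀ {arr bs x} → Increasing bs → Holds arr 1 bs → x ∈ bs →
               arr (suc (rank (ord π x) bs)) ≡ toℕ x
  holds-next {arr} {bs} {x} inc h x∈
    with holds-rank 0 bs inc h {suc (rank (ord π x) bs)} z<s
           (≤-trans (≤-reflexive (sym (rank-suc-∈ inc x∈))) (rank-≤ (suc (ord π x)) bs))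
  ... | b , e≡ , iff = trans e≡ (cong toℕ (sym (ord-injective (π-complete x) (≤-antisym
          (≮⇒≥ λ b<x → <-irrefl refl (iff (ord π x) .proj₁ b<x))
          (s≤s⁻¹ (iff (suc (ord π x)) .proj₂ (≤-reflexive (sym (rank-suc-∈ inc x∈)))))))))

-- Execution of the search

module Searching {n : ℕ} {S : MPS n} (C : Candidate S) (π : Word n)
                 (w : ℕ) (room : 16 * suc n ≤ 2 ^ w)
                 (π-unique : Unique π) (π-complete : ∀ x → x ∈ π) where

  open WordRAM w hiding (Run)
  open Machine C π w room π-unique π-complete
  open HeapCode C π w room π-unique π-complete using (Lim; ≤Lim; ≤Lim₂)
  open HeapOps C π w room π-unique π-complete using (2^-double; 2^suc/2)
  open Ranks π π-unique π-complete

  searchLoop : Cmd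
  searchLoop = while (reg rS) searchStep

  module _ (bs : Word n) (inc : Increasing bs) (|bs| : length bs ≤ n) (y : Fin n) where

    r : ℕ
    r = rank (ord π y) bs

    record Searchable (σ : State n) : Set where
      constructor searchable
      field
        many  : regs σ rM ≡ length bs
        table : Holds (arrays σ aForced) 1 bs
        what  : regs σ rY ≡ toℕ y
    open Searchable

    probe : Cmd
    probe = ifz (op lt (reg rM) (reg rPos ⊕ reg rS))
              (compare rG (aForced [ reg rPos ⊕ reg rS ]) (reg rY))
              (rG := lit 0)

    probe-yes : ∀ {σ p s P} → Searchable σ → regs σ rPos ≡ p → regs σ rS ≡ s → 0 < s → p + s ≤ Lim →
                p + s ≤ r → P (setReg rG 1 σ) → Exec probe σ 20 1 P
    probe-yes {p = p} {s} sr rp rs s>0 fit ≤r post with holds-rank 0 bs inc (table sr) {p + s}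
      (<-≤-trans s>0 (m≤n+m s p)) (≤-trans ≤r (rank-≤ (ord π y) bs))
    ... | b , e≡ , iff = e-weaken (toWitness {a? = _ ≤? _} tt) ≤-refl
      (e-if0 (ev-lt0 (ev-reg (many sr)) (ev-add (ev-reg rp) (ev-reg rs) (≤Lim fit))
                (≤⇒≯ (≤-trans ≤r (rank-≤ (ord π y) bs))))
        (e-yes (ev-arr (ev-add (ev-reg rp) (ev-reg rs) (≤Lim fit)) e≡) (ev-reg (what sr))
          (iff (ord π y) .proj₂ ≤r) post))

    probe-no : ∀ {σ p s P} → Searchable σ → regs σ rPos ≡ p → regs σ rS ≡ s → 0 < s → p + s ≤ Lim →
               r < p + s → P (setReg rG 0 σ) → Exec probe σ 20 1 P
    probe-no {σ} {p} {s} sr rp rs s>0 fit r< post with length bs <? p + s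
    ... | yes m< = e-weaken (toWitness {a? = _ ≤? _} tt) z≤n
      (e-if1 (ev-lt1 (ev-reg (many sr)) (ev-add (ev-reg rp) (ev-reg rs) (≤Lim fit)) m<)
        (e-assign ev-lit post))
    ... | no m≮ with holds-rank 0 bs inc (table sr) {p + s} (<-≤-trans s>0 (m≤n+m s p)) (≮⇒≥ m≮)
    ... | b , e≡ , iff = e-weaken (toWitness {a? = _ ≤? _} tt) ≤-refl
      (e-if0 (ev-lt0 (ev-reg (many sr)) (ev-add (ev-reg rp) (ev-reg rs) (≤Lim fit)) m≮)
        (e-no (ev-arr (ev-add (ev-reg rp) (ev-reg rs) (≤Lim fit)) e≡) (ev-reg (what sr))
          (λ b< → <⇒≱ r< (iff (ord π y) .proj₁ b<)) post))

    Found : State n → Set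
    Found σ = regs σ rPos ≡ r

    r≤n : r ≤ n
    r≤n = ≤-trans (rank-≤ (ord π y) bs) |bs|

    fit : ∀ {p s} → p ≤ r → s ≤ suc n → p + s ≤ Lim
    fit p≤ s≤ = ≤-trans (+-mono-≤ (≤-trans p≤ (≤-trans r≤n (n≤1+n n))) s≤)
      (≤-trans (≤-reflexive (cong (suc n +_) (sym (+-identityʳ (suc n))))) (*-monoˡ-≤ (suc n) {2} {4} (s≤s (s≤s z≤n))))

    s≤8n : ∀ {s} → s ≤ suc n → s + s ≤ 8 * suc n
    s≤8n s≤ = ≤Lim₂ (≤-trans s≤ (m≤n*m (suc n) 4))

    nonzero : ∀ {σ} i → regs σ rS ≡ 2 ^ i → σ ⊢ reg rS ⇓ suc (pred (2 ^ i))
    nonzero i rs = ev-reg (trans rs (sym (suc-pred (2 ^ i) {{m^n≢0 2 i}})))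

    descend : ∀ {σ} i p → Searchable σ → regs σ rPos ≡ p → regs σ rS ≡ 2 ^ i → regs σ rU ≡ 0 →
      2 ^ i ≤ suc n → p ≤ r → r < p + 2 ^ suc i → Work searchLoop σ 1 (suc i) Found
    halved : ∀ {σ} i p → Searchable σ → regs σ rPos ≡ p → regs σ rS ≡ 2 ^ i / 2 → regs σ rU ≡ 0 →
      2 ^ i ≤ suc n → p ≤ r → r < p + 2 ^ i → Work searchLoop σ 1 i Found
    halved zero p sr rp rs ru s≤ p≤ r< = e-block (e-while0 (ev-reg rs)
      (trans rp (≤-antisym p≤ (s≤s⁻¹ (≤-trans r< (≤-reflexive (+-comm p 1)))))))
    halved (suc i) p sr rp rs ru s≤ p≤ r< = descend i p sr rp (trans rs (2^suc/2 i)) ru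
      (≤-trans (m≤m+n _ _) s≤) p≤ r<
    descend i p sr@(searchable sz tb wh) rp rs ru s≤ p≤ r< with p + 2 ^ i ≤? r
    ... | yes ≤r = e-iter (nonzero i rs)
      (e-seq (probe-yes sr rp rs (m^n>0 2 i) (fit p≤ s≤) ≤r
        (e-seq (e-if1 (ev-reg refl) (e-assign (ev-add (ev-reg rp) (ev-reg rs) (≤Lim (fit p≤ s≤)))
          (e-if0 (ev-reg ru) (e-assign (ev-half (ev-reg rs))
            (halved i (p + 2 ^ i) (searchable sz tb wh) refl refl ru s≤ ≤r
              (≤-trans r< (≤-reflexive (trans (cong (p +_) (sym (2^-double i))) (sym (+-assoc p _ _)))))))))))))
    ... | no ≰r = e-iter (nonzero i rs)
      (e-seq (probe-no sr rp rs (m^n>0 2 i) (fit p≤ s≤) (≰⇒> ≰r)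
        (e-seq (e-if0 (ev-reg refl) (e-assign ev-lit
          (e-if0 (ev-reg refl) (e-assign (ev-half (ev-reg rs))
            (halved i p (searchable sz tb wh) rp refl refl s≤ p≤ (≰⇒> ≰r)))))))))

    -- The strides taken so far are 1, 2, 4, up to half of the current one, whence
    -- `suc p ≡ cur + 2 ^ j`. The bound on `r` excludes a success at `j = L`; so at most `e` more
    -- probes succeed, one fails, and at most `L` halvings follow.
    gallop : ∀ {σ cur L} e j p → Searchable σ → regs σ rPos ≡ p → regs σ rS ≡ 2 ^ j → regs σ rU ≡ 1 →
      p ≤ r → suc p ≡ cur + 2 ^ j → suc r < cur + 2 ^ suc L → j + e ≡ L →
      Work searchLoop σ 1 (e + suc L) Found
    gallop {cur = cur} {L} e j p sr@(searchable sz tb wh) rp rs ru p≤ p≡ r< refl with p + 2 ^ j ≤? r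
    ... | no ≰r = w-weaken ≤-refl (≤-trans (s≤s (m≤m+n j e)) (m≤n+m _ e)) (e-iter (nonzero j rs)
      (e-seq (probe-no sr rp rs (m^n>0 2 j) (fit p≤ s≤) (≰⇒> ≰r)
        (e-seq (e-if0 (ev-reg refl) (e-assign ev-lit
          (e-if0 (ev-reg refl) (e-assign (ev-half (ev-reg rs))
            (halved j p (searchable sz tb wh) rp refl refl s≤ p≤ (≰⇒> ≰r))))))))))
      where
      s≤ : 2 ^ j ≤ suc n
      s≤ = ≤-trans (m≤n+m (2 ^ j) cur) (≤-trans (≤-reflexive (sym p≡)) (s≤s (≤-trans p≤ r≤n)))
    gallop {cur = cur} zero j p sr rp rs ru p≤ p≡ r< refl | yes ≤r = ⊥-elim (<⇒≱ r< (≤-trans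
      (≤-reflexive (trans (cong (λ k → cur + 2 ^ suc k) (+-identityʳ j))
        (trans (cong (cur +_) (sym (2^-double j))) (trans (sym (+-assoc cur _ _))
          (cong (_+ 2 ^ j) (sym p≡)))))) (s≤s ≤r)))
    gallop {cur = cur} (suc e) j p sr@(searchable sz tb wh) rp rs ru p≤ p≡ r< refl | yes ≤r =
      e-iter (nonzero j rs)
      (e-seq (probe-yes sr rp rs (m^n>0 2 j) (fit p≤ s≤) ≤r
        (e-seq (e-if1 (ev-reg refl) (e-assign (ev-add (ev-reg rp) (ev-reg rs) (≤Lim (fit p≤ s≤)))
          (e-if1 (ev-reg ru) (e-assign (ev-add (ev-reg rs) (ev-reg rs) (s≤8n s≤))
            (gallop {cur = cur} e (suc j) (p + 2 ^ j) (searchable sz tb wh) refl (2^-double j) ru ≤r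
              (trans (cong (_+ 2 ^ j) p≡) (trans (+-assoc cur _ _) (cong (cur +_) (2^-double j))))
              r< (sym (+-suc j e))))))))))
      where
      s≤ : 2 ^ j ≤ suc n
      s≤ = ≤-trans (m≤n+m (2 ^ j) cur) (≤-trans (≤-reflexive (sym p≡)) (s≤s (≤-trans p≤ r≤n)))

    search-code : ∀ {σ cur L} → Searchable σ → regs σ rCur ≡ cur → cur ≤ r → suc r < cur + 2 ^ suc L →
      Work search σ 5 (L + suc L) (λ σ′ → arrays σ′ aPos ≡ update (arrays σ aPos) (toℕ y) r)
    search-code {cur = cur} (searchable sz tb wh) rc cur≤ r< = w-weaken ≤-refl
      (≤-reflexive (+-identityʳ _))
      (w-seq (e-block (e-assign (ev-reg rc)
      (w-seq (e-block (e-assign ev-lit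
      (w-seq (e-block (e-assign ev-lit
      (w-then (gallop {cur = cur} _ 0 cur (searchable sz tb wh) refl refl refl cur≤ (+-comm 1 cur) r< refl)
        λ F found → e-block (e-store (ev-reg (trans (F .reg≡ rY refl) wh)) (ev-reg found)
          (cong (λ f → update f (toℕ y) r) (F .arr≡ aPos refl)))))))))))))

-- The first session

writeFrom-below : ∀ {n} i (xs : Word n) f {j} → j < i → writeFrom i xs f j ≡ f j
writeFrom-below i [] f j<i = refl
writeFrom-below i (x ∷ xs) f j<i =
  trans (writeFrom-below (suc i) xs _ (m<n⇒m<1+n j<i)) (update-other f (toℕ x) (<⇒≢ j<i ∘ sym))

holds-writeFrom : ∀ {n} i (xs : Word n) f → Holds (writeFrom i xs f) i xs
holds-writeFrom i [] f = tt
holds-writeFrom i (x ∷ xs) f =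
  trans (writeFrom-below (suc i) xs _ (n<1+n i)) (update-same f i (toℕ x)) ,
  holds-writeFrom (suc i) xs _

holds-≡ : ∀ {n} {f g : ℕ → ℕ} {i} {xs : Word n} → f ≡ g → Holds f i xs → Holds g i xs
holds-≡ refl h = h

module Sessions {n : ℕ} (A : Antimatroid n) (S : MPS n) (A≐S : Lang A ≐ 𝓛 S) (C : Candidate S)
                (π : Word n) (π∈𝓛 : 𝓛 S π) (π-complete : ∀ x → x ∈ π)
                (w : ℕ) (room : 16 * suc n ≤ 2 ^ w) where

  π-unique : Unique π
  π-unique = proj₁ π∈𝓛

  open WordRAM w hiding (Run)
  open Machine C π w room π-unique π-complete
  open HeapCode C π w room π-unique π-complete using (Lim; ≤Lim)
  open Ranks π π-unique π-complete
  open Counting A S A≐S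

  ≤1+n⇒≤Lim : ∀ {k} → k ≤ suc n → k ≤ Lim
  ≤1+n⇒≤Lim k≤ = ≤-trans k≤ (m≤n*m (suc n) 4)

  ≤1+n⇒fits : ∀ {k} → k ≤ suc n → k ≤ 8 * suc n
  ≤1+n⇒fits k≤ = ≤Lim (≤1+n⇒≤Lim k≤)

  record Reported (σ : State n) (α xs : Word n) : Set where
    constructor reported
    field
      state   : history σ ≡ just α
      number  : regs σ rCount ≡ length xs
      reports : Holds (arrays σ aReport) 0 xs
  open Reported

  receive-reported : ∀ {σ} xs α → Unique xs → Reported (receive xs α rCount aReport σ) α xs
  receive-reported {σ} xs α uq = reported refl
    (trunc-< (fits (≤1+n⇒fits (≤-trans (unique-length uq) (n≤1+n n))))) (holds-writeFrom 0 xs _)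

  init-code : ∀ {σ P} → P (receive (initReports C) [] rCount aReport σ) →
              Work (init rCount aReport) σ (suc (initTime C)) 0 P
  init-code post = w-timed (initTime C) (n≤1+n _) (e-init post)

  step-code : ∀ {σ P α x} → history σ ≡ just α → regs σ rX ≡ toℕ x → 𝓛 S (α ∷ʳ x) →
              P (receive (stepReports C α x) (α ∷ʳ x) rCount aReport σ) →
              Work (step (reg rX) rCount aReport) σ (suc (stepTime C α x)) 0 P
  step-code his rx L post = w-timed _ ≤-refl (e-step his (ev-reg rx) L post)

  -- The witness is the first letter of `π` outside `d`: the letters before it lie in `d`, so it is
  -- available. Hence a letter alone in the queue must be this one, and the queue cannot run empty
  -- before all letters are processed.
  first-outside : ∀ d {z} → z ∉ d → ∃[ y ] y ∉ d × Avail S d y × ord π y ≤ ord π z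
  first-outside d {z} z∉ = go [] π refl (λ ())
    where
    go : ∀ u v → π ≡ u ++ v → (∀ {x} → x ∈ u → x ∈ d) → ∃[ y ] y ∉ d × Avail S d y × ord π y ≤ ord π z
    go u [] e≡ u⊆ = ⊥-elim (z∉ (u⊆ (subst (z ∈_) (trans e≡ (++-identityʳ u)) (π-complete z))))
    go u (y ∷ v) e≡ u⊆ with y ∈? d
    ... | yes y∈ = go (u ∷ʳ y) v (trans e≡ (sym (++-assoc u (y ∷ []) v))) λ x∈ →
      case ∈-∷ʳ⁻ u x∈ of λ { (inj₁ q) → u⊆ q ; (inj₂ refl) → y∈ }
    ... | no y∉ = y , y∉ , avail-mono S u⊆ y∉ (𝓛-avail S π∈𝓛 u e≡) ,
      subst (λ σ → ord σ y ≤ ord σ z) (sym e≡) (≤-trans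
        (≤-reflexive (ord-split u (y∉ ∘ u⊆))) (ord-∉ u (z∉ ∘ u⊆)))

  Pending : Word n → Word n → Set
  Pending d q = Unique (d ++ q) × (∀ {y} → y ∈ q → Avail S d y) ×
                (∀ {y} → y ∉ d → Avail S d y → y ∈ q)

  pending-init : Pending [] (initReports C)
  pending-init = Candidate.init-unique C
    , (λ {y} → Equivalence.to (Candidate.init-correct C y))
    , λ {y} _ → Equivalence.from (Candidate.init-correct C y)

  pending-step : ∀ {d x q} → Pending d (x ∷ q) → 𝓛 S (d ∷ʳ x) → Pending (d ∷ʳ x) (q ++ stepReports C d x)
  pending-step {d} {x} {q} (uq , av , full) L =
    subst Unique (++-assoc (d ∷ʳ x) q R) (Unique.++⁺ uq′ (Candidate.step-unique C d x L) disjoint)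
    , available , complete
    where
    R : Word n
    R = stepReports C d x
    correct : ∀ y → (y ∈ R → y ∉ d ∷ʳ x × p S y (letters d) ≡ false × Avail S (d ∷ʳ x) y) ×
                    (y ∉ d ∷ʳ x × p S y (letters d) ≡ false × Avail S (d ∷ʳ x) y → y ∈ R)
    correct y = Equivalence.to (Candidate.step-correct C d x L y) ,
                Equivalence.from (Candidate.step-correct C d x L y)
    uq′ : Unique ((d ∷ʳ x) ++ q)
    uq′ = subst Unique (sym (++-assoc d (x ∷ []) q)) uq
    disjoint : ∀ {y} → ¬ (y ∈ (d ∷ʳ x) ++ q × y ∈ R)
    disjoint {y} (y∈ , y∈R) with correct y .proj₁ y∈R | ∈-++⁻ (d ∷ʳ x) y∈
    ... | y∉ , _ , _ | inj₁ y∈d = y∉ y∈d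
    ... | _ , un , _ | inj₂ y∈q = case trans (sym un) (av (there y∈q)) of λ ()
    available : ∀ {y} → y ∈ q ++ R → Avail S (d ∷ʳ x) y
    available {y} y∈ with ∈-++⁻ q y∈
    ... | inj₂ y∈R = correct y .proj₁ y∈R .proj₂ .proj₂
    ... | inj₁ y∈q = avail-mono S {d} ∈-++⁺ˡ (λ y∈d → unique-++-disjoint (d ∷ʳ x) uq′ y∈d y∈q) (av (there y∈q))
    complete : ∀ {y} → y ∉ d ∷ʳ x → Avail S (d ∷ʳ x) y → y ∈ q ++ R
    complete {y} y∉ avy = decide (p S y (letters d)) refl
      where
      decide : ∀ b → p S y (letters d) ≡ b → y ∈ q ++ R
      decide false un = ∈-++⁺ʳ q (correct y .proj₂ (y∉ , un , avy))
      decide true avd with full (y∉ ∘ ∈-++⁺ˡ) avd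
      ... | here refl = ⊥-elim (y∉ (∈-++⁺ʳ d (here refl)))
      ... | there y∈q = ∈-++⁺ˡ y∈q

  -- The variants of the letters processed so far, where the last letter x may still be
  -- waiting to be swapped with the next letter x′.
  data Freedom : Word n → Word n → ℕ → Set where
    settled : ∀ {d q k} → Variants k d → Freedom d q k
    waiting : ∀ {d x x′ q k} → Variants k d → x ∉ d → x′ ∉ d → x ≢ x′ → Avail S d x → Avail S d x′ →
              Freedom (d ∷ʳ x) (x′ ∷ q) (suc k)

  variants-weaken : ∀ {j k d} → j ≤ k → Variants k d → Variants j d
  variants-weaken j≤k (variants vs uq sp count) = variants vs uq sp (≤-trans (^-monoʳ-≤ 2 j≤k) count)

  freedom-forced : ∀ {d x q k} q′ → Freedom d (x ∷ q) k → x ∉ d → Avail S d x → Freedom (d ∷ʳ x) q′ k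
  freedom-forced q′ (settled V) x∉ av = settled (variants-∷ʳ V x∉ av)
  -- The forced letter serves as the partner of the waiting one. The swap could account for two free
  -- letters, but only one of its letters is free.
  freedom-forced q′ (waiting V x∉ x′∉ x≢x′ avx avx′) _ _ =
    settled (variants-weaken (n≤1+n _) (variants-swap V x∉ x′∉ x≢x′ avx avx′))

  freedom-choice : ∀ {d x y q k} → Freedom d (x ∷ y ∷ q) k → x ∉ d → y ∉ d → x ≢ y →
                   Avail S d x → Avail S d y → ∀ q′ → Freedom (d ∷ʳ x) (y ∷ q′) (suc k)
  freedom-choice (settled V) x∉ y∉ x≢y avx avy q′ = waiting V x∉ y∉ x≢y avx avy
  freedom-choice (waiting V x∉ x′∉ x≢x′ avx avx′) _ _ _ _ _ q′ =
    settled (variants-swap V x∉ x′∉ x≢x′ avx avx′)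

  record Split (d q bs ns : Word n) : Set where
    constructor split
    field
      valid      : 𝓛 S d
      pending    : Pending d q
      increasing : Increasing bs
      minimal    : ∀ {b z} → b ∈ bs → z ∉ d → ord π b < ord π z
      bs⊆d       : ∀ {b} → b ∈ bs → b ∈ d
      covers     : ∀ {z} → z ∈ d → z ∈ bs ⊎ z ∈ ns
      freedom    : Freedom d q (length ns)
  open Split

  head-∉ : ∀ {d x q} → Pending d (x ∷ q) → x ∉ d
  head-∉ {d} (uq , _) = unique-middle d uq .proj₁

  split-forced : ∀ {d x bs ns} → Split d (x ∷ []) bs ns → Split (d ∷ʳ x) (stepReports C d x) (bs ∷ʳ x) ns
  split-forced {d} {x} {bs} {ns} (split L pd inc mn bs⊆ cov fr) = split L′
    (pending-step pd L′)
    (AllPairsₚ.++⁺ inc ([] ∷ []) (All.tabulate λ b∈ → mn b∈ x∉ ∷ []))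
    minimal′
    (λ b∈ → case ∈-∷ʳ⁻ bs b∈ of λ { (inj₁ q) → ∈-++⁺ˡ (bs⊆ q) ; (inj₂ refl) → ∈-++⁺ʳ d (here refl) })
    (λ z∈ → case ∈-∷ʳ⁻ d z∈ of λ
      { (inj₁ q) → case cov q of λ { (inj₁ r) → inj₁ (∈-++⁺ˡ r) ; (inj₂ r) → inj₂ r }
      ; (inj₂ refl) → inj₁ (∈-++⁺ʳ bs (here refl)) })
    (freedom-forced _ fr x∉ (pd .proj₂ .proj₁ (here refl)))
    where
    x∉ : x ∉ d
    x∉ = head-∉ pd
    L′ : 𝓛 S (d ∷ʳ x)
    L′ = 𝓛-∷ʳ S L x∉ (pd .proj₂ .proj₁ (here refl))
    minimal′ : ∀ {b z} → b ∈ bs ∷ʳ x → z ∉ d ∷ʳ x → ord π b < ord π z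
    minimal′ {b} {z} b∈ z∉ with ∈-∷ʳ⁻ bs b∈
    ... | inj₁ q = mn q (z∉ ∘ ∈-++⁺ˡ)
    ... | inj₂ refl with first-outside d (z∉ ∘ ∈-++⁺ˡ)
    ... | y , y∉ , av , y≤ with pd .proj₂ .proj₂ y∉ av
    ... | here refl = ≤∧≢⇒< y≤ λ e≡ →
      z∉ (∈-++⁺ʳ d (here (ord-injective (π-complete z) (sym e≡))))

  split-choice : ∀ {d x y q bs ns} → Split d (x ∷ y ∷ q) bs ns →
                 Split (d ∷ʳ x) ((y ∷ q) ++ stepReports C d x) bs (x ∷ ns)
  split-choice {d} {x} {y} {q} {bs} {ns} (split L pd@(uq , av , _) inc mn bs⊆ cov fr) = split L′
    (pending-step pd L′) inc (λ b∈ z∉ → mn b∈ (z∉ ∘ ∈-++⁺ˡ)) (∈-++⁺ˡ ∘ bs⊆)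
    (λ z∈ → case ∈-∷ʳ⁻ d z∈ of λ
      { (inj₁ r) → case cov r of λ { (inj₁ s) → inj₁ s ; (inj₂ s) → inj₂ (there s) }
      ; (inj₂ refl) → inj₂ (here refl) })
    (freedom-choice fr (head-∉ pd) (λ y∈ → unique-++-disjoint d uq y∈ (there (here refl)))
      (λ { refl → unique-middle d uq .proj₂ (here refl) }) (av (here refl)) (av (there (here refl))) _)
    where
    L′ : 𝓛 S (d ∷ʳ x)
    L′ = 𝓛-∷ʳ S L (head-∉ pd) (av (here refl))

  split-init : Split [] (initReports C) [] []
  split-init = split ([] , λ ()) pending-init [] (λ ()) (λ ()) (λ ()) (settled variants-[])

  split-complete : ∀ {d bs ns} → Split d [] bs ns → ∀ x → x ∈ d
  split-complete {d} sp x with x ∈? d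
  ... | yes x∈ = x∈
  ... | no x∉ with first-outside d x∉
  ... | y , y∉ , av , _ = case sp .pending .proj₂ .proj₂ y∉ av of λ ()

  split-count : ∀ {d bs ns} → Split d [] bs ns → 2 ^ length ns ≤ ∣𝓟 A ∣ * ∣𝓟 A ∣
  split-count sp with sp .freedom
  -- `waiting` requires a nonempty queue, so no swap is left open at the end.
  ... | settled V = variants-count V (split-complete sp)

  -- Execution of the first session

  enqueueLoop : Cmd
  enqueueLoop = while (op lt (reg rI) (reg rCount))
    (aQueue [ reg rTail ]:= aReport [ reg rI ] ⨾ rI := reg rI ⊕ lit 1 ⨾ rTail := reg rTail ⊕ lit 1)

  record Enqueued (f : ℕ → ℕ) (σ′ : State n) (t : ℕ) (xs : Word n) : Set where
    constructor enqueued
    field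
      added : Holds (arrays σ′ aQueue) t xs
      kept  : ∀ k → k < t → arrays σ′ aQueue k ≡ f k
      end   : regs σ′ rTail ≡ t + length xs

  enqueue-loop : ∀ {σ} i t xs → regs σ rI ≡ i → regs σ rTail ≡ t → regs σ rCount ≡ i + length xs →
    Holds (arrays σ aReport) i xs → i + length xs ≤ suc n → t + length xs ≤ suc n →
    Work enqueueLoop σ (suc (length xs)) 0 (λ σ′ → Enqueued (arrays σ aQueue) σ′ t xs)
  enqueue-loop i t [] ri rt rc h i≤ t≤ = e-block (e-while0
    (ev-lt0 (ev-reg ri) (ev-reg rc) (≤⇒≯ (≤-reflexive (+-identityʳ i))))
    (enqueued tt (λ _ _ → refl) (trans rt (sym (+-identityʳ t)))))
  enqueue-loop {σ} i t (x ∷ xs) ri rt rc (e≡ , h) i≤ t≤ =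
    e-iter₀ (ev-lt1 (ev-reg ri) (ev-reg rc) (m<m+n i z<s))
    (e-seq (e-store (ev-reg rt) (ev-arr (ev-reg ri) e≡)
    (e-seq (e-assign (ev-add (ev-reg ri) ev-lit (≤1+n⇒fits i+1≤))
    (e-assign (ev-add (ev-reg rt) ev-lit (≤1+n⇒fits t+1≤))
    (w-map finish (enqueue-loop (suc i) (suc t) xs (+-comm i 1) (+-comm t 1)
      (trans rc (+-suc i (length xs))) h (subst (_≤ suc n) (+-suc i (length xs)) i≤)
      (subst (_≤ suc n) (+-suc t (length xs)) t≤))))))))
    where
    i+1≤ : i + 1 ≤ suc n
    i+1≤ = ≤-trans (+-monoʳ-≤ i (s≤s z≤n)) i≤
    t+1≤ : t + 1 ≤ suc n
    t+1≤ = ≤-trans (+-monoʳ-≤ t (s≤s z≤n)) t≤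
    finish : ∀ {σ′} → Enqueued _ σ′ (suc t) xs → Enqueued (arrays σ aQueue) σ′ t (x ∷ xs)
    finish (enqueued ad kp en) = enqueued
      (trans (kp t (n<1+n t)) (update-same (arrays σ aQueue) t (toℕ x)) , ad)
      (λ k k< → trans (kp k (m<n⇒m<1+n k<)) (update-other (arrays σ aQueue) (toℕ x) (<⇒≢ k< ∘ sym)))
      (trans en (sym (+-suc t (length xs))))

  enqueue-code : ∀ {σ α t xs} → Reported σ α xs → regs σ rTail ≡ t → t + length xs ≤ suc n →
    Work enqueueReports σ (2 + length xs) 0 (λ σ′ → Enqueued (arrays σ aQueue) σ′ t xs)
  enqueue-code {t = t} {xs} rep rt t≤ = w-seq (e-block (e-assign ev-lit
    (enqueue-loop 0 t xs refl rt (rep .number) (rep .reports) (≤-trans (m≤n+m _ t) t≤) t≤)))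

  holds-++ : ∀ {f i} (xs : Word n) {ys : Word n} → Holds f i xs → Holds f (i + length xs) ys → Holds f i (xs ++ ys)
  holds-++ {f} {i} [] {ys} h h′ = subst (λ k → Holds f k ys) (+-identityʳ i) h′
  holds-++ {f} {i} (x ∷ xs) {ys} (e≡ , h) h′ =
    e≡ , holds-++ xs h (subst (λ k → Holds f k ys) (+-suc i (length xs)) h′)

  record Forced (σ : State n) (bs : Word n) : Set where
    constructor forced
    field
      count   : regs σ rM ≡ length bs
      table   : Holds (arrays σ aForced) 1 bs
      flagged : ∀ {x} → x ∈ bs → arrays σ aIsForced (toℕ x) ≡ 1
      others  : ∀ {x} → x ∉ bs → arrays σ aIsForced (toℕ x) ≡ 0
  open Forced

  record Queue (σ : State n) (d q : Word n) : Set where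
    constructor queue
    field
      front : regs σ rHead ≡ length d
      back  : regs σ rTail ≡ length d + length q
      cells : Holds (arrays σ aQueue) (length d) q
  open Queue

  length-∷ʳ : ∀ (d : Word n) x → length (d ∷ʳ x) ≡ suc (length d)
  length-∷ʳ d x = trans (length-++ d) (+-comm (length d) 1)

  pending-≤ : ∀ {d q} → Pending d q → length d + length q ≤ n
  pending-≤ {d} (uq , _) = ≤-trans (≤-reflexive (sym (length-++ d))) (unique-length uq)

  enqueue-queue : ∀ {σ σ′ α d q xs} → Reported σ α xs → Queue σ d q → Frame enqueueReports σ σ′ →
                  Enqueued (arrays σ aQueue) σ′ (length d + length q) xs → Queue σ′ d (q ++ xs)
  enqueue-queue {d = d} {q} {xs} rep (queue hd tl cs) F (enqueued ad kp en) = queue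
    (trans (F .reg≡ rHead refl) hd)
    (trans en (trans (+-assoc (length d) (length q) (length xs)) (cong (length d +_) (sym (length-++ q)))))
    (holds-++ q (holds-cong (length d) q (λ j _ j< → kp j j<) cs) ad)

  findLoop : Cmd
  findLoop = while (op lt (reg rHead) (reg rTail))
    (rX := aQueue [ reg rHead ]
     ⨾ rHead := reg rHead ⊕ lit 1
     ⨾ ifz (op eq (reg rHead) (reg rTail)) skip
         (rM := reg rM ⊕ lit 1 ⨾ aForced [ reg rM ]:= reg rX ⨾ aIsForced [ reg rX ]:= lit 1)
     ⨾ step (reg rX) rCount aReport
     ⨾ enqueueReports)

  open Candidate C using (stepsTime)

  stepsTime-∷ʳ : ∀ α β x → stepsTime α (β ∷ʳ x) ≡ stepsTime α β + stepTime C (α ++ β) x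
  stepsTime-∷ʳ α [] x = trans (+-identityʳ _) (cong (λ γ → stepTime C γ x) (sym (++-identityʳ α)))
  stepsTime-∷ʳ α (y ∷ β) x = trans (cong (stepTime C α y +_) (stepsTime-∷ʳ (α ∷ʳ y) β x))
    (trans (sym (+-assoc (stepTime C α y) _ _))
      (cong (λ γ → stepTime C α y + stepsTime (α ∷ʳ y) β + stepTime C γ x) (++-assoc α (y ∷ []) β)))

  -- A call takes more time than it has reports, `r < s`. So `s` also pays for the queueing of the
  -- reports and for the constant work of a pass.
  step-cost : ∀ s r t → r < s → suc (1 + (1 + (1 + (suc s + (2 + r)))) + (1 + 8 * t)) ≤ 1 + 8 * (s + t)
  step-cost s r t r<s = linear 0 (+-mono-≤ r<s (*-monoʳ-≤ 6 (≤-trans (s≤s z≤n) r<s))) (identity s r t)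
    where
    identity : ∀ s r t → suc (1 + (1 + (1 + (suc s + (2 + r)))) + (1 + 8 * t)) + (s + 6 * s) + 0 ≡
                         1 + 8 * (s + t) + (suc r + 6 * 1)
    identity = solve-∀

  -- The steps of the loop are determined before it runs, since its cost is stated in terms of them.
  data Trace (d′ bs′ ns′ : Word n) : Word n → Word n → Word n → Word n → ℕ → Set where
    stop   : Trace d′ bs′ ns′ d′ [] bs′ ns′ 0
    only   : ∀ {d x bs ns t} → Trace d′ bs′ ns′ (d ∷ʳ x) (stepReports C d x) (bs ∷ʳ x) ns t →
             Trace d′ bs′ ns′ d (x ∷ []) bs ns (stepTime C d x + t)
    choice : ∀ {d x y q bs ns t} →
             Trace d′ bs′ ns′ (d ∷ʳ x) ((y ∷ q) ++ stepReports C d x) bs (x ∷ ns) t →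
             Trace d′ bs′ ns′ d (x ∷ y ∷ q) bs ns (stepTime C d x + t)

  record Outcome (d q bs ns : Word n) : Set where
    constructor outcome
    field
      {done forced′ free} : Word n
      {time} : ℕ
      trace  : Trace done forced′ free d q bs ns time
      result : Split done [] forced′ free
      total  : stepsTime [] done ≡ stepsTime [] d + time

  outcome-total : ∀ d x e t → stepsTime [] e ≡ stepsTime [] (d ∷ʳ x) + t →
                  stepsTime [] e ≡ stepsTime [] d + (stepTime C d x + t)
  outcome-total d x e t p = trans p (trans (cong (_+ _) (stepsTime-∷ʳ [] d x)) (+-assoc (stepsTime [] d) _ _))

  find-outcome : ∀ fuel {d q bs ns} → n < length d + fuel → Split d q bs ns → Outcome d q bs ns
  find-outcome zero {d} fuel≥ sp = ⊥-elim (<⇒≱ fuel≥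
    (≤-trans (≤-reflexive (+-identityʳ _)) (unique-length (proj₁ (sp .valid)))))
  find-outcome (suc fuel) {d} {[]} fuel≥ sp = outcome stop sp (sym (+-identityʳ _))
  find-outcome (suc fuel) {d} {x ∷ []} fuel≥ sp
    with find-outcome fuel (subst (n <_) (trans (+-suc (length d) fuel)
           (cong (_+ fuel) (sym (length-∷ʳ d x)))) fuel≥) (split-forced sp)
  ... | outcome {done} {time = t} tr res tot = outcome (only tr) res (outcome-total d x done t tot)
  find-outcome (suc fuel) {d} {x ∷ y ∷ q} fuel≥ sp
    with find-outcome fuel (subst (n <_) (trans (+-suc (length d) fuel)
           (cong (_+ fuel) (sym (length-∷ʳ d x)))) fuel≥) (split-choice sp)
  ... | outcome {done} {time = t} tr res tot = outcome (choice tr) res (outcome-total d x done t tot)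

  advance : ∀ {σ d x q bs} → history σ ≡ just d → regs σ rX ≡ toℕ x → 𝓛 S (d ∷ʳ x) →
    Pending (d ∷ʳ x) (q ++ stepReports C d x) → Queue σ (d ∷ʳ x) q → Forced σ bs →
    Work (step (reg rX) rCount aReport ⨾ enqueueReports) σ
      (suc (stepTime C d x) + (2 + length (stepReports C d x))) 0
      (λ σ′ → history σ′ ≡ just (d ∷ʳ x) × Queue σ′ (d ∷ʳ x) (q ++ stepReports C d x) × Forced σ′ bs)
  advance {σ} {d} {x} {q} {bs} his rx L pd (queue hd tl cs) (forced ct tb f1 f0) = w-seq (step-code his rx L
    (w-map′ (λ F en → F .his≡ refl
        , enqueue-queue rep (queue hd tl cs) F en
        , forced (trans (F .reg≡ rM refl) ct) (holds-≡ (sym (F .arr≡ aForced refl)) tb)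
            (λ {z} z∈ → trans (cong (λ f → f (toℕ z)) (F .arr≡ aIsForced refl)) (f1 z∈))
            (λ {z} z∉ → trans (cong (λ f → f (toℕ z)) (F .arr≡ aIsForced refl)) (f0 z∉)))
      (enqueue-code rep tl (≤-trans (≤-reflexive (trans (+-assoc (length (d ∷ʳ x)) (length q) _)
        (cong (length (d ∷ʳ x) +_) (sym (length-++ q))))) (≤-trans (pending-≤ pd) (n≤1+n n))))))
    where
    R : Word n
    R = stepReports C d x
    rep : Reported (receive R (d ∷ʳ x) rCount aReport σ) (d ∷ʳ x) R
    rep = receive-reported {σ} R (d ∷ʳ x) (Candidate.step-unique C d x L)

  flag-update : ∀ {f : ℕ → ℕ} {bs : Word n} {x} → (∀ {z} → z ∈ bs → f (toℕ z) ≡ 1) →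
                ∀ {z} → z ∈ bs ∷ʳ x → update f (toℕ x) 1 (toℕ z) ≡ 1
  flag-update {f} {bs} {x} h {z} z∈ with z Fin.≟ x
  ... | yes refl = update-same f (toℕ x) 1
  ... | no z≢x = trans (update-other f 1 (z≢x ∘ sym ∘ Fin.toℕ-injective))
    (case ∈-∷ʳ⁻ bs z∈ of λ { (inj₁ q) → h q ; (inj₂ e≡) → ⊥-elim (z≢x e≡) })

  find-loop : ∀ {σ d q bs ns d′ bs′ ns′ t} → Trace d′ bs′ ns′ d q bs ns t →
    history σ ≡ just d → Queue σ d q → Forced σ bs → Split d q bs ns →
    Work findLoop σ (1 + 8 * t) 0 (λ σ′ → Forced σ′ bs′)
  find-loop stop his (queue hd tl cs) fo sp =
    e-block (e-while0 (ev-lt0 (ev-reg hd) (ev-reg tl) (≤⇒≯ (≤-reflexive (+-identityʳ _)))) fo)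
  find-loop {σ} {d} {bs = bs} (only {x = x} {t = t} tr) his (queue hd tl (e≡ , _)) (forced ct tb f1 f0) sp =
    w-weaken (step-cost (stepTime C d x) (length (stepReports C d x)) t (Candidate.step-cost C d x L)) ≤-refl
    (w-while (ev-lt1 (ev-reg hd) (ev-reg tl) (≤-reflexive (+-comm 1 (length d))))
    (w-seq (e-block (e-assign (ev-arr (ev-reg hd) e≡)
    (w-seq (e-block (e-assign (ev-add (ev-reg hd) ev-lit (≤1+n⇒fits (≤-trans d+1≤ (n≤1+n n))))
    (w-seq (e-block (e-if1 (ev-eq1 (ev-reg refl) (ev-reg tl) refl)
      (e-seq (e-assign (ev-add (ev-reg ct) ev-lit (≤1+n⇒fits bs+1≤))
      (e-seq (e-store (ev-reg (+-comm (length bs) 1)) (ev-reg refl)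
      (e-store (ev-reg refl) ev-lit
    (w-map (λ (his′ , qu′ , fo′) → find-loop tr his′ qu′ fo′ (split-forced sp))
      (advance his refl L (split-forced sp .pending)
        (queue (trans (+-comm (length d) 1) (sym (length-∷ʳ d x)))
               (trans tl (trans (+-comm (length d) 1) (sym (trans (+-identityʳ _) (length-∷ʳ d x))))) tt)
        (forced (trans (+-comm (length bs) 1) (sym (length-∷ʳ bs x)))
          (holds-∷ʳ 1 bs (holds-cong 1 bs (λ j _ j< → update-other (arrays σ aForced) (toℕ x) (<⇒≢ j< ∘ sym)) tb)
            (update-same (arrays σ aForced) (suc (length bs)) (toℕ x)))
          (flag-update {arrays σ aIsForced} {bs} f1)
          (λ {z} z∉ → trans (update-other (arrays σ aIsForced) 1 λ p → z∉ (∈-++⁺ʳ bs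
            (here (sym (Fin.toℕ-injective p))))) (f0 (z∉ ∘ ∈-++⁺ˡ)))))))))))))))))))))
    where
    L : 𝓛 S (d ∷ʳ x)
    L = split-forced sp .valid
    d+1≤ : length d + 1 ≤ n
    d+1≤ = pending-≤ (sp .pending)
    bs+1≤ : length bs + 1 ≤ suc n
    bs+1≤ = ≤-trans (≤-reflexive (+-comm (length bs) 1)) (s≤s (unique-length
      (AllPairs.map (λ b<c → λ { refl → <-irrefl refl b<c }) (sp .increasing))))
  find-loop {σ} {d} {bs = bs} (choice {x = x} {y} {q} {t = t} tr) his (queue hd tl (e≡ , cs)) (forced ct tb f1 f0) sp =
    w-weaken (step-cost (stepTime C d x) (length (stepReports C d x)) t (Candidate.step-cost C d x L)) ≤-refl
    (w-while (ev-lt1 (ev-reg hd) (ev-reg tl) (m<m+n (length d) z<s))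
    (w-seq (e-block (e-assign (ev-arr (ev-reg hd) e≡)
    (w-seq (e-block (e-assign (ev-add (ev-reg hd) ev-lit (≤1+n⇒fits (≤-trans d+1≤ (n≤1+n n))))
    (w-seq (e-block (e-if0 (ev-eq0 (ev-reg refl) (ev-reg tl) λ p → <⇒≢ (s≤s (s≤s z≤n)) (+-cancelˡ-≡ (length d) _ _ p))
      (e-skip
    (w-map (λ (his′ , qu′ , fo′) → find-loop tr his′ qu′ fo′ (split-choice sp))
      (advance his refl L (split-choice sp .pending)
        (queue (trans (+-comm (length d) 1) (sym (length-∷ʳ d x)))
               (trans tl (trans (+-suc (length d) (suc (length q))) (cong (_+ suc (length q)) (sym (length-∷ʳ d x)))))
               (subst (λ k → Holds (arrays σ aQueue) k (y ∷ q)) (sym (length-∷ʳ d x)) cs))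
        (forced ct tb f1 f0))))))))))))))
    where
    L : 𝓛 S (d ∷ʳ x)
    L = split-choice sp .valid
    d+1≤ : length d + 1 ≤ n
    d+1≤ = ≤-trans (+-monoʳ-≤ (length d) (s≤s z≤n)) (pending-≤ (sp .pending))

  first : Outcome [] (initReports C) [] []
  first = find-outcome (suc n) ≤-refl split-init

  open Outcome first public using () renaming (forced′ to forcedLetters; free to freeLetters)

  find-code : Work findForced (start n)
    (suc (initTime C) + (2 + length (initReports C) + (1 + 8 * Outcome.time first))) 0
    (λ σ′ → Forced σ′ forcedLetters)
  find-code = w-seq (init-code (w-then (enqueue-code rep refl (≤-trans (unique-length uq) (n≤1+n n)))
    λ F en → find-loop (Outcome.trace first) (F .his≡ refl)
      (enqueue-queue {d = []} {[]} rep (queue refl refl tt) F en)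
      (forced (F .reg≡ rM refl) tt (λ ()) (λ {x} _ → cong (λ f → f (toℕ x)) (F .arr≡ aIsForced refl)))
      split-init))
    where
    uq : Unique (initReports C)
    uq = Candidate.init-unique C
    rep : Reported (receive (initReports C) [] rCount aReport (start n)) [] (initReports C)
    rep = receive-reported {start n} (initReports C) [] uq

  find-time : suc (initTime C) + (2 + length (initReports C) + (1 + 8 * Outcome.time first)) ≤
              10 * tᵗᵒᵗᵃˡ C
  find-time = ≤-trans (linear (5 * i + 2 * t) (+-mono-≤ (Candidate.init-cost C)
      (*-monoʳ-≤ 3 (≤-trans (s≤s z≤n) (Candidate.init-cost C)))) (identity i (length (initReports C)) t))
    (*-monoʳ-≤ 10 (subst (λ s → i + s ≤ tᵗᵒᵗᵃˡ C) (Outcome.total first)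
      (session≤total C (Outcome.result first .valid))))
    where
    i t : ℕ
    i = initTime C
    t = Outcome.time first
    identity : ∀ i r t → suc i + (2 + r + (1 + 8 * t)) + (i + 3 * i) + (5 * i + 2 * t) ≡
                         10 * (i + t) + (suc r + 3 * 1)
    identity = solve-∀

-- The second session

least : ∀ {P : ℕ → Set} → (∀ i → Dec (P i)) → ∀ m → P m → ∃[ i ] i ≤ m × P i × (∀ j → P j → i ≤ j)
least P? zero p = 0 , z≤n , p , λ _ _ → z≤n
least P? (suc m) p with P? 0
... | yes p₀ = 0 , z≤n , p₀ , λ _ _ → z≤n
... | no ¬p₀ with least (P? ∘ suc) m p
... | i , i≤ , pᵢ , min = suc i , s≤s i≤ , pᵢ , λ
  { zero p₀ → ⊥-elim (¬p₀ p₀) ; (suc j) pⱼ → s≤s (min j pⱼ) }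

module Planning {n : ℕ} (S : MPS n) (C : Candidate S)
                (π : Word n) (π∈𝓛 : 𝓛 S π) (π-complete : ∀ x → x ∈ π) (bs : Word n) where

  π-unique : Unique π
  π-unique = proj₁ π∈𝓛

  take-length : ∀ (u : Word n) {v} → take (length u) (u ++ v) ≡ u
  take-length [] = refl
  take-length (x ∷ u) = cong (x ∷_) (take-length u)

  avail-ord : ∀ y → Avail S (take (ord π y) π) y
  avail-ord y with ∈-split (π-complete y)
  ... | u , v , e≡ = subst (λ w → Avail S w y) (sym (trans
      (cong₂ take (trans (cong (λ w → ord w y) e≡)
        (ord-split u (unique-middle u (subst Unique e≡ π-unique) .proj₁))) e≡)
      (take-length u))) (𝓛-avail S π∈𝓛 u e≡)

  earliest : ∀ y → ∃[ i ] i ≤ ord π y × Avail S (take i π) y × (∀ j → Avail S (take j π) y → i ≤ j)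
  earliest y = least (λ i → avail? S (take i π) y) (ord π y) (avail-ord y)

  a : Fin n → ℕ
  a y = earliest y .proj₁

  a≤ : ∀ y → a y ≤ ord π y
  a≤ y = earliest y .proj₂ .proj₁

  available : ∀ y → Avail S (take (a y) π) y
  available y = earliest y .proj₂ .proj₂ .proj₁

  a-least : ∀ {u v y} → π ≡ u ++ v → Avail S u y → a y ≤ length u
  a-least {u} {v} {y} e≡ av = earliest y .proj₂ .proj₂ .proj₂ (length u)
    (subst (λ w → Avail S w y) (sym (trans (cong (take (length u)) e≡) (take-length u))) av)

  open Capacity π π-complete a a≤ public
  open Heaps (ord π) public

  alive-avail : ∀ {u v y} → π ≡ u ++ v → Alive (length u) y → Avail S u y
  alive-avail {u} {v} {y} e≡ (a≤τ , τ≤) = avail-mono S {take (a y) π}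
    (λ z∈ → ord<⇒∈ u (subst₂ (λ w l → ord w _ < l) (trans (take++drop≡id (a y) π) e≡) refl
      (<-≤-trans (ord-∈ (take (a y) π) z∈) (≤-trans (≤-reflexive (length-take (a y) π))
        (≤-trans (m⊓n≤m (a y) _) a≤τ)))))
    (λ y∈ → <⇒≱ (ord-∈ u y∈) (subst (λ w → length u ≤ ord w y) e≡ τ≤)) (available y)

  insertAll : Word n → Heap → Heap
  insertAll [] h = h
  insertAll (y ∷ xs) h with y ∈? bs
  ... | yes _ = insertAll xs h
  ... | no _ = insertAll xs (insert y h)

  -- The summand `l + suc l` is for the exponential search, the rest for `insert-code`. Only free
  -- letters are charged in this way; handling a forced letter is paid for by the call that reports
  -- it.
  insertWork : Fin n → Heap → ℕ
  insertWork y h = let (j , c′ , _) = carry 0 (y ∷ []) h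
                       l = lg (ord π y ∸ a y) in
    l + suc l + (carryWork 0 (y ∷ []) h + (length c′ + suc j))

  insertAllWork : Word n → Heap → ℕ
  insertAllWork [] h = 0
  insertAllWork (y ∷ xs) h with y ∈? bs
  ... | yes _ = insertAllWork xs h
  ... | no _ = insertWork y h + insertAllWork xs (insert y h)

  -- The potential Λ h − Φ h pays for the work on the elements of h up to now, counted from
  -- their insertion on; popping x costs it at most 45 · cap x in total.
  Φ μ Λ : Heap → ℕ
  Φ = levels 0
  μ = cappedLevels cap 0
  Λ h = 38 * μ h + 6 * weight (λ _ → cap) 0 h

  weight-const-↭ : ∀ (f : Fin n → ℕ) i h → weight (λ _ → f) i h ≡ sumBy f (concat h)
  weight-const-↭ f i [] = refl
  weight-const-↭ f i (r ∷ h) = trans (cong (sumBy f r +_) (weight-const-↭ f (suc i) h)) (sym (sumBy-++ f r))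

  insert-potential : ∀ {τ} y h → Good τ (y ∷ concat h) →
    insertWork y h + Φ (insert y h) + Λ h ≤ Φ h + Λ (insert y h)
  insert-potential {τ} y h g = subst
    (λ k → insertWork y h + Φ (insert y h) + Λ h ≤ Φ h + (38 * μ (insert y h) + 6 * k)) (sym caps)
    -- With `l` for the logarithm, the work plus the growth of `Φ` is at most `2 * l + 12` plus 19
    -- times that growth: 18 by `insert-work`, and 1 that `Φ` keeps for a later pop. By
    -- `insert-capped` the latter part is covered by the 38 in `Λ`, and `6 * cap y = 12 + 6 * l`
    -- covers the former.
    (linear (4 * lg (ord π y ∸ a y))
      (+-mono-≤ (insert-work y h) (*-monoʳ-≤ 19 (insert-capped cap (Good τ) good-resp-↭ rises y h g)))
      (identity (lg (ord π y ∸ a y)) (carryWork 0 (y ∷ []) h) (length c′) j (Φ h) (Φ (insert y h))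
        (μ h) (μ (insert y h)) (weight (λ _ → cap) 0 h)))
    where
    j : ℕ
    j = proj₁ (carry 0 (y ∷ []) h)
    c′ : Batch
    c′ = proj₁ (proj₂ (carry 0 (y ∷ []) h))
    caps : weight (λ _ → cap) 0 (insert y h) ≡ cap y + weight (λ _ → cap) 0 h
    caps = trans (weight-const-↭ cap 0 (insert y h)) (trans (sumBy-↭ cap (insert-↭ y h))
      (cong (cap y +_) (sym (weight-const-↭ cap 0 h))))
    identity : ∀ l k c j φ φ′ m m′ s →
      l + suc l + (k + (c + suc j)) + φ′ + (38 * m + 6 * s) + (10 + 18 * φ′ + 19 * (φ + 2 * m′)) + 4 * l ≡
      φ + (38 * m′ + 6 * (2 + l + s)) + (k + c + j + 18 * φ + 19 * (φ′ + 2 * m))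
    identity = solve-∀

  -- The invariant of the second session apart from memory: `u` has been output, and `xs` are the
  -- reported letters still to be examined. The latter may contain forced letters, which is why
  -- `free` speaks of the heap alone.
  record Pure (u : Word n) (h : Heap) (xs : Word n) : Set where
    constructor pure
    field
      sorted   : All Sorted h
      good     : Good (length u) (concat h ++ xs)
      free     : ∀ {y} → y ∈ concat h → y ∉ bs
      complete : ∀ {y} → y ∉ u → y ∉ bs → Avail S u y → y ∈ concat h ++ xs
  open Pure public

  good-here : ∀ {u h y xs} → Pure u h (y ∷ xs) → Good (length u) (y ∷ concat h)
  good-here {h = h} {y} {xs} P with good-resp-↭ (shift y (concat h) xs) (P .good)
  ... | uq , al = unique-++ˡ (y ∷ concat h) uq , All.++⁻ˡ (y ∷ concat h) al

  pure-skip : ∀ {u h y xs} → y ∈ bs → Pure u h (y ∷ xs) → Pure u h xs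
  pure-skip {h = h} {y} {xs} y∈ (pure so go fr co)
    with good-resp-↭ (shift y (concat h) xs) go
  ... | _ ∷ uq , _ ∷ al = pure so (uq , al) fr λ z∉u z∉bs av →
    ∈-swap (concat h) (co z∉u z∉bs av) λ { refl → z∉bs y∈ }

  pure-insert : ∀ {u h y xs} → y ∉ bs → Pure u h (y ∷ xs) → Pure u (insert y h) xs
  pure-insert {h = h} {y} {xs} y∉ (pure so go fr co) = pure (insert-sorted y so) (good-resp-↭ perm go)
    (λ z∈ → case ∈-resp-↭ (insert-↭ y h) z∈ of λ { (here refl) → y∉ ; (there z∈h) → fr z∈h })
    (λ z∉u z∉bs av → ∈-resp-↭ perm (co z∉u z∉bs av))
    where
    perm : concat h ++ y ∷ xs ↭ concat (insert y h) ++ xs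
    perm = ↭-trans (shift y (concat h) xs) (++⁺ʳ xs (↭-sym (insert-↭ y h)))

  insertAll-pure : ∀ {u h} xs → Pure u h xs → Pure u (insertAll xs h) []
  insertAll-pure [] P = P
  insertAll-pure (y ∷ xs) P with y ∈? bs
  ... | yes y∈ = insertAll-pure xs (pure-skip y∈ P)
  ... | no y∉ = insertAll-pure xs (pure-insert y∉ P)

  insertAll-potential : ∀ {u h} xs → Pure u h xs →
    insertAllWork xs h + Φ (insertAll xs h) + Λ h ≤ Φ h + Λ (insertAll xs h)
  insertAll-potential [] P = ≤-refl
  insertAll-potential {h = h} (y ∷ xs) P with y ∈? bs
  ... | yes y∈ = insertAll-potential xs (pure-skip y∈ P)
  ... | no y∉ = linear 0
    (+-mono-≤ (insert-potential y h (good-here P)) (insertAll-potential xs (pure-insert y∉ P)))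
    (identity (insertWork y h) (insertAllWork xs h₁) (Φ h) (Φ h₁) (Φ h₂) (Λ h) (Λ h₁) (Λ h₂))
    where
    h₁ h₂ : Heap
    h₁ = insert y h
    h₂ = insertAll xs h₁
    identity : ∀ v w f f₁ f₂ l l₁ l₂ →
      v + w + f₂ + l + (f + l₁ + (f₁ + l₂)) + 0 ≡ f + l₂ + (v + f₁ + l + (w + f₂ + l₁))
    identity = solve-∀

  pure-init : Pure [] [] (initReports C)
  pure-init = pure []
    (Candidate.init-unique C , All.tabulate λ {y} y∈ →
      a-least {[]} refl (Equivalence.to (Candidate.init-correct C y) y∈) , z≤n)
    (λ ()) (λ {y} _ _ av → Equivalence.from (Candidate.init-correct C y) av)

  module _ {u x v} (π≡ : π ≡ u ++ x ∷ v) where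

    π≡′ : π ≡ (u ∷ʳ x) ++ v
    π≡′ = trans π≡ (sym (++-assoc u (x ∷ []) v))

    x∉u : x ∉ u
    x∉u = unique-middle u (subst Unique π≡ π-unique) .proj₁

    ord-x : ord π x ≡ length u
    ord-x = trans (cong (λ w → ord w x) π≡) (ord-split u x∉u)

    valid-step : 𝓛 S (u ∷ʳ x)
    valid-step = 𝓛-prefix S (u ∷ʳ x) (subst (𝓛 S) π≡′ π∈𝓛)

    |u∷ʳx| : length (u ∷ʳ x) ≡ suc (length u)
    |u∷ʳx| = trans (length-++ u) (+-comm (length u) 1)

    outside : ∀ {y} → y ∉ u ∷ʳ x → length (u ∷ʳ x) ≤ ord π y
    outside y∉ = subst (λ w → length (u ∷ʳ x) ≤ ord w _) (sym π≡′) (ord-∉ (u ∷ʳ x) y∉)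

    pure-next : ∀ {h h₁} → Pure u h [] → All Sorted h₁ → Unique (concat h₁) →
      (∀ {y} → y ∈ concat h₁ → y ∈ concat h × y ≢ x) →
      (∀ {y} → y ∈ concat h → y ≢ x → y ∈ concat h₁) →
      Pure (u ∷ʳ x) h₁ (stepReports C u x)
    pure-next {h} {h₁} (pure so (uq , al) fr co) so₁ uq₁ h₁⊆ ⊆h₁ = pure so₁
      ( Unique.++⁺ uq₁ (Candidate.step-unique C u x valid-step) disjoint
      , All.++⁺ (All.tabulate old) (All.tabulate new))
      (fr ∘ proj₁ ∘ h₁⊆) complete₁
      where
      reported⁻ : ∀ {y} → y ∈ stepReports C u x → y ∉ u ∷ʳ x × p S y (letters u) ≡ false × Avail S (u ∷ʳ x) y
      reported⁻ {y} = Equivalence.to (Candidate.step-correct C u x valid-step y)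
      alive : ∀ {y} → y ∈ concat h → Alive (length u) y
      alive y∈ = All.lookup al (∈-++⁺ˡ y∈)
      disjoint : ∀ {y} → ¬ (y ∈ concat h₁ × y ∈ stepReports C u x)
      disjoint (y∈h , y∈R) = case trans (sym (reported⁻ y∈R .proj₂ .proj₁))
        (alive-avail {u} π≡ (alive (h₁⊆ y∈h .proj₁))) of λ ()
      old : ∀ {y} → y ∈ concat h₁ → Alive (length (u ∷ʳ x)) y
      old {y} y∈ with h₁⊆ y∈
      ... | y∈h , y≢x = subst (λ τ → Alive τ y) (sym |u∷ʳx|)
        ( m≤n⇒m≤1+n (alive y∈h .proj₁)
        , ≤∧≢⇒< (alive y∈h .proj₂) (λ e≡ → y≢x (ord-injective (π-complete y) (trans (sym e≡) (sym ord-x)))))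
      new : ∀ {y} → y ∈ stepReports C u x → Alive (length (u ∷ʳ x)) y
      new y∈ with reported⁻ y∈
      ... | y∉ , _ , av = a-least {u ∷ʳ x} π≡′ av , outside y∉
      complete₁ : ∀ {y} → y ∉ u ∷ʳ x → y ∉ bs → Avail S (u ∷ʳ x) y → y ∈ concat h₁ ++ stepReports C u x
      complete₁ {y} y∉ y∉bs av = decide (p S y (letters u)) refl
        where
        decide : ∀ b → p S y (letters u) ≡ b → y ∈ concat h₁ ++ stepReports C u x
        decide false un = ∈-++⁺ʳ (concat h₁)
          (Equivalence.from (Candidate.step-correct C u x valid-step y) (y∉ , un , av))
        decide true avᵤ = ∈-++⁺ˡ (⊆h₁ (subst (y ∈_) (++-identityʳ (concat h))
          (co (y∉ ∘ ∈-++⁺ˡ) y∉bs avᵤ)) λ { refl → y∉ (∈-++⁺ʳ u (here refl)) })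

    unique-heap : ∀ {h} → Pure u h [] → Unique (concat h)
    unique-heap P = unique-++ˡ _ (P .good .proj₁)

    alive-heap : ∀ {h y} → Pure u h [] → y ∈ concat h → Alive (length u) y
    alive-heap P y∈ = All.lookup (P .good .proj₂) (∈-++⁺ˡ y∈)

    pure-forced : ∀ {h} → x ∈ bs → Pure u h [] → Pure (u ∷ʳ x) h (stepReports C u x)
    pure-forced x∈ P = pure-next P (P .sorted) (unique-heap P)
      (λ y∈ → y∈ , λ { refl → P .free y∈ x∈ }) (λ y∈ _ → y∈)

    pure-pop : ∀ ls r up → Pure u (plug ls ((x ∷ r) ∷ up)) [] →
               Pure (u ∷ʳ x) (plug ls (r ∷ up)) (stepReports C u x)
    pure-pop ls r up P with unique-resp-↭ (plug-pop-↭ ls {x} {(x ∷ r) ∷ up} {r ∷ up} ↭-refl) (unique-heap P)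
    ... | x∉ ∷ uq = pure-next P so uq
      (λ y∈ → ∈-resp-↭ (↭-sym perm) (there y∈) , λ { refl → All.lookup x∉ y∈ refl })
      (λ y∈ y≢x → case ∈-resp-↭ perm y∈ of λ { (here e≡) → ⊥-elim (y≢x e≡) ; (there q) → q })
      where
      perm : concat (plug ls ((x ∷ r) ∷ up)) ↭ x ∷ concat (plug ls (r ∷ up))
      perm = plug-pop-↭ ls {x} {(x ∷ r) ∷ up} {r ∷ up} ↭-refl
      so : All Sorted (plug ls (r ∷ up))
      so with plug-all⁻ ls (P .sorted)
      ... | pl , (_ ∷ sr) ∷ su = plug-all⁺ pl (sr ∷ su)

    -- Letters of the heap are alive, so none stands before position `length u`, which is that of
    -- `x`. Being free and available, `x` is in the heap itself, and distinct letters have distinct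
    -- keys.
    best-next : ∀ {h} → Pure u h [] → x ∉ bs →
      ∃[ ls ] ∃[ r ] ∃[ up ] h ≡ plug ls ((x ∷ r) ∷ up) × best 0 h ≡ just (length ls , x)
    best-next {h} P x∉bs = go (best 0 h) refl
      where
      x∈h : x ∈ concat h
      x∈h = subst (x ∈_) (++-identityʳ (concat h)) (P .complete x∉u x∉bs (𝓛-avail S π∈𝓛 u π≡))
      go : ∀ b → best 0 h ≡ b →
        ∃[ ls ] ∃[ r ] ∃[ up ] h ≡ plug ls ((x ∷ r) ∷ up) × best 0 h ≡ just (length ls , x)
      go nothing b≡ = case subst (x ∈_) (best-nothing 0 h b≡) x∈h of λ ()
      go (just (j , z)) b≡ with best-plug h b≡ [] refl
      ... | ls , r , up , refl , refl with ord-injective (π-complete z) (≤-antisym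
              (All.lookup (best-minimum 0 (P .sorted) b≡) x∈h)
              (≤-trans (≤-reflexive ord-x) (alive-heap P (∈-resp-↭ (↭-sym
                (plug-pop-↭ ls {z} {(z ∷ r) ∷ up} {r ∷ up} ↭-refl)) (here refl)) .proj₂)))
      ... | refl = ls , r , up , refl , b≡

  -- Fixes the course of the second session and its amortised cost before the program runs, because
  -- `Work` states the cost in advance. A plan follows `π`, which the program does not know.
  data Plan : Word n → Word n → Heap → ℕ → Set where
    plan-end : ∀ {u h} → Plan u [] h 0
    plan-forced : ∀ {u x v h k} → x ∈ bs → Plan (u ∷ʳ x) v (insertAll (stepReports C u x) h) k →
             Plan u (x ∷ v) h (insertAllWork (stepReports C u x) h + k)
    plan-pop : ∀ {u x v k} ls r up → x ∉ bs → best 0 (plug ls ((x ∷ r) ∷ up)) ≡ just (length ls , x) →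
             Plan (u ∷ʳ x) v (insertAll (stepReports C u x) (plug ls (r ∷ up))) k →
             Plan u (x ∷ v) (plug ls ((x ∷ r) ∷ up))
               (suc (length ls) + (insertAllWork (stepReports C u x) (plug ls (r ∷ up)) + k))

  future : Word n → ℕ
  future [] = 0
  future (x ∷ v) with x ∈? bs
  ... | yes _ = future v
  ... | no _ = cap x + future v

  future-filter : ∀ v → future v ≡ sumBy cap (filter (λ x → ¬? (x ∈? bs)) v)
  future-filter [] = refl
  future-filter (x ∷ v) with x ∈? bs
  ... | yes _ = future-filter v
  ... | no _ = cong (cap x +_) (future-filter v)

  future-∈ : ∀ {x v} → x ∈ bs → future (x ∷ v) ≡ future v
  future-∈ {x} x∈ with x ∈? bs
  ... | yes _ = refl
  ... | no x∉ = ⊥-elim (x∉ x∈)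

  future-∉ : ∀ {x v} → x ∉ bs → future (x ∷ v) ≡ cap x + future v
  future-∉ {x} x∉ with x ∈? bs
  ... | yes x∈ = ⊥-elim (x∉ x∈)
  ... | no _ = refl

  -- Of the budget `45 * future v`, the part `Λ h - Φ h` has been spent on letters that are still in
  -- the heap; the bound is stated without subtraction.
  plan : ∀ u v h → π ≡ u ++ v → Pure u h [] → ∃[ k ] Plan u v h k × k + Λ h ≤ Φ h + 45 * future v
  plan u [] h π≡ P = 0 , plan-end , ≤-trans (≤-reflexive (empty-Λ (concat h) refl)) z≤n
    where
    weight-[] : ∀ g i h → concat h ≡ [] → weight g i h ≡ 0
    weight-[] g i [] e≡ = refl
    weight-[] g i ([] ∷ h) e≡ = weight-[] g (suc i) h e≡
    empty-Λ : ∀ ys → concat h ≡ ys → Λ h ≡ 0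
    empty-Λ [] e≡ = cong₂ (λ m s → 38 * m + 6 * s)
      (weight-[] (λ i x → i ⊓ cap x) 0 h e≡) (weight-[] (λ _ → cap) 0 h e≡)
    -- The heap must be empty now: a letter in it would be alive and thus have a position beyond the
    -- end of `π`.
    empty-Λ (y ∷ ys) e≡ = ⊥-elim (<⇒≱ (subst₂ (λ w l → ord w y < l) (sym (trans π≡ (++-identityʳ u))) refl
        (subst (λ w → ord w y < length u) (++-identityʳ u)
          (ord-∈ u (subst (y ∈_) (trans π≡ (++-identityʳ u)) (π-complete y)))))
      (All.lookup (P .good .proj₂) (∈-++⁺ˡ (subst (y ∈_) (sym e≡) (here refl))) .proj₂))
  plan u (x ∷ v) h π≡ P = go (x ∈? bs)
    where
    go : Dec (x ∈ bs) → ∃[ k ] Plan u (x ∷ v) h k × k + Λ h ≤ Φ h + 45 * future (x ∷ v)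
    go (yes x∈) with pure-forced π≡ x∈ P
    ... | P₁ with plan (u ∷ʳ x) v (insertAll (stepReports C u x) h) (π≡′ π≡) (insertAll-pure _ P₁)
    ... | k , pl , k≤ = insertAllWork R h + k , plan-forced x∈ pl ,
      subst (λ f → insertAllWork R h + k + Λ h ≤ Φ h + 45 * f) (sym (future-∈ x∈))
      (linear 0 (+-mono-≤ (insertAll-potential _ P₁) k≤)
        (identity (insertAllWork R h) k (Φ h) (Φ (insertAll R h)) (Λ h) (Λ (insertAll R h)) (future v)))
      where
      R : Word n
      R = stepReports C u x
      identity : ∀ v k f f₂ l l₂ t →
        v + k + l + (f + l₂ + (f₂ + 45 * t)) + 0 ≡ f + 45 * t + (v + f₂ + l + (k + l₂))
      identity = solve-∀
    go (no x∉) with best-next π≡ P x∉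
    ... | ls , r , up , refl , b≡ with pure-pop π≡ ls r up P
    ... | P₁ with plan (u ∷ʳ x) v (insertAll (stepReports C u x) (plug ls (r ∷ up))) (π≡′ π≡) (insertAll-pure _ P₁)
    ... | k , pl , k≤ = suc j + (i + k) , plan-pop ls r up x∉ b≡ pl ,
      subst₂ (λ f l → suc j + (i + k) + l ≤ Φ (plug ls ((x ∷ r) ∷ up)) + 45 * f) (sym (future-∉ x∉)) (sym Λ≡)
      (subst (λ f → suc j + (i + k) + (38 * (j ⊓ cap x + μ h₁) + 6 * (cap x + weight (λ _ → cap) 0 h₁)) ≤
                    f + 45 * (cap x + future v)) (sym (weight-pop (λ i _ → i) ls))
      -- The pop costs `suc j`, where `j` is released by `Φ`. The remaining 1 and the share of `x`
      -- in `Λ`, at most `38 * cap x + 6 * cap x`, add up to no more than `45 * cap x`.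
      (linear 0 (+-mono-≤ (+-mono-≤ (insertAll-potential _ P₁) k≤)
          (+-mono-≤ (*-monoʳ-≤ 38 (m⊓n≤n j (cap x))) (s≤s (z≤n {suc (lg (ord π x ∸ a x))}))))
        (identity j i k (j ⊓ cap x) (cap x) (Φ h₁) (Φ h₂) (μ h₁) (weight (λ _ → cap) 0 h₁) (Λ h₂) (future v))))
      where
      h₁ h₂ : Heap
      h₁ = plug ls (r ∷ up)
      h₂ = insertAll (stepReports C u x) h₁
      i j : ℕ
      i = insertAllWork (stepReports C u x) h₁
      j = length ls
      Λ≡ : Λ (plug ls ((x ∷ r) ∷ up)) ≡ 38 * (j ⊓ cap x + μ h₁) + 6 * (cap x + weight (λ _ → cap) 0 h₁)
      Λ≡ = cong₂ (λ m s → 38 * m + 6 * s) (weight-pop (λ i x → i ⊓ cap x) ls) (weight-pop (λ _ → cap) ls)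
      identity : ∀ j i k o c f₁ f₂ m s l₂ t →
        suc j + (i + k) + (38 * (o + m) + 6 * (c + s)) + (f₁ + l₂ + (f₂ + 45 * t) + (38 * c + c)) + 0 ≡
        j + f₁ + 45 * (c + t) + (i + f₂ + (38 * m + 6 * s) + (k + l₂) + (38 * o + 1))
      identity = solve-∀

-- Execution of the second session

module Outputting {n : ℕ} (A : Antimatroid n) (S : MPS n) (A≐S : Lang A ≐ 𝓛 S) (C : Candidate S)
                (π : Word n) (π∈𝓛 : 𝓛 S π) (π-complete : ∀ x → x ∈ π)
                (w : ℕ) (room : 16 * suc n ≤ 2 ^ w)
                (bs : Word n) (increasing : AllPairs (λ x y → ord π x < ord π y) bs) where

  open WordRAM w hiding (Run)
  open Machine C π w room (proj₁ π∈𝓛) π-complete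
  open HeapCode C π w room (proj₁ π∈𝓛) π-complete using (≤Lim)
  open HeapOps C π w room (proj₁ π∈𝓛) π-complete
  open Searching C π w room (proj₁ π∈𝓛) π-complete
  open Ranks π (proj₁ π∈𝓛) π-complete
  open Sessions A S A≐S C π π∈𝓛 π-complete w room
    using (Reported; reported; receive-reported; init-code; step-code; Forced; forced; ≤1+n⇒fits)
  open Planning S C π π∈𝓛 π-complete bs
  open Candidate C using (stepsTime)

  |bs|≤n : length bs ≤ n
  |bs|≤n = unique-length (AllPairs.map (λ b<c → λ { refl → <-irrefl refl b<c }) increasing)

  record Store (σ : State n) (u : Word n) (h : Heap) : Set where
    constructor store
    field
      forcing : Forced σ bs
      heap    : Heaped σ h
      places  : ∀ {y} → y ∈ concat h → arrays σ aPos (toℕ y) ≡ rank (ord π y) bs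
      current : regs σ rCur ≡ rank (length u) bs
  open Store

  heaped-≡ : ∀ {σ σ′ h} → arrays σ′ aLen ≡ arrays σ aLen → arrays σ′ aHeap ≡ arrays σ aHeap →
             arrays σ′ aMin ≡ arrays σ aMin → Heaped σ h → Heaped σ′ h
  heaped-≡ {h = h} l≡ h≡ m≡ (heaped R M cp ht) = heaped
    (subst₂ (λ f g → Runs f g 0 h) (sym l≡) (sym h≡) R) (subst (λ f → Mins f 0 h) (sym m≡) M) cp ht

  forced-≡ : ∀ {σ σ′} → regs σ′ rM ≡ regs σ rM → arrays σ′ aForced ≡ arrays σ aForced →
             arrays σ′ aIsForced ≡ arrays σ aIsForced → Forced σ bs → Forced σ′ bs
  forced-≡ m≡ t≡ f≡ (forced ct tb f1 f0) = forced (trans m≡ ct) (holds-≡ (sym t≡) tb)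
    (λ {x} x∈ → trans (cong (λ f → f (toℕ x)) f≡) (f1 x∈))
    (λ {x} x∉ → trans (cong (λ f → f (toℕ x)) f≡) (f0 x∉))

  insertLoop : Cmd
  insertLoop = while (op lt (reg rI) (reg rCount))
    (rY := aReport [ reg rI ]
     ⨾ rI := reg rI ⊕ lit 1
     ⨾ ifz (aIsForced [ reg rY ]) (search ⨾ insertHeap) skip)

  insert-letter : ∀ {σ u h y xs v} → π ≡ u ++ v → y ∉ bs → Pure u h (y ∷ xs) → regs σ rY ≡ toℕ y →
    Store σ u h → Work (search ⨾ insertHeap) σ 12 (insertWork y h) (λ σ′ → Store σ′ u (insert y h))
  insert-letter {σ} {u} {h} {y} π≡ y∉ P ry (store fo hp pl cu) =
    w-then (search-code bs increasing |bs|≤n y {L = lg (ord π y ∸ a y)}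
        (searchable (fo .Forced.count) (fo .Forced.table) ry) cu
        (rank-mono bs τ≤) bound)
      λ {σ₁} F pos≡ → w-map′ (λ F′ hp′ → store
          (forced-≡ (trans (F′ .reg≡ rM refl) (F .reg≡ rM refl)) (trans (F′ .arr≡ aForced refl) (F .arr≡ aForced refl))
            (trans (F′ .arr≡ aIsForced refl) (F .arr≡ aIsForced refl)) fo)
          hp′
          (λ z∈ → trans (cong (λ f → f _) (trans (F′ .arr≡ aPos refl) pos≡)) (place z∈))
          (trans (F′ .reg≡ rCur refl) (trans (F .reg≡ rCur refl) cu)))
        (insert-code h (trans (F .reg≡ rY refl) ry)
          (heaped-≡ (F .arr≡ aLen refl) (F .arr≡ aHeap refl) (F .arr≡ aMin refl) hp)
          (s≤s (unique-length (AllPairs.tail (good-here P .proj₁)))))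
    where
    alive : Alive (length u) y
    alive = All.head (good-here P .proj₂)
    τ≤ : length u ≤ ord π y
    τ≤ = alive .proj₂
    bound : suc (rank (ord π y) bs) < rank (length u) bs + 2 ^ suc (lg (ord π y ∸ a y))
    bound = begin-strict
      suc (rank (ord π y) bs) ≡⟨ cong (λ k → suc (rank k bs)) (sym (m∸n+n≡m τ≤)) ⟩
      suc (rank (ord π y ∸ length u + length u) bs) ≤⟨ s≤s (rank-+ (length u) (ord π y ∸ length u) increasing) ⟩
      suc (rank (length u) bs + (ord π y ∸ length u)) ≡⟨ sym (+-suc _ _) ⟩
      rank (length u) bs + suc (ord π y ∸ length u) ≤⟨ +-monoʳ-≤ _ (s≤s (∸-monoʳ-≤ (ord π y) (alive .proj₁))) ⟩
      rank (length u) bs + suc (ord π y ∸ a y) <⟨ +-monoʳ-< _ (lg-spec (ord π y ∸ a y) .proj₂ .proj₂) ⟩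
      rank (length u) bs + 2 ^ suc (lg (ord π y ∸ a y)) ∎
      where open ≤-Reasoning
    place : ∀ {z} → z ∈ concat (insert y h) →
            update (arrays σ aPos) (toℕ y) (rank (ord π y) bs) (toℕ z) ≡ rank (ord π z) bs
    place {z} z∈ with z Fin.≟ y
    ... | yes refl = update-same (arrays σ aPos) (toℕ y) _
    ... | no z≢y = trans (update-other (arrays σ aPos) _ (z≢y ∘ sym ∘ Fin.toℕ-injective))
      (case ∈-resp-↭ (insert-↭ y h) z∈ of λ { (here e≡) → ⊥-elim (z≢y e≡) ; (there q) → pl q })

  insert-loop : ∀ {σ u h v} i xs → π ≡ u ++ v → Pure u h xs → regs σ rI ≡ i → regs σ rCount ≡ i + length xs →
    Holds (arrays σ aReport) i xs → i + length xs ≤ suc n → Store σ u h →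
    Work insertLoop σ (1 + 16 * length xs) (insertAllWork xs h) (λ σ′ → Store σ′ u (insertAll xs h))
  insert-loop i [] π≡ P ri rc hs i≤ st =
    e-block (e-while0 (ev-lt0 (ev-reg ri) (ev-reg rc) (≤⇒≯ (≤-reflexive (+-identityʳ i)))) st)
  insert-loop {σ} {u} {h} i (y ∷ xs) π≡ P ri rc (e≡ , hs) i≤ st@(store fo hp pl cu) with y ∈? bs
  ... | yes y∈ = w-weaken (≤-trans (m≤m+n _ 15) (≤-reflexive (identity (length xs)))) ≤-refl
    (e-iter₀ (ev-lt1 (ev-reg ri) (ev-reg rc) (m<m+n i z<s))
    (e-seq (e-assign (ev-arr (ev-reg ri) e≡)
    (e-seq (e-assign (ev-add (ev-reg ri) ev-lit (≤1+n⇒fits (≤-trans (+-monoʳ-≤ i (s≤s z≤n)) i≤)))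
    (e-if1 (ev-arr (ev-reg refl) (fo .Forced.flagged y∈)) (e-skip
      (insert-loop (suc i) xs π≡ (pure-skip y∈ P) (+-comm i 1) (trans rc (+-suc i (length xs))) hs
        (subst (_≤ suc n) (+-suc i (length xs)) i≤)
        (store (forced-≡ refl refl refl fo) (heaped-≡ refl refl refl hp) pl cu)))))))))
    where
    identity : ∀ m → 2 + 16 * m + 15 ≡ 1 + 16 * suc m
    identity = solve-∀
  ... | no y∉ = w-weaken (≤-reflexive (cong suc (sym (*-suc 16 (length xs))))) ≤-refl
    (w-while (ev-lt1 (ev-reg ri) (ev-reg rc) (m<m+n i z<s))
    (w-seq (e-block (e-assign (ev-arr (ev-reg ri) e≡)
    (w-seq (e-block (e-assign (ev-add (ev-reg ri) ev-lit (≤1+n⇒fits (≤-trans (+-monoʳ-≤ i (s≤s z≤n)) i≤)))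
    (w-if0 (ev-arr (ev-reg refl) (fo .Forced.others y∉))
    (w-map′ (λ F st′ → insert-loop (suc i) xs π≡ (pure-insert y∉ P)
        (trans (F .reg≡ rI refl) (+-comm i 1))
        (trans (F .reg≡ rCount refl) (trans rc (+-suc i (length xs))))
        (holds-≡ (sym (F .arr≡ aReport refl)) hs)
        (subst (_≤ suc n) (+-suc i (length xs)) i≤) st′)
      (insert-letter {v = _} π≡ y∉ P refl
        (store (forced-≡ refl refl refl fo) (heaped-≡ refl refl refl hp) pl cu)))))))))))

  insert-reports : ∀ {σ u h xs v} → π ≡ u ++ v → Pure u h xs → Unique xs → Reported σ u xs → Store σ u h →
    Work insertReports σ (2 + 16 * length xs) (insertAllWork xs h) (λ σ′ → Store σ′ u (insertAll xs h))
  insert-reports {xs = xs} π≡ P uq (reported his rc hs) (store fo hp pl cu) =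
    w-seq (e-block (e-assign ev-lit (insert-loop 0 xs π≡ P refl rc hs (≤-trans (unique-length uq) (n≤1+n n))
      (store (forced-≡ refl refl refl fo) (heaped-≡ refl refl refl hp) pl cu))))

  record Chosen (σ′ : State n) (x : Fin n) (u : Word n) (h : Heap) : Set where
    constructor chosen
    field
      letter : regs σ′ rX ≡ toℕ x
      now    : regs σ′ rCur ≡ rank (suc (length u)) bs
      rest   : Heaped σ′ h

  module _ {u x v} (π≡ : π ≡ u ++ x ∷ v) where

    rank-ord : rank (ord π x) bs ≡ rank (length u) bs
    rank-ord = cong (λ k → rank k bs) (ord-x π≡)

    rank-next : rank (suc (ord π x)) bs ≡ rank (suc (length u)) bs
    rank-next = cong (λ k → rank (suc k) bs) (ord-x π≡)

    cur+1≤ : rank (length u) bs + 1 ≤ 8 * suc n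
    cur+1≤ = ≤1+n⇒fits (≤-trans (≤-reflexive (+-comm _ 1)) (s≤s (≤-trans (rank-≤ (length u) bs) |bs|≤n)))

    take-code : ∀ {σ h} → x ∈ bs → Store σ u h → ∀ {τ} → regs τ rCur ≡ regs σ rCur → arrays τ ≡ arrays σ →
      Exec takeForced τ 10 0 (λ σ′ → Chosen σ′ x u h)
    take-code {σ} {h} x∈ (store fo hp pl cu) {τ} c≡ refl = e-weaken (toWitness {a? = _ ≤? _} tt) ≤-refl
      (e-seq (e-assign (ev-add (ev-reg (trans c≡ cu)) ev-lit cur+1≤)
      (e-assign (ev-arr (ev-reg next) (holds-next increasing (fo .Forced.table) x∈))
      (chosen refl (trans next (trans (sym (rank-suc-∈ increasing x∈)) rank-next))
        (heaped-≡ {σ} refl refl refl hp)))))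
      where
      next : rank (length u) bs + 1 ≡ suc (rank (ord π x) bs)
      next = trans (+-comm _ 1) (cong suc (sym rank-ord))

    top-code : ∀ {σ h j z} → Store σ u h → best 0 h ≡ just (j , z) →
               Top (arrays σ aLen) (arrays σ aHeap) j z
    top-code {h = h} (store fo (heaped R M cp ht) pl cu) b≡ = best-top h R cp ht b≡

    min-code : ∀ {σ h} → Store σ u h → ∀ {b} → best 0 h ≡ b → arrays σ aMin 1 ≡ code b
    min-code {h = h} (store fo (heaped R M cp ht) pl cu) b≡ = trans (mins-head 0 h M) (cong code b≡)

    next-forced : ∀ {σ h} → x ∈ bs → Pure u h [] → Store σ u h →
                  Work nextLetter σ 6 0 (λ σ′ → Chosen σ′ x u h)
    next-forced {σ} {h} x∈ P st = w-weaken (s≤s z≤n) ≤-refl (go (best 0 h) refl)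
      where
      go : ∀ b → best 0 h ≡ b → Work nextLetter σ 1 0 (λ σ′ → Chosen σ′ x u h)
      go nothing b≡ = e-block (e-seq (e-assign (ev-arr ev-lit (min-code st b≡))
        (e-if0 (ev-reg refl) (take-code x∈ st refl refl))))
      go (just (j , z)) b≡ with top-code st b≡ | best-plug h b≡ [] refl
      ... | isTop l≡ c≡ f≤ | ls , r , up , h≡ , _ = e-block (e-seq (e-assign (ev-arr ev-lit (min-code st b≡))
        (e-if1 (ev-reg (code-just j {z} .proj₂)) (e-seq (e-assign
          (ev-arr (ev-add (ev-reg refl) (ev-arr (ev-reg refl) l≡) (≤Lim f≤)) c≡)
          (e-if1 (ev-lt1 (ev-reg (st .current)) (ev-arr (ev-reg refl) (st .places z∈)) later)
            (take-code x∈ st refl refl)))))))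
        where
        z∈ : z ∈ concat h
        z∈ = subst (λ h → z ∈ concat h) (sym h≡)
          (∈-resp-↭ (↭-sym (plug-pop-↭ ls {z} {(z ∷ r) ∷ up} {r ∷ up} ↭-refl)) (here refl))
        -- Ranks suffice to see that `z` is later: `x` is itself a forced letter before `z`, and
        -- `rCur` does not count it yet.
        later : rank (length u) bs < rank (ord π z) bs
        later = ≤-trans (≤-reflexive (trans (cong suc (sym rank-ord)) (sym (rank-suc-∈ increasing x∈))))
          (rank-mono bs (≤∧≢⇒< (≤-trans (≤-reflexive (ord-x π≡)) (alive-heap π≡ P z∈ .proj₂))
            λ e≡ → P .free z∈ (subst (_∈ bs) (ord-injective (π-complete x) e≡) x∈)))

    next-popped : ∀ {σ} ls r up → x ∉ bs → best 0 (plug ls ((x ∷ r) ∷ up)) ≡ just (length ls , x) →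
      Store σ u (plug ls ((x ∷ r) ∷ up)) →
      Work nextLetter σ 6 (suc (length ls)) (λ σ′ → Chosen σ′ x u (plug ls (r ∷ up)))
    next-popped {σ} ls r up x∉ b≡ st with top-code st b≡
    ... | isTop l≡ c≡ f≤ =
      w-seq (e-block (e-assign (ev-arr ev-lit (min-code st b≡))
      (w-if1 (ev-reg (code-just (length ls) {x} .proj₂))
      (w-seq (e-block (e-assign (ev-arr (ev-add (ev-reg refl) (ev-arr (ev-reg refl) l≡) (≤Lim f≤)) c≡)
      -- As `x` stands at position `length u`, the forced letters before it are just those already
      -- output.
      (w-if0 (ev-lt0 (ev-reg (st .current)) (ev-arr (ev-reg refl) (st .places x∈))
          (≤⇒≯ (≤-reflexive rank-ord)))
      (w-map′ (λ F hp → chosen (F .reg≡ rX refl)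
          (trans (F .reg≡ rCur refl) (trans (st .current) (trans (sym rank-ord)
            (trans (sym (rank-suc-∉ x∉)) rank-next)))) hp)
        (pop-code ls x r up refl (heaped-≡ {σ} refl refl refl (st .heap)))))))))))
      where
      x∈ : x ∈ concat (plug ls ((x ∷ r) ∷ up))
      x∈ = ∈-resp-↭ (↭-sym (plug-pop-↭ ls {x} {(x ∷ r) ∷ up} {r ∷ up} ↭-refl)) (here refl)

  outputLoop : Cmd
  outputLoop = while (op lt (reg rOut) (reg rN))
    (nextLetter
     ⨾ aOut [ reg rOut ]:= reg rX
     ⨾ rOut := reg rOut ⊕ lit 1
     ⨾ step (reg rX) rCount aReport
     ⨾ insertReports)

  record Written (σ : State n) (u : Word n) : Set where
    constructor written
    field
      bound  : regs σ rN ≡ n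
      next   : regs σ rOut ≡ length u
      output : Holds (arrays σ aOut) 0 u

  iteration-cost : ∀ s r t → r < s →
    suc (6 + (1 + (1 + (suc s + (2 + 16 * r)))) + (1 + 40 * t)) ≤ 1 + 40 * (s + t)
  iteration-cost s r t r<s = linear (8 + 19 * s) (+-mono-≤ (*-monoʳ-≤ 16 r<s) (*-monoʳ-≤ 4 (≤-trans (s≤s z≤n) r<s)))
    (identity s r t)
    where
    identity : ∀ s r t → suc (6 + (1 + (1 + (suc s + (2 + 16 * r)))) + (1 + 40 * t)) + (16 * s + 4 * s) + (8 + 19 * s) ≡
                         1 + 40 * (s + t) + (16 * suc r + 4 * 1)
    identity = solve-∀

  module _ {u x v} (π≡ : π ≡ u ++ x ∷ v) where

    |u|<n : length u < n
    |u|<n = subst (_≤ n) (|u∷ʳx| π≡) (unique-length (proj₁ (valid-step π≡)))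

    emit-code : ∀ {σ₀ σ h} → Frame nextLetter σ₀ σ → history σ₀ ≡ just u → Written σ₀ u →
      (∀ {y} → y ∈ concat h → arrays σ₀ aPos (toℕ y) ≡ rank (ord π y) bs) → Forced σ₀ bs →
      Chosen σ x u h → Pure (u ∷ʳ x) h (stepReports C u x) →
      Work (aOut [ reg rOut ]:= reg rX ⨾ rOut := reg rOut ⊕ lit 1 ⨾ step (reg rX) rCount aReport ⨾ insertReports)
        σ (1 + (1 + (suc (stepTime C u x) + (2 + 16 * length (stepReports C u x)))))
        (insertAllWork (stepReports C u x) h)
        (λ σ′ → history σ′ ≡ just (u ∷ʳ x) × Written σ′ (u ∷ʳ x) ×
                Store σ′ (u ∷ʳ x) (insertAll (stepReports C u x) h))
    emit-code {σ₀} {σ} {h} F his (written bd nx out) pl fo (chosen lx cu hp) P =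
      w-seq (e-block (e-store (ev-reg out≡) (ev-reg lx)
      (w-seq (e-block (e-assign (ev-add (ev-reg out≡) ev-lit
          (≤1+n⇒fits (≤-trans (≤-reflexive (+-comm (length u) 1)) (≤-trans |u|<n (n≤1+n n)))))
      (w-seq (step-code (trans (F .his≡ refl) his) lx (valid-step π≡)
      (w-map′ (λ F′ st → F′ .his≡ refl
          , written (trans (F′ .reg≡ rN refl) (trans (F .reg≡ rN refl) bd))
              (trans (F′ .reg≡ rOut refl) (trans (+-comm (length u) 1) (sym (|u∷ʳx| π≡))))
              (holds-≡ (sym (F′ .arr≡ aOut refl)) out′)
          , st)
        (insert-reports (π≡′ π≡) P uq (receive-reported
            {setReg rOut (length u + 1) (setCell aOut (length u) (toℕ x) σ)} R (u ∷ʳ x) uq)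
          (store (forced-≡ (F .reg≡ rM refl) (F .arr≡ aForced refl) (F .arr≡ aIsForced refl) fo)
            (heaped-≡ {σ} refl refl refl hp)
            (λ {y} y∈ → trans (cong (λ f → f (toℕ y)) (F .arr≡ aPos refl)) (pl y∈))
            (trans cu (cong (λ k → rank k bs) (sym (|u∷ʳx| π≡))))))))))))))
      where
      R : Word n
      R = stepReports C u x
      uq : Unique R
      uq = Candidate.step-unique C u x (valid-step π≡)
      out≡ : regs σ rOut ≡ length u
      out≡ = trans (F .reg≡ rOut refl) nx
      out′ : Holds (update (arrays σ aOut) (length u) (toℕ x)) 0 (u ∷ʳ x)
      out′ = holds-∷ʳ 0 u (holds-cong 0 u (λ j _ j< → trans (update-other (arrays σ aOut) (toℕ x) (<⇒≢ j< ∘ sym))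
          (cong (λ f → f j) (F .arr≡ aOut refl))) out) (update-same (arrays σ aOut) (length u) (toℕ x))

  output-loop : ∀ {σ u v h k} → Plan u v h k → π ≡ u ++ v → Pure u h [] → history σ ≡ just u →
    Written σ u → Store σ u h →
    Work outputLoop σ (1 + 40 * stepsTime u v) k (λ σ′ → Holds (arrays σ′ aOut) 0 π)
  output-loop {u = u} plan-end π≡ P his (written bd nx out) st = e-block (e-while0
    (ev-lt0 (ev-reg nx) (ev-reg bd) (≤⇒≯ (subst (_≤ length u) (length-tabulate {n = n} id)
      (unique-⊆-length (Unique.allFin⁺ n) λ {z} _ → subst (z ∈_) (trans π≡ (++-identityʳ u)) (π-complete z)))))
    (subst (Holds _ 0) (sym (trans π≡ (++-identityʳ u))) out))
  output-loop {σ} {u} {x ∷ v} {h} (plan-forced {k = k} x∈ pl) π≡ P his wr@(written bd nx _) st =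
    w-weaken (iteration-cost (stepTime C u x) (length R) (stepsTime (u ∷ʳ x) v)
      (Candidate.step-cost C u x (valid-step π≡))) ≤-refl
    (w-while (ev-lt1 (ev-reg nx) (ev-reg bd) (|u|<n π≡))
    (w-then (next-forced π≡ x∈ P st) λ F ch →
      w-map (λ (his′ , wr′ , st′) → output-loop pl (π≡′ π≡) (insertAll-pure R (pure-forced π≡ x∈ P)) his′ wr′ st′)
        (emit-code π≡ F his wr (st .places) (st .forcing) ch (pure-forced π≡ x∈ P))))
    where
    R : Word n
    R = stepReports C u x
  output-loop {σ} {u} {x ∷ v} (plan-pop {k = k} ls r up x∉ b≡ pl) π≡ P his wr@(written bd nx _) st =
    w-weaken (iteration-cost (stepTime C u x) (length R) (stepsTime (u ∷ʳ x) v)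
      (Candidate.step-cost C u x (valid-step π≡))) (≤-reflexive (+-assoc (suc (length ls)) _ k))
    (w-while (ev-lt1 (ev-reg nx) (ev-reg bd) (|u|<n π≡))
    (w-then (next-popped π≡ ls r up x∉ b≡ st) λ F ch →
      w-map (λ (his′ , wr′ , st′) → output-loop pl (π≡′ π≡) (insertAll-pure R (pure-pop π≡ ls r up P)) his′ wr′ st′)
        (emit-code π≡ F his wr (λ y∈ → st .places (∈-resp-↭ (↭-sym
          (plug-pop-↭ ls {x} {(x ∷ r) ∷ up} {r ∷ up} ↭-refl)) (there y∈))) (st .forcing) ch (pure-pop π≡ ls r up P))))
    where
    R : Word n
    R = stepReports C u x

  output-code : ∀ {σ k} → Plan [] π (insertAll (initReports C) []) k → regs σ rN ≡ n → regs σ rOut ≡ 0 →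
    regs σ rCur ≡ 0 → (∀ i → arrays σ aLen i ≡ 0) → (∀ i → arrays σ aMin i ≡ 0) → Forced σ bs →
    Work outputAll σ (suc (initTime C) + ((2 + 16 * length (initReports C)) + (1 + 40 * stepsTime [] π)))
      (insertAllWork (initReports C) [] + k) (λ σ′ → Holds (arrays σ′ aOut) 0 π)
  output-code {σ} pl rn ro rc len0 min0 fo = w-seq (init-code
    (w-then (insert-reports refl pure-init uq (receive-reported {σ} R [] uq)
        (store (forced-≡ refl refl refl fo)
          (heaped (λ j _ → len0 (2 ^ j)) (λ j _ → min0 (2 ^ j)) tt (s≤s z≤n)) (λ ())
          (trans rc (sym (rank-zero bs)))))
      λ F st → output-loop pl refl (insertAll-pure R pure-init) (F .his≡ refl)
        (written (trans (F .reg≡ rN refl) rn) (trans (F .reg≡ rOut refl) ro) tt) st))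
    where
    R : Word n
    R = initReports C
    uq : Unique R
    uq = Candidate.init-unique C

  output-time : suc (initTime C) + ((2 + 16 * length (initReports C)) + (1 + 40 * stepsTime [] π)) ≤
                40 * tᵗᵒᵗᵃˡ C
  output-time = ≤-trans (linear (16 + 19 * i) (+-mono-≤ (*-monoʳ-≤ 16 (Candidate.init-cost C))
      (*-monoʳ-≤ 4 (≤-trans (s≤s z≤n) (Candidate.init-cost C)))) (identity i (length (initReports C)) (stepsTime [] π)))
    (*-monoʳ-≤ 40 (session≤total C π∈𝓛))
    where
    i : ℕ
    i = initTime C
    identity : ∀ i r t → suc i + ((2 + 16 * r) + (1 + 40 * t)) + (16 * i + 4 * i) + (16 + 19 * i) ≡
                         40 * (i + t) + (16 * suc r + 4 * 1)
    identity = solve-∀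

-- The bounds

-- In logarithms, `F ≤ d * log N` gives `b * T + e * F ≤ (b + d * e) * (T + log
-- N)`, because `T` and `log N` are each at most their sum; the former needs `log N` to be
-- nonnegative.
power-bound : ∀ T N F b d e → 1 ≤ N → 2 ^ F ≤ N ^ d → 2 ^ (b * T + e * F) ≤ (2 ^ T * N) ^ (b + d * e)
power-bound T (suc N) F b d e _ F≤ = begin
  2 ^ (b * T + e * F)                         ≡⟨ ^-distribˡ-+-* 2 (b * T) (e * F) ⟩
  2 ^ (b * T) * 2 ^ (e * F)                   ≡⟨ cong₂ _*_ (split b T) (split e F) ⟩
  (2 ^ T) ^ b * (2 ^ F) ^ e                   ≤⟨ *-mono-≤ (^-monoˡ-≤ b (m≤m*n (2 ^ T) (suc N))) (^-monoˡ-≤ e F≤) ⟩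
  (2 ^ T * suc N) ^ b * (suc N ^ d) ^ e       ≡⟨ cong ((2 ^ T * suc N) ^ b *_) (^-*-assoc (suc N) d e) ⟩
  (2 ^ T * suc N) ^ b * suc N ^ (d * e)       ≤⟨ *-monoʳ-≤ ((2 ^ T * suc N) ^ b) (^-monoˡ-≤ (d * e)
                                                   (m≤n*m (suc N) (2 ^ T) {{m^n≢0 2 T}})) ⟩
  (2 ^ T * suc N) ^ b * (2 ^ T * suc N) ^ (d * e) ≡⟨ sym (^-distribˡ-+-* (2 ^ T * suc N) b (d * e)) ⟩
  (2 ^ T * suc N) ^ (b + d * e)               ∎
  where
  open ≤-Reasoning
  split : ∀ b T → 2 ^ (b * T) ≡ (2 ^ T) ^ b
  split b T = trans (cong (2 ^_) (*-comm b T)) (sym (^-*-assoc 2 T b))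

cost-bound : ∀ {t T N F k} b d e → 1 ≤ N → 2 ^ F ≤ N ^ d → t ≤ k * (b * T + e * F) →
             t ≤ (b + d * e) * k ·⟨ T +log₂ N ⟩
cost-bound {t} {T} {N} {F} {k} b d e N≥1 F≤ t≤ = begin
  2 ^ t                           ≤⟨ ^-monoʳ-≤ 2 t≤ ⟩
  2 ^ (k * (b * T + e * F))       ≡⟨ cong (2 ^_) (*-comm k _) ⟩
  2 ^ ((b * T + e * F) * k)       ≡⟨ sym (^-*-assoc 2 (b * T + e * F) k) ⟩
  (2 ^ (b * T + e * F)) ^ k       ≤⟨ ^-monoˡ-≤ k (power-bound T N F b d e N≥1 F≤) ⟩
  ((2 ^ T * N) ^ (b + d * e)) ^ k ≡⟨ ^-*-assoc (2 ^ T * N) (b + d * e) k ⟩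
  (2 ^ T * N) ^ ((b + d * e) * k) ∎
  where open ≤-Reasoning

holds-lookup : ∀ {n f} i (xs : Word n) → Holds f i xs → ∀ j → f (i + toℕ j) ≡ toℕ (lookup xs j)
holds-lookup {f = f} i (x ∷ xs) (e≡ , h) zero = trans (cong f (+-identityʳ i)) e≡
holds-lookup {f = f} i (x ∷ xs) (e≡ , h) (suc j) = trans (cong f (+-suc i (toℕ j))) (holds-lookup (suc i) xs h j)

module Correctness {n : ℕ} (A : Antimatroid n) (S : MPS n) (A≐S : Lang A ≐ 𝓛 S) (C : Candidate S)
                   (π : Word n) (π∈𝓛 : 𝓛 S π) (π-complete : ∀ x → x ∈ π)
                   (w : ℕ) (room : 16 * suc n ≤ 2 ^ w) where

  open Machine C π w room (proj₁ π∈𝓛) π-complete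
  open Sessions A S A≐S C π π∈𝓛 π-complete w room

  bs : Word n
  bs = forcedLetters

  result : Split (Outcome.done first) [] bs freeLetters
  result = Outcome.result first

  open Planning S C π π∈𝓛 π-complete bs
  open Outputting A S A≐S C π π∈𝓛 π-complete w room bs (Split.increasing result)

  frees : Word n
  frees = filter (λ x → ¬? (x ∈? bs)) π

  frees-unique : Unique frees
  frees-unique = Unique.filter⁺ (λ x → ¬? (x ∈? bs)) (proj₁ π∈𝓛)

  frees-count : length frees ≤ length freeLetters
  frees-count = unique-⊆-length frees-unique λ {z} z∈ →
    case Split.covers result (split-complete result z) of λ
      { (inj₁ z∈bs) → ⊥-elim (∈-filter⁻ (λ x → ¬? (x ∈? bs)) {xs = π} z∈ .proj₂ z∈bs)
      ; (inj₂ z∈ns) → z∈ns }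

  future-bound : 2 ^ future π ≤ ∣𝓟 A ∣ ^ 9
  future-bound = subst (λ f → 2 ^ f ≤ ∣𝓟 A ∣ ^ 9) (sym (future-filter π))
    (width≤cap {∣𝓟 A ∣} {length frees} frees
      (width-product A S A≐S π π-complete (proj₁ π∈𝓛) a a≤ available frees frees-unique)
      (≤-trans (^-monoʳ-≤ 2 frees-count) (split-count result)) ≤-refl)

  ∣𝓟∣≥1 : 1 ≤ ∣𝓟 A ∣
  ∣𝓟∣≥1 = positive ∣𝓟 A ∣ (≤-trans (m^n>0 2 (future π)) future-bound)
    where
    positive : ∀ m → 1 ≤ m ^ 9 → 1 ≤ m
    positive (suc m) _ = s≤s z≤n

  start-heap : Heap
  start-heap = insertAll (initReports C) []

  planned : ∃[ k ] Plan [] π start-heap k × k + Λ start-heap ≤ Φ start-heap + 45 * future π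
  planned = plan [] π start-heap refl (insertAll-pure _ pure-init)

  comparisons : ℕ
  comparisons = insertAllWork (initReports C) [] + planned .proj₁

  comparisons-bound : comparisons ≤ 45 * future π
  comparisons-bound = linear 0 (+-mono-≤ (insertAll-potential (initReports C) pure-init) (planned .proj₂ .proj₂))
    (identity (insertAllWork (initReports C) []) (planned .proj₁) (Φ start-heap) (Λ start-heap) (future π))
    where
    identity : ∀ i k f l t → i + k + (l + (f + 45 * t)) + 0 ≡ 45 * t + (i + f + 0 + (k + l))
    identity = solve-∀

  program-code : Work program (start n) (50 * tᵗᵒᵗᵃˡ C) comparisons (λ σ → Holds (arrays σ aOut) 0 π)
  program-code = w-weaken
    (≤-trans (+-mono-≤ find-time output-time) (≤-reflexive (sym (*-distribʳ-+ (tᵗᵒᵗᵃˡ C) 10 40)))) ≤-refl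
    (w-then find-code λ F fo → output-code (planned .proj₂ .proj₁)
      (F .reg≡ rN refl) (F .reg≡ rOut refl) (F .reg≡ rCur refl)
      (λ i → cong (λ f → f i) (F .arr≡ aLen refl)) (λ i → cong (λ f → f i) (F .arr≡ aMin refl)) fo)

  Sorts : Set
  Sorts = ∃[ σ ] ∃[ t ] ∃[ q ]
    (Run w C π program (start n) σ t q × Outputs σ π
     × t ≤ (50 + 9 * 45) * K ·⟨ tᵗᵒᵗᵃˡ C +log₂ ∣𝓟 A ∣ ⟩
     × q ≤ (50 + 9 * 45) * K ·⟨ 0 +log₂ ∣𝓟 A ∣ ⟩)

  conclude : Exec program (start n) (K * (50 * tᵗᵒᵗᵃˡ C + comparisons)) comparisons
                  (λ σ → Holds (arrays σ aOut) 0 π) → Sorts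
  conclude (exec {σ} {t} {q} R t≤ q≤ out) = σ , t , q , R , holds-lookup 0 π out
    , cost-bound {t} {tᵗᵒᵗᵃˡ C} {∣𝓟 A ∣} {future π} {K} 50 9 45 ∣𝓟∣≥1 future-bound
        (≤-trans t≤ (*-monoʳ-≤ K (+-monoʳ-≤ (50 * tᵗᵒᵗᵃˡ C) comparisons-bound)))
    -- With `T = 0` the cost of the sessions drops out. The factor `K` is given away so that both
    -- bounds share one constant.
    , cost-bound {q} {0} {∣𝓟 A ∣} {future π} {K} 50 9 45 ∣𝓟∣≥1 future-bound
        (≤-trans q≤ (≤-trans comparisons-bound (≤-trans (≤-reflexive (sym (*-identityˡ _)))
          (*-monoˡ-≤ (45 * future π) (≤K {t = 1})))))
  sorts : Sorts
  sorts = conclude (unwork program-code)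

theorem9 : ∃[ prog ] ∃[ c ] ∃[ κ ]
    (∀ (n w : ℕ) → 2 ^ κ * suc n ≤ 2 ^ w →
    (A : Antimatroid n) (S : MPS n) → Lang A ≐ 𝓛 S →
    (C : Candidate S) (π : Word n) → 𝓟 A π →
    ∃[ σ ] ∃[ t ] ∃[ q ]
    (Run w C π prog (start n) σ t q
    × Outputs σ π
    × t ≤ c ·⟨ tᵗᵒᵗᵃˡ C +log₂ ∣𝓟 A ∣ ⟩
    × q ≤ c ·⟨ 0 +log₂ ∣𝓟 A ∣ ⟩))
-- The witness 4 for `κ` gives the factor `2 ^ 4 = 16` of `room`.
theorem9 = program , (50 + 9 * 45) * K , 4 , λ n w room A S A≐S C π (A∋π , full) →
  Correctness.sorts A S A≐S C π (proj₁ A≐S A∋π) full w room
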